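{- Let $\{H^{(n)}\}$ be a family of decreasing gap sequences $H^{(n)}=(h_{n,1}>\cdots>h_{n,p_n}=1)$. Suppose that for a fixed $c>0$, $W_n(H^{(n)})=O(n(\log n)^c)$. For every fixed $\varepsilon>0$, set $$s_n=\left\lfloor\frac{\log n}{(c+\varepsilon)\log\log n}\right\rfloor.$$ Then, for all sufficiently large $n$, $$p_n\ge s_n+1\qquad\text{and}\qquad h_{n,s_n+1}=\Omega\!\left(\frac{n}{(\log n)^c}\right).$$ Thus any such family must contain $\Omega(\log n/\log\log n)$ gaps of order at least $n/(\log n)^c$.
   Context: Shellsort: a gap sequence is a decreasing sequence of positive integers $H=(h_1>h_2>\cdots>h_p=1)$. On an array of $n$ distinct keys (a permutation), pass $j$ runs ordinary insertion sort separately on each $h_j$-chain, i.e. on each set of positions with the same remainder modulo $h_j$: each key is repeatedly exchanged with the key $h_j$ positions before it while the two are out of order. Passes are run for $j=1,2,\dots,p$. $W_n(H)$ is the worst-case (over all inputs of $n$ keys) total number of exchanges. Logarithms are natural. -}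

module Defs where

open import Algebra.Bundles using (CommutativeRing)
import Algebra.Properties.Semiring.Exp
import Algebra.Properties.CommutativeSemiring.Exp
open import Data.Nat.Base as ℕ using (ℕ; zero; suc)
import Data.Nat.Properties as ℕ
open import Data.Integer.Base as ℤ using (ℤ; +_; -[1+_])
import Data.Integer.Properties as ℤ
open import Data.Rational.Base
open import Data.Rational.Properties
import Data.Rational.Unnormalised.Base as ℚᵘ
import Data.Rational.Unnormalised.Properties as ℚᵘ
open import Data.Rational.Solver using (module +-*-Solver)
open import Data.Product.Base using (Σ; Σ-syntax; _×_; _,_; proj₁; proj₂)
open import Data.Sum.Base using (_⊎_; inj₁; inj₂; [_,_]′)
open import Data.Empty using (⊥-elim)
open import Relation.Nullary using (¬_; Dec; yes; no; does; contradiction)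
open import Relation.Binary.PropositionalEquality
open import Data.Bool.Base using (if_then_else_)
open import Data.Fin.Base as Fin using (Fin)
import Data.Fin.Properties as Fin
open import Data.List.Base using (List; []; _∷_; allFin; cartesianProductWith; filter; foldl; map; upTo)
open import Data.List.Extrema.Nat using (max)
open import Data.Vec.Base using (Vec; []; _∷_; lookup; _[_]≔_)
open import Data.Vec.Relation.Unary.AllPairs using (allPairs?)
open import Relation.Nullary.Decidable using (¬?)

open CommutativeRing +-*-commutativeRing using (semiring; commutativeSemiring)
open Algebra.Properties.Semiring.Exp semiring using (_^_; ^-homo-*; ^-assocʳ)
open Algebra.Properties.CommutativeSemiring.Exp commutativeSemiring
  using (^-distrib-*)
open +-*-Solver using (solve; _:=_; _:+_; _:*_; _:-_; :-_; con)

ι : ℕ → ℚ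
ι n = + n / 1

r : ℕ → ℚ
r n = + 1 / suc n

toℚᵘ-/ : ∀ i n → toℚᵘ (i / suc n) ℚᵘ.≃ ℚᵘ.mkℚᵘ i n
toℚᵘ-/ i n = toℚᵘ-fromℚᵘ (ℚᵘ.mkℚᵘ i n)

ι-suc : ∀ n → ι (suc n) ≡ 1ℚ + ι n
ι-suc n = toℚᵘ-injective (ℚᵘ.≃-trans (toℚᵘ-/ (+ suc n) 0)
  (ℚᵘ.≃-sym (ℚᵘ.≃-trans (toℚᵘ-homo-+ 1ℚ (ι n))
    (ℚᵘ.≃-trans (ℚᵘ.+-congʳ ℚᵘ.1ℚᵘ (toℚᵘ-/ (+ n) 0)) (ℚᵘ.*≡* lemma)))))
  where
  lemma : (+ 1 ℤ.* + 1 ℤ.+ + n ℤ.* + 1) ℤ.* + 1 ≡ + suc n ℤ.* + 1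
  lemma = cong (ℤ._* + 1) (cong (λ z → + 1 ℤ.+ z) (ℤ.*-identityʳ (+ n)))

ι*r : ∀ n → ι (suc n) * r n ≡ 1ℚ
ι*r n = toℚᵘ-injective (ℚᵘ.≃-trans (toℚᵘ-homo-* (ι (suc n)) (r n))
  (ℚᵘ.≃-trans (ℚᵘ.*-cong (toℚᵘ-/ (+ suc n) 0) (toℚᵘ-/ (+ 1) n)) (ℚᵘ.*≡* lemma)))
  where
  lemma : (+ suc n ℤ.* + 1) ℤ.* + 1 ≡ + 1 ℤ.* (+ 1 ℤ.* + suc n)
  lemma = trans (trans (ℤ.*-identityʳ (+ suc n ℤ.* + 1)) (ℤ.*-identityʳ (+ suc n)))
                (sym (trans (ℤ.*-identityˡ (+ 1 ℤ.* + suc n)) (ℤ.*-identityˡ (+ suc n))))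

0≤1 : 0ℚ ≤ 1ℚ
0≤1 = *≤* (ℤ.+≤+ ℕ.z≤n)

0≤p*q : ∀ {p q} → 0ℚ ≤ p → 0ℚ ≤ q → 0ℚ ≤ p * q
0≤p*q {p} {q} 0≤p 0≤q = nonNegative⁻¹ (p * q)
  {{nonNeg*nonNeg⇒nonNeg p {{nonNegative 0≤p}} q {{nonNegative 0≤q}}}}

0<p*q : ∀ {p q} → 0ℚ < p → 0ℚ < q → 0ℚ < p * q
0<p*q {p} {q} 0<p 0<q = positive⁻¹ (p * q)
  {{pos*pos⇒pos p {{positive 0<p}} q {{positive 0<q}}}}

0≤p+q : ∀ {p q} → 0ℚ ≤ p → 0ℚ ≤ q → 0ℚ ≤ p + q
0≤p+q = +-mono-≤

+⇒≤ : ∀ {p q} e → 0ℚ ≤ e → q ≡ p + e → p ≤ q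
+⇒≤ {p} {q} e 0≤e q≡ = begin
  p       ≡⟨ +-identityʳ p ⟨
  p + 0ℚ  ≤⟨ +-monoʳ-≤ p 0≤e ⟩
  p + e   ≡⟨ q≡ ⟨
  q       ∎
  where open ≤-Reasoning

+⇒< : ∀ {p q} e → 0ℚ < e → q ≡ p + e → p < q
+⇒< {p} {q} e 0<e q≡ = begin-strict
  p       ≡⟨ +-identityʳ p ⟨
  p + 0ℚ  <⟨ +-monoʳ-< p 0<e ⟩
  p + e   ≡⟨ q≡ ⟨
  q       ∎
  where open ≤-Reasoning

p-q+q : ∀ p q → p ≡ q + (p - q)
p-q+q = solve 2 (λ p q → p := q :+ (p :- q)) refl

p≤q⇒0≤q-p : ∀ {p q} → p ≤ q → 0ℚ ≤ q - p
p≤q⇒0≤q-p {p} {q} p≤q =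
  subst (_≤ q - p) (+-inverseʳ p) (+-monoˡ-≤ (- p) p≤q)

p<q⇒0<q-p : ∀ {p q} → p < q → 0ℚ < q - p
p<q⇒0<q-p {p} {q} p<q =
  subst (_< q - p) (+-inverseʳ p) (+-monoˡ-< (- p) p<q)

*-mono : ∀ {a b c d} → 0ℚ ≤ b → 0ℚ ≤ c → a ≤ b → c ≤ d → a * c ≤ b * d
*-mono {a} {b} {c} {d} 0≤b 0≤c a≤b c≤d = ≤-trans
  (*-monoʳ-≤-nonNeg c {{nonNegative 0≤c}} a≤b)
  (*-monoˡ-≤-nonNeg b {{nonNegative 0≤b}} c≤d)

*-monoʳ : ∀ {a b} c → 0ℚ ≤ c → a ≤ b → a * c ≤ b * c
*-monoʳ c 0≤c = *-monoʳ-≤-nonNeg c {{nonNegative 0≤c}}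

*-monoˡ : ∀ {a b} c → 0ℚ ≤ c → a ≤ b → c * a ≤ c * b
*-monoˡ c 0≤c = *-monoˡ-≤-nonNeg c {{nonNegative 0≤c}}

p≤p*q : ∀ {p q} → 0ℚ ≤ p → 1ℚ ≤ q → p ≤ p * q
p≤p*q {p} 0≤p 1≤q =
  subst (_≤ p * _) (*-identityʳ p) (*-monoˡ p 0≤p 1≤q)

0≤ι : ∀ n → 0ℚ ≤ ι n
0≤ι zero    = ≤-refl
0≤ι (suc n) = subst (0ℚ ≤_) (sym (ι-suc n)) (0≤p+q 0≤1 (0≤ι n))

0<r : ∀ n → 0ℚ < r n
0<r n = positive⁻¹ (r n) {{normalize-pos 1 (suc n)}}

0≤r : ∀ n → 0ℚ ≤ r n
0≤r n = <⇒≤ (0<r n)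

ι-mono : ∀ {m n} → m ℕ.≤ n → ι m ≤ ι n
ι-mono {n = n} ℕ.z≤n = 0≤ι n
ι-mono {suc m} {suc n} (ℕ.s≤s m≤n) =
  subst₂ _≤_ (sym (ι-suc m)) (sym (ι-suc n)) (+-monoʳ-≤ 1ℚ (ι-mono m≤n))

ι-* : ∀ m n → ι (m ℕ.* n) ≡ ι m * ι n
ι-* m n = toℚᵘ-injective (ℚᵘ.≃-trans (toℚᵘ-/ (+ (m ℕ.* n)) 0)
  (ℚᵘ.≃-sym (ℚᵘ.≃-trans (toℚᵘ-homo-* (ι m) (ι n))
    (ℚᵘ.≃-trans (ℚᵘ.*-cong (toℚᵘ-/ (+ m) 0) (toℚᵘ-/ (+ n) 0))
      (ℚᵘ.*≡* (cong (ℤ._* + 1) (sym (ℤ.pos-* m n))))))))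

ι-+ : ∀ m n → ι (m ℕ.+ n) ≡ ι m + ι n
ι-+ zero    n = sym (+-identityˡ (ι n))
ι-+ (suc m) n = begin
  ι (suc (m ℕ.+ n))   ≡⟨ ι-suc (m ℕ.+ n) ⟩
  1ℚ + ι (m ℕ.+ n)    ≡⟨ cong (λ z → 1ℚ + z) (ι-+ m n) ⟩
  1ℚ + (ι m + ι n)    ≡⟨ +-assoc 1ℚ (ι m) (ι n) ⟨
  (1ℚ + ι m) + ι n    ≡⟨ cong (_+ ι n) (ι-suc m) ⟨
  ι (suc m) + ι n     ∎
  where open ≡-Reasoning

r-* : ∀ {k m n} → suc k ≡ suc m ℕ.* suc n → r k ≡ r m * r n
r-* {k} {m} {n} eq = begin
  r k                                          ≡⟨ *-identityʳ (r k) ⟨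
  r k * 1ℚ                                     ≡⟨ cong (r k *_) (cong₂ _*_ (ι*r m) (ι*r n)) ⟨
  r k * ((ι (suc m) * r m) * (ι (suc n) * r n))
    ≡⟨ solve 5 (λ k M m N n → k :* ((M :* m) :* (N :* n)) := ((M :* N) :* k) :* (m :* n))
         refl (r k) (ι (suc m)) (r m) (ι (suc n)) (r n) ⟩
  ((ι (suc m) * ι (suc n)) * r k) * (r m * r n)
    ≡⟨ cong (λ z → (z * r k) * (r m * r n)) (trans (sym (ι-* (suc m) (suc n))) (cong ι (sym eq))) ⟩
  (ι (suc k) * r k) * (r m * r n)              ≡⟨ cong (_* (r m * r n)) (ι*r k) ⟩
  1ℚ * (r m * r n)                             ≡⟨ *-identityˡ _ ⟩
  r m * r n                                    ∎
  where open ≡-Reasoning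

r-antimono : ∀ {m n} → m ℕ.≤ n → r n ≤ r m
r-antimono {m} {n} m≤n = begin
  r n                        ≡⟨ *-identityˡ (r n) ⟨
  1ℚ * r n                   ≡⟨ cong (_* r n) (ι*r m) ⟨
  (ι (suc m) * r m) * r n
    ≡⟨ solve 3 (λ a b c → (a :* b) :* c := a :* (b :* c)) refl (ι (suc m)) (r m) (r n) ⟩
  ι (suc m) * (r m * r n)    ≤⟨ *-monoʳ _ (0≤p*q (0≤r m) (0≤r n)) (ι-mono (ℕ.s≤s m≤n)) ⟩
  ι (suc n) * (r m * r n)
    ≡⟨ solve 3 (λ a b c → a :* (b :* c) := b :* (a :* c)) refl (ι (suc n)) (r m) (r n) ⟩
  r m * (ι (suc n) * r n)    ≡⟨ cong (r m *_) (ι*r n) ⟩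
  r m * 1ℚ                   ≡⟨ *-identityʳ (r m) ⟩
  r m                        ∎
  where open ≤-Reasoning

archimedean : ∀ q → Σ[ B ∈ ℕ ] q ≤ ι B
archimedean q@(mkℚ i d _) = ℤ.∣ i ∣ , toℚᵘ-cancel-≤
  (ℚᵘ.≤-respʳ-≃ (ℚᵘ.≃-sym (toℚᵘ-/ (+ ℤ.∣ i ∣) 0)) (ℚᵘ.*≤* (lemma i)))
  where
  lemma : ∀ i → i ℤ.* + 1 ℤ.≤ + ℤ.∣ i ∣ ℤ.* + suc d
  lemma (+ n)    = subst₂ ℤ._≤_ (ℤ.pos-* n 1) (ℤ.pos-* n (suc d))
                     (ℤ.+≤+ (ℕ.*-monoʳ-≤ n (ℕ.s≤s ℕ.z≤n)))
  lemma -[1+ n ] = ℤ.-≤+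

r-small : ∀ {ε} → 0ℚ < ε → Σ[ N ∈ ℕ ] r N ≤ ε
r-small {ε} 0<ε = N , (begin
  r N                   ≡⟨ *-identityʳ (r N) ⟨
  r N * 1ℚ              ≡⟨ cong (r N *_) (*-inverseʳ ε) ⟨
  r N * (ε * 1/ ε)      ≤⟨ *-monoˡ (r N) (0≤r N) (*-monoˡ ε (<⇒≤ 0<ε) (≤-trans bound (ι-mono (ℕ.n≤1+n N)))) ⟩
  r N * (ε * ι (suc N)) ≡⟨ solve 3 (λ a b c → a :* (b :* c) := b :* (c :* a)) refl (r N) ε (ι (suc N)) ⟩
  ε * (ι (suc N) * r N) ≡⟨ cong (ε *_) (ι*r N) ⟩
  ε * 1ℚ                ≡⟨ *-identityʳ ε ⟩
  ε                     ∎)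
  where
  open ≤-Reasoning
  instance
    ε≢0 : NonZero ε
    ε≢0 = >-nonZero 0<ε
  N = proj₁ (archimedean (1/ ε))
  bound = proj₂ (archimedean (1/ ε))

∣p∣≤ : ∀ {p e} → p ≤ e → - e ≤ p → ∣ p ∣ ≤ e
∣p∣≤ {p} {e} p≤e -e≤p with ∣p∣≡p∨∣p∣≡-p p
... | inj₁ eq = subst (_≤ e) (sym eq) p≤e
... | inj₂ eq = subst (_≤ e) (sym eq)
  (subst (- p ≤_) (solve 1 (λ e → :- (:- e) := e) refl e) (neg-antimono-≤ -e≤p))

p≤∣p∣ : ∀ p → p ≤ ∣ p ∣
p≤∣p∣ p with ∣p∣≡p∨∣p∣≡-p p
... | inj₁ eq = ≤-reflexive (sym eq)
... | inj₂ eq with ≤-total 0ℚ p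
...   | inj₁ 0≤p = ≤-reflexive (sym (0≤p⇒∣p∣≡p 0≤p))
...   | inj₂ p≤0 = ≤-trans p≤0 (0≤∣p∣ p)

∣p∣≤⇒≤ : ∀ {p e} → ∣ p ∣ ≤ e → p ≤ e
∣p∣≤⇒≤ = ≤-trans (p≤∣p∣ _)

∣p∣≤⇒-≤ : ∀ {p e} → ∣ p ∣ ≤ e → - e ≤ p
∣p∣≤⇒-≤ {p} {e} h = subst (- e ≤_) (solve 1 (λ p → :- (:- p) := p) refl p)
  (neg-antimono-≤ (≤-trans (p≤∣p∣ (- p)) (subst (_≤ e) (sym (∣-p∣≡∣p∣ p)) h)))

∣p-q∣-comm : ∀ p q → ∣ p - q ∣ ≡ ∣ q - p ∣
∣p-q∣-comm p q = trans (sym (∣-p∣≡∣p∣ (p - q)))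
  (cong ∣_∣ (solve 2 (λ p q → :- (p :- q) := q :- p) refl p q))

∣p-s∣≤ : ∀ p q s → ∣ p - s ∣ ≤ ∣ p - q ∣ + ∣ q - s ∣
∣p-s∣≤ p q s = subst (_≤ ∣ p - q ∣ + ∣ q - s ∣)
  (cong ∣_∣ (solve 3 (λ p q s → (p :- q) :+ (q :- s) := p :- s) refl p q s))
  (∣p+q∣≤∣p∣+∣q∣ (p - q) (q - s))

∣p*q∣≤ : ∀ {p q a b} → ∣ p ∣ ≤ a → ∣ q ∣ ≤ b → ∣ p * q ∣ ≤ a * b
∣p*q∣≤ {p} {q} {a} {b} p≤a q≤b = subst (_≤ a * b) (sym (∣p*q∣≡∣p∣*∣q∣ p q))
  (*-mono (≤-trans (0≤∣p∣ p) p≤a) (0≤∣p∣ q) p≤a q≤b)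

∣p+q∣≤ : ∀ {p q a b} → ∣ p ∣ ≤ a → ∣ q ∣ ≤ b → ∣ p + q ∣ ≤ a + b
∣p+q∣≤ {p} {q} p≤a q≤b = ≤-trans (∣p+q∣≤∣p∣+∣q∣ p q) (+-mono-≤ p≤a q≤b)

^-nonNeg : ∀ {a} → 0ℚ ≤ a → ∀ n → 0ℚ ≤ a ^ n
^-nonNeg 0≤a zero    = 0≤1
^-nonNeg 0≤a (suc n) = 0≤p*q 0≤a (^-nonNeg 0≤a n)

^-pos : ∀ {a} → 0ℚ < a → ∀ n → 0ℚ < a ^ n
^-pos 0<a zero    = *<* (ℤ.+<+ (ℕ.s≤s ℕ.z≤n))
^-pos 0<a (suc n) = 0<p*q 0<a (^-pos 0<a n)

^-monoˡ : ∀ {a b} → 0ℚ ≤ a → a ≤ b → ∀ n → a ^ n ≤ b ^ n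
^-monoˡ 0≤a a≤b zero    = ≤-refl
^-monoˡ 0≤a a≤b (suc n) =
  *-mono (≤-trans 0≤a a≤b) (^-nonNeg 0≤a n) a≤b (^-monoˡ 0≤a a≤b n)

1≤^ : ∀ {a} → 1ℚ ≤ a → ∀ n → 1ℚ ≤ a ^ n
1≤^ 1≤a zero    = ≤-refl
1≤^ 1≤a (suc n) = ≤-trans 1≤a (p≤p*q (≤-trans 0≤1 1≤a) (1≤^ 1≤a n))

^≤1 : ∀ {a} → 0ℚ ≤ a → a ≤ 1ℚ → ∀ n → a ^ n ≤ 1ℚ
^≤1 0≤a a≤1 zero    = ≤-refl
^≤1 0≤a a≤1 (suc n) = *-mono 0≤1 (^-nonNeg 0≤a n) a≤1 (^≤1 0≤a a≤1 n)

^-monoʳ : ∀ {a m n} → 1ℚ ≤ a → m ℕ.≤ n → a ^ m ≤ a ^ n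
^-monoʳ {n = n} 1≤a ℕ.z≤n = 1≤^ 1≤a n
^-monoʳ {a} 1≤a (ℕ.s≤s m≤n) = *-monoˡ a (≤-trans 0≤1 1≤a) (^-monoʳ 1≤a m≤n)

∣^∣≤ : ∀ {a e} → ∣ a ∣ ≤ e → ∀ n → ∣ a ^ n ∣ ≤ e ^ n
∣^∣≤ h zero    = ≤-refl
∣^∣≤ h (suc n) = ∣p*q∣≤ h (∣^∣≤ h n)

^-lipschitz : ∀ {u v U V d} → ∣ u - v ∣ ≤ d → ∣ u ∣ ≤ U → ∣ v ∣ ≤ V →
              1ℚ ≤ U → 1ℚ ≤ V → ∀ n →
              ∣ u ^ n - v ^ n ∣ ≤ ι n * d * (U ^ n * V ^ n)
^-lipschitz {u} {v} {U} {V} {d} duv hu hv 1≤U 1≤V zero =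
  ≤-reflexive (sym (trans (cong (_* (1ℚ * 1ℚ)) (*-zeroˡ d)) (*-zeroˡ (1ℚ * 1ℚ))))
^-lipschitz {u} {v} {U} {V} {d} duv hu hv 1≤U 1≤V (suc n) = begin
  ∣ u * u ^ n - v * v ^ n ∣
    ≡⟨ cong ∣_∣ (solve 4 (λ u x v y → u :* x :- v :* y := u :* (x :- y) :+ (u :- v) :* y)
         refl u (u ^ n) v (v ^ n)) ⟩
  ∣ u * (u ^ n - v ^ n) + (u - v) * v ^ n ∣
    ≤⟨ ∣p+q∣≤ (∣p*q∣≤ hu (^-lipschitz duv hu hv 1≤U 1≤V n)) (∣p*q∣≤ duv (∣^∣≤ hv n)) ⟩
  U * (ι n * d * (U ^ n * V ^ n)) + d * V ^ n
    ≤⟨ +-mono-≤ (p≤p*q (0≤p*q 0≤U (0≤p*q (0≤p*q (0≤ι n) 0≤d) (0≤p*q 0≤Uⁿ 0≤Vⁿ))) 1≤V)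
                (≤-trans (p≤p*q (0≤p*q 0≤d 0≤Vⁿ) 1≤V)
                         (p≤p*q (0≤p*q (0≤p*q 0≤d 0≤Vⁿ) 0≤V) (1≤^ 1≤U (suc n)))) ⟩
  U * (ι n * d * (U ^ n * V ^ n)) * V + d * V ^ n * V * (U * U ^ n)
    ≡⟨ solve 6 (λ k d U V x y → U :* (k :* d :* (x :* y)) :* V :+ d :* y :* V :* (U :* x)
                  := (con 1ℚ :+ k) :* d :* ((U :* x) :* (V :* y)))
         refl (ι n) d U V (U ^ n) (V ^ n) ⟩
  (1ℚ + ι n) * d * ((U * U ^ n) * (V * V ^ n))
    ≡⟨ cong (λ z → z * d * ((U * U ^ n) * (V * V ^ n))) (ι-suc n) ⟨
  ι (suc n) * d * ((U * U ^ n) * (V * V ^ n)) ∎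
  where
  open ≤-Reasoning
  0≤d  = ≤-trans (0≤∣p∣ (u - v)) duv
  0≤U  = ≤-trans 0≤1 1≤U
  0≤V  = ≤-trans 0≤1 1≤V
  0≤Uⁿ = ^-nonNeg 0≤U n
  0≤Vⁿ = ^-nonNeg 0≤V n

bernoulli : ∀ {t} → 0ℚ ≤ t → ∀ n → 1ℚ + ι n * t ≤ (1ℚ + t) ^ n
bernoulli {t} 0≤t zero = ≤-reflexive (trans (cong (λ z → 1ℚ + z) (*-zeroˡ t)) (+-identityʳ 1ℚ))
bernoulli {t} 0≤t (suc n) = begin
  1ℚ + ι (suc n) * t              ≡⟨ cong (λ z → 1ℚ + z * t) (ι-suc n) ⟩
  1ℚ + (1ℚ + ι n) * t
    ≤⟨ +⇒≤ (ι n * (t * t)) (0≤p*q (0≤ι n) (0≤p*q 0≤t 0≤t))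
         (solve 2 (λ k t → (con 1ℚ :+ t) :* (con 1ℚ :+ k :* t)
            := con 1ℚ :+ (con 1ℚ :+ k) :* t :+ k :* (t :* t)) refl (ι n) t) ⟩
  (1ℚ + t) * (1ℚ + ι n * t)       ≤⟨ *-monoˡ _ (0≤p+q 0≤1 0≤t) (bernoulli 0≤t n) ⟩
  (1ℚ + t) * (1ℚ + t) ^ n         ∎
  where open ≤-Reasoning

bernoulli₂ : ∀ {t τ} → ∣ t ∣ ≤ τ → ∀ n →
  ∣ (1ℚ + t) ^ n - (1ℚ + ι n * t) ∣ ≤ ι n * ι n * (τ * τ) * (1ℚ + τ) ^ n
bernoulli₂ {t} {τ} h zero = ≤-reflexive (trans
  (cong ∣_∣ (solve 1 (λ t → con 1ℚ :- (con 1ℚ :+ con 0ℚ :* t) := con 0ℚ) refl t))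
  (solve 1 (λ τ → con 0ℚ := con 0ℚ :* con 0ℚ :* (τ :* τ) :* con 1ℚ) refl τ))
bernoulli₂ {t} {τ} h (suc n) = begin
  ∣ (1ℚ + t) * (1ℚ + t) ^ n - (1ℚ + ι (suc n) * t) ∣
    ≡⟨ cong (λ z → ∣ (1ℚ + t) * (1ℚ + t) ^ n - (1ℚ + z * t) ∣) (ι-suc n) ⟩
  ∣ (1ℚ + t) * (1ℚ + t) ^ n - (1ℚ + (1ℚ + ι n) * t) ∣
    ≡⟨ cong ∣_∣ (solve 3 (λ k t x → (con 1ℚ :+ t) :* x :- (con 1ℚ :+ (con 1ℚ :+ k) :* t)
          := (con 1ℚ :+ t) :* (x :- (con 1ℚ :+ k :* t)) :+ k :* (t :* t))
         refl (ι n) t ((1ℚ + t) ^ n)) ⟩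
  ∣ (1ℚ + t) * ((1ℚ + t) ^ n - (1ℚ + ι n * t)) + ι n * (t * t) ∣
    ≤⟨ ∣p+q∣≤ (∣p*q∣≤ {a = T} (∣p+q∣≤ {p = 1ℚ} ≤-refl h) (bernoulli₂ h n))
              (∣p*q∣≤ (≤-reflexive (0≤p⇒∣p∣≡p (0≤ι n))) (∣p*q∣≤ h h)) ⟩
  T * (k * k * (τ * τ) * T ^ n) + k * (τ * τ)
    ≤⟨ +-monoʳ-≤ (T * (k * k * (τ * τ) * T ^ n)) (p≤p*q (0≤p*q 0≤k 0≤ττ) (1≤^ 1≤T (suc n))) ⟩
  T * (k * k * (τ * τ) * T ^ n) + k * (τ * τ) * (T * T ^ n)
    ≤⟨ +⇒≤ ((1ℚ + k) * (τ * τ) * (T * T ^ n))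
         (0≤p*q (0≤p*q (0≤p+q 0≤1 0≤k) 0≤ττ) (^-nonNeg 0≤T (suc n)))
         (solve 4 (λ k s T x → (con 1ℚ :+ k) :* (con 1ℚ :+ k) :* s :* (T :* x)
            := T :* (k :* k :* s :* x) :+ k :* s :* (T :* x) :+ (con 1ℚ :+ k) :* s :* (T :* x))
            refl k (τ * τ) T (T ^ n)) ⟩
  (1ℚ + k) * (1ℚ + k) * (τ * τ) * (T * T ^ n)
    ≡⟨ cong (λ z → z * z * (τ * τ) * (T * T ^ n)) (ι-suc n) ⟨
  ι (suc n) * ι (suc n) * (τ * τ) * (T * T ^ n) ∎
  where
  open ≤-Reasoning
  k = ι n
  T = 1ℚ + τ
  0≤k  = 0≤ι n
  0≤τ  = ≤-trans (0≤∣p∣ t) h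
  0≤ττ = 0≤p*q 0≤τ 0≤τ
  1≤T  = +⇒≤ τ 0≤τ refl
  0≤T  = ≤-trans 0≤1 1≤T

bernoulli⁻ : ∀ {t} → 0ℚ ≤ t → ∀ n → (1ℚ - ι n * t) * (1ℚ + t) ^ n ≤ 1ℚ
bernoulli⁻ {t} 0≤t zero = ≤-reflexive
  (solve 1 (λ t → (con 1ℚ :- con 0ℚ :* t) :* con 1ℚ := con 1ℚ) refl t)
bernoulli⁻ {t} 0≤t (suc n) = begin
  (1ℚ - ι (suc n) * t) * ((1ℚ + t) * x)
    ≡⟨ cong (λ z → (1ℚ - z * t) * ((1ℚ + t) * x)) (ι-suc n) ⟩
  (1ℚ - (1ℚ + k) * t) * ((1ℚ + t) * x)
    ≤⟨ +⇒≤ ((1ℚ + k) * (t * t) * x)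
         (0≤p*q (0≤p*q (0≤p+q 0≤1 (0≤ι n)) (0≤p*q 0≤t 0≤t)) (^-nonNeg (0≤p+q 0≤1 0≤t) n))
         (solve 3 (λ k t x → (con 1ℚ :- k :* t) :* x
             := (con 1ℚ :- (con 1ℚ :+ k) :* t) :* ((con 1ℚ :+ t) :* x)
                :+ (con 1ℚ :+ k) :* (t :* t) :* x) refl k t x) ⟩
  (1ℚ - k * t) * x  ≤⟨ bernoulli⁻ 0≤t n ⟩
  1ℚ ∎
  where
  open ≤-Reasoning
  k = ι n
  x = (1ℚ + t) ^ n

-- Cauchy sequences of rationals; the intended equality is the setoid
-- equality  x ≤ℝ y × y ≤ℝ x.

record ℝ : Set where
  constructor mkℝ
  field
    seq    : ℕ → ℚ
    cauchy : ∀ {ε} → 0ℚ < ε →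
             Σ[ N ∈ ℕ ] (∀ m n → N ℕ.≤ m → N ℕ.≤ n → ∣ seq m - seq n ∣ ≤ ε)

open ℝ

infix 4 _<ℝ_ _≤ℝ_

_<ℝ_ : ℝ → ℝ → Set
x <ℝ y = Σ[ δ ∈ ℚ ] 0ℚ < δ × (Σ[ N ∈ ℕ ] (∀ n → N ℕ.≤ n → seq x n + δ ≤ seq y n))

_≤ℝ_ : ℝ → ℝ → Set
x ≤ℝ y = ∀ {ε} → 0ℚ < ε → Σ[ N ∈ ℕ ] (∀ n → N ℕ.≤ n → seq x n ≤ seq y n + ε)

fromℚ : ℚ → ℝ
fromℚ q = mkℝ (λ _ → q) λ 0<ε → 0 , λ _ _ _ _ →
  subst (_≤ _) (sym (cong ∣_∣ (+-inverseʳ q))) (<⇒≤ 0<ε)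

fromℕ : ℕ → ℝ
fromℕ n = fromℚ (ι n)

0ℝ : ℝ
0ℝ = fromℚ 0ℚ

fromℚ-mono-< : ∀ {p q} → p < q → fromℚ p <ℝ fromℚ q
fromℚ-mono-< {p} {q} p<q =
  q - p , p<q⇒0<q-p p<q , 0 , λ _ _ → ≤-reflexive (sym (p-q+q q p))

split : ∀ {ε} → 0ℚ < ε → (c : ℕ) → Σ[ δ ∈ ℚ ] 0ℚ < δ × ι (suc c) * δ ≡ ε
split {ε} 0<ε c = r c * ε , 0<p*q (0<r c) 0<ε , (begin
  ι (suc c) * (r c * ε)  ≡⟨ *-assoc (ι (suc c)) (r c) ε ⟨
  ι (suc c) * r c * ε    ≡⟨ cong (_* ε) (ι*r c) ⟩
  1ℚ * ε                 ≡⟨ *-identityˡ ε ⟩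
  ε                      ∎)
  where open ≡-Reasoning

half : ∀ {ε} → 0ℚ < ε → Σ[ δ ∈ ℚ ] 0ℚ < δ × δ + δ ≡ ε
half 0<ε with δ , 0<δ , eq ← split 0<ε 1 =
  δ , 0<δ , trans (solve 1 (λ δ → δ :+ δ := con (ι 2) :* δ) refl δ) eq

m⊔n≤o⇒ : ∀ {m n o} → m ℕ.⊔ n ℕ.≤ o → m ℕ.≤ o × n ℕ.≤ o
m⊔n≤o⇒ {m} {n} h = ℕ.m⊔n≤o⇒m≤o m n h , ℕ.m⊔n≤o⇒n≤o m n h

bounded : ∀ x → Σ[ B ∈ ℕ ] (Σ[ N ∈ ℕ ] (∀ n → N ℕ.≤ n → ∣ seq x n ∣ ≤ ι B))
bounded x with N , h ← cauchy x {1ℚ} (0<r 0)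
          with B , b ← archimedean (1ℚ + ∣ seq x N ∣) = B , N , λ n N≤n → begin
  ∣ seq x n ∣
    ≡⟨ cong ∣_∣ (solve 2 (λ p q → p := (p :- q) :+ q) refl (seq x n) (seq x N)) ⟩
  ∣ (seq x n - seq x N) + seq x N ∣   ≤⟨ ∣p+q∣≤ (h n N N≤n ℕ.≤-refl) ≤-refl ⟩
  1ℚ + ∣ seq x N ∣                    ≤⟨ b ⟩
  ι B                                 ∎
  where open ≤-Reasoning

<ℝ-asym : ∀ {x y} → x <ℝ y → ¬ y <ℝ x
<ℝ-asym {x} {y} (δ , 0<δ , N , f) (δ′ , 0<δ′ , N′ , g) = <-irrefl refl (begin-strict
  seq x n             <⟨ +⇒< δ 0<δ refl ⟩
  seq x n + δ         ≤⟨ f n (ℕ.m≤m⊔n N N′) ⟩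
  seq y n             <⟨ +⇒< δ′ 0<δ′ refl ⟩
  seq y n + δ′        ≤⟨ g n (ℕ.m≤n⊔m N N′) ⟩
  seq x n             ∎)
  where
  open ≤-Reasoning
  n = N ℕ.⊔ N′

<ℝ-trans : ∀ {x y z} → x <ℝ y → y <ℝ z → x <ℝ z
<ℝ-trans {x} {y} {z} (δ , 0<δ , N , f) (δ′ , 0<δ′ , N′ , g) =
  δ , 0<δ , N ℕ.⊔ N′ , λ n h → begin
    seq x n + δ    ≤⟨ f n (proj₁ (m⊔n≤o⇒ h)) ⟩
    seq y n        ≤⟨ +⇒≤ δ′ (<⇒≤ 0<δ′) refl ⟩
    seq y n + δ′   ≤⟨ g n (proj₂ (m⊔n≤o⇒ {N} h)) ⟩
    seq z n        ∎
  where open ≤-Reasoning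

<ℝ-cotrans : ∀ {a b} → a <ℝ b → ∀ x → a <ℝ x ⊎ x <ℝ b
<ℝ-cotrans {a} {b} (ε , 0<ε , N , f) x
  with η , 0<η , 6η≡ε ← split 0<ε 5
  with Na , ca ← cauchy a 0<η | Nb , cb ← cauchy b 0<η | Nx , cx ← cauchy x 0<η
  = go (≤-total (seq a M + ι 3 * η) (seq x M))
  where
  M = N ℕ.⊔ (Na ℕ.⊔ (Nb ℕ.⊔ Nx))
  N≤ : ∀ {n} → M ℕ.≤ n → N ℕ.≤ n
  N≤ h = proj₁ (m⊔n≤o⇒ h)
  Na≤ : ∀ {n} → M ℕ.≤ n → Na ℕ.≤ n
  Na≤ h = proj₁ (m⊔n≤o⇒ (proj₂ (m⊔n≤o⇒ {N} h)))
  Nb≤ : ∀ {n} → M ℕ.≤ n → Nb ℕ.≤ n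
  Nb≤ h = proj₁ (m⊔n≤o⇒ (proj₂ (m⊔n≤o⇒ {Na} (proj₂ (m⊔n≤o⇒ {N} h)))))
  Nx≤ : ∀ {n} → M ℕ.≤ n → Nx ℕ.≤ n
  Nx≤ h = proj₂ (m⊔n≤o⇒ {Nb} (proj₂ (m⊔n≤o⇒ {Na} (proj₂ (m⊔n≤o⇒ {N} h)))))
  M≤M = ℕ.≤-refl {M}

  go : seq a M + ι 3 * η ≤ seq x M ⊎ seq x M ≤ seq a M + ι 3 * η → a <ℝ x ⊎ x <ℝ b
  go (inj₁ h) = inj₁ (η , 0<η , M , λ n M≤n →
    +⇒≤ (((η - (seq a n - seq a M)) + (seq x M - (seq a M + ι 3 * η))) + (η - (seq x M - seq x n)))
      (0≤p+q (0≤p+q (p≤q⇒0≤q-p (∣p∣≤⇒≤ (ca n M (Na≤ M≤n) (Na≤ M≤M)))) (p≤q⇒0≤q-p h))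
             (p≤q⇒0≤q-p (∣p∣≤⇒≤ (cx M n (Nx≤ M≤M) (Nx≤ M≤n)))))
      (solve 5 (λ e an am xm xn → xn := an :+ e :+ (((e :- (an :- am))
           :+ (xm :- (am :+ con (ι 3) :* e))) :+ (e :- (xm :- xn))))
         refl η (seq a n) (seq a M) (seq x M) (seq x n)))
  go (inj₂ h) = inj₂ (η , 0<η , M , λ n M≤n →
    +⇒≤ ((((η - (seq x n - seq x M)) + (seq a M + ι 3 * η - seq x M))
             + (seq b M - (seq a M + ι 6 * η))) + (η - (seq b M - seq b n)))
      (0≤p+q (0≤p+q (0≤p+q (p≤q⇒0≤q-p (∣p∣≤⇒≤ (cx n M (Nx≤ M≤n) (Nx≤ M≤M)))) (p≤q⇒0≤q-p h))
             (p≤q⇒0≤q-p (subst (λ z → seq a M + z ≤ seq b M) (sym 6η≡ε) (f M (N≤ M≤M)))))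
             (p≤q⇒0≤q-p (∣p∣≤⇒≤ (cb M n (Nb≤ M≤M) (Nb≤ M≤n)))))
      (solve 6 (λ e am xm xn bm bn → bn := xn :+ e :+ ((((e :- (xn :- xm))
           :+ (am :+ con (ι 3) :* e :- xm)) :+ (bm :- (am :+ con (ι 6) :* e))) :+ (e :- (bm :- bn))))
         refl η (seq a M) (seq x M) (seq x n) (seq b M) (seq b n)))

infixl 6 _+ℝ_
infixl 7 _*ℝ_ _/ℝ_[_]

∣+-+∣≤ : ∀ {a b c d δ δ′} → ∣ a - b ∣ ≤ δ → ∣ c - d ∣ ≤ δ′ →
         ∣ (a + c) - (b + d) ∣ ≤ δ + δ′
∣+-+∣≤ {a} {b} {c} {d} {δ} {δ′} h h′ = subst (_≤ δ + δ′)
  (cong ∣_∣ (solve 4 (λ a b c d → (a :- b) :+ (c :- d) := (a :+ c) :- (b :+ d)) refl a b c d))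
  (∣p+q∣≤ {a - b} {c - d} h h′)

∣*-*∣≤ : ∀ {a b c d δ} A drift → 0ℚ < δ → ∣ a ∣ ≤ ι A → ∣ d ∣ ≤ ι drift →
         ∣ a - b ∣ ≤ δ → ∣ c - d ∣ ≤ δ → ∣ a * c - b * d ∣ ≤ ι (suc (A ℕ.+ drift)) * δ
∣*-*∣≤ {a} {b} {c} {d} {δ} A drift 0<δ ha hd hab hcd = begin
  ∣ a * c - b * d ∣
    ≡⟨ cong ∣_∣ (solve 4 (λ a b c d → a :* c :- b :* d := a :* (c :- d) :+ (a :- b) :* d)
         refl a b c d) ⟩
  ∣ a * (c - d) + (a - b) * d ∣
    ≤⟨ ∣p+q∣≤ {a * (c - d)} {(a - b) * d} (∣p*q∣≤ ha hcd) (∣p*q∣≤ hab hd) ⟩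
  ι A * δ + δ * ι drift
    ≤⟨ +⇒≤ δ (<⇒≤ 0<δ)
         (trans (cong (_* δ) (trans (ι-suc (A ℕ.+ drift)) (cong (λ z → 1ℚ + z) (ι-+ A drift))))
           (solve 3 (λ a b d → (con 1ℚ :+ (a :+ b)) :* d := a :* d :+ d :* b :+ d)
             refl (ι A) (ι drift) δ)) ⟩
  ι (suc (A ℕ.+ drift)) * δ ∎
  where open ≤-Reasoning

_+ℝ_ : ℝ → ℝ → ℝ
x +ℝ y = mkℝ (λ n → seq x n + seq y n) conv
  where
  conv : ∀ {ε} → 0ℚ < ε → Σ[ N ∈ ℕ ] (∀ m n → N ℕ.≤ m → N ℕ.≤ n →
           ∣ (seq x m + seq y m) - (seq x n + seq y n) ∣ ≤ ε)
  conv {ε} 0<ε = Nx ℕ.⊔ Ny , λ m n N≤m N≤n →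
    subst (∣ (seq x m + seq y m) - (seq x n + seq y n) ∣ ≤_) (proj₂ (proj₂ δs))
      (∣+-+∣≤ {seq x m} {seq x n} {seq y m} {seq y n}
        (cx m n (proj₁ (m⊔n≤o⇒ N≤m)) (proj₁ (m⊔n≤o⇒ N≤n)))
        (cy m n (proj₂ (m⊔n≤o⇒ {Nx} N≤m)) (proj₂ (m⊔n≤o⇒ {Nx} N≤n))))
    where
    δs = half 0<ε
    0<δ = proj₁ (proj₂ δs)
    Nx = proj₁ (cauchy x 0<δ)
    cx = proj₂ (cauchy x 0<δ)
    Ny = proj₁ (cauchy y 0<δ)
    cy = proj₂ (cauchy y 0<δ)

_*ℝ_ : ℝ → ℝ → ℝ
x *ℝ y = mkℝ (λ n → seq x n * seq y n) conv
  where
  Bx = proj₁ (bounded x)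
  Nx = proj₁ (proj₂ (bounded x))
  bx = proj₂ (proj₂ (bounded x))
  By = proj₁ (bounded y)
  Ny = proj₁ (proj₂ (bounded y))
  by = proj₂ (proj₂ (bounded y))
  conv : ∀ {ε} → 0ℚ < ε → Σ[ N ∈ ℕ ] (∀ m n → N ℕ.≤ m → N ℕ.≤ n →
           ∣ seq x m * seq y m - seq x n * seq y n ∣ ≤ ε)
  conv {ε} 0<ε = (Nx ℕ.⊔ Ny) ℕ.⊔ (Mx ℕ.⊔ My) , λ m n N≤m N≤n →
    let (N≤m₁ , N≤m₂) = m⊔n≤o⇒ {Nx ℕ.⊔ Ny} N≤m
        (N≤n₁ , N≤n₂) = m⊔n≤o⇒ {Nx ℕ.⊔ Ny} N≤n
    in subst (∣ seq x m * seq y m - seq x n * seq y n ∣ ≤_) (proj₂ (proj₂ δs))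
      (∣*-*∣≤ {seq x m} {seq x n} {seq y m} {seq y n} Bx By 0<δ
        (bx m (proj₁ (m⊔n≤o⇒ N≤m₁))) (by n (proj₂ (m⊔n≤o⇒ {Nx} N≤n₁)))
        (cx m n (proj₁ (m⊔n≤o⇒ N≤m₂)) (proj₁ (m⊔n≤o⇒ N≤n₂)))
        (cy m n (proj₂ (m⊔n≤o⇒ {Mx} N≤m₂)) (proj₂ (m⊔n≤o⇒ {Mx} N≤n₂))))
    where
    δs = split 0<ε (Bx ℕ.+ By)
    0<δ = proj₁ (proj₂ δs)
    Mx = proj₁ (cauchy x 0<δ)
    cx = proj₂ (cauchy x 0<δ)
    My = proj₁ (cauchy y 0<δ)
    cy = proj₂ (cauchy y 0<δ)

-- Reciprocal on ℚ, extended by 0 at 0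
inv : ℚ → ℚ
inv q with q ≟ 0ℚ
... | yes _  = 0ℚ
... | no q≢0 = (1/ q) {{≢-nonZero q≢0}}

inv-* : ∀ {q} → 0ℚ < q → inv q * q ≡ 1ℚ
inv-* {q} 0<q with q ≟ 0ℚ
... | yes q≡0 = contradiction (sym q≡0) (<⇒≢ 0<q)
... | no q≢0  = *-inverseˡ q {{≢-nonZero q≢0}}

inv-nonNeg : ∀ {q} → 0ℚ < q → 0ℚ ≤ inv q
inv-nonNeg {q} 0<q = *-cancelʳ-≤-pos q {{positive 0<q}}
  (subst₂ _≤_ (sym (*-zeroˡ q)) (sym (inv-* 0<q)) 0≤1)

inv-antimono : ∀ {p q} → 0ℚ < p → p ≤ q → inv q ≤ inv p
inv-antimono {p} {q} 0<p p≤q = begin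
  inv q               ≡⟨ *-identityˡ (inv q) ⟨
  1ℚ * inv q          ≡⟨ cong (_* inv q) (inv-* 0<p) ⟨
  inv p * p * inv q   ≤⟨ *-monoʳ (inv q) (inv-nonNeg 0<q) (*-monoˡ (inv p) (inv-nonNeg 0<p) p≤q) ⟩
  inv p * q * inv q   ≡⟨ solve 3 (λ a b c → a :* b :* c := a :* (c :* b)) refl (inv p) q (inv q) ⟩
  inv p * (inv q * q) ≡⟨ cong (inv p *_) (inv-* 0<q) ⟩
  inv p * 1ℚ          ≡⟨ *-identityʳ (inv p) ⟩
  inv p               ∎
  where
  open ≤-Reasoning
  0<q = <-≤-trans 0<p p≤q

∣inv-inv∣≤ : ∀ {a b δ ε} → 0ℚ < δ → δ ≤ a → δ ≤ b → ∣ b - a ∣ ≤ ε * (δ * δ) →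
             ∣ inv a - inv b ∣ ≤ ε
∣inv-inv∣≤ {a} {b} {δ} {ε} 0<δ δ≤a δ≤b h = begin
  ∣ inv a - inv b ∣
    ≡⟨ cong ∣_∣ (trans (cong₂ _-_
           (trans (sym (*-identityʳ (inv a))) (cong (inv a *_) (sym (inv-* (<-≤-trans 0<δ δ≤b)))))
           (trans (sym (*-identityʳ (inv b))) (cong (inv b *_) (sym (inv-* (<-≤-trans 0<δ δ≤a))))))
         (solve 4 (λ a b p q → p :* (q :* b) :- q :* (p :* a) := (b :- a) :* (p :* q))
           refl a b (inv a) (inv b))) ⟩
  ∣ (b - a) * (inv a * inv b) ∣
    ≤⟨ ∣p*q∣≤ h (∣p*q∣≤ (abs≤ δ≤a) (abs≤ δ≤b)) ⟩
  ε * (δ * δ) * (inv δ * inv δ)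
    ≡⟨ solve 3 (λ e d i → e :* (d :* d) :* (i :* i) := e :* ((i :* d) :* (i :* d))) refl ε δ (inv δ) ⟩
  ε * ((inv δ * δ) * (inv δ * δ))   ≡⟨ cong (λ z → ε * (z * z)) (inv-* 0<δ) ⟩
  ε * 1ℚ                            ≡⟨ *-identityʳ ε ⟩
  ε ∎
  where
  open ≤-Reasoning
  abs≤ : ∀ {p} → δ ≤ p → ∣ inv p ∣ ≤ inv δ
  abs≤ δ≤p = subst (_≤ inv δ) (sym (0≤p⇒∣p∣≡p (inv-nonNeg (<-≤-trans 0<δ δ≤p)))) (inv-antimono 0<δ δ≤p)

_⁻¹[_] : (x : ℝ) → 0ℝ <ℝ x → ℝ
x ⁻¹[ δ , 0<δ , N , pos ] = mkℝ (λ n → inv (seq x n)) conv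
  where
  δ≤ : ∀ n → N ℕ.≤ n → δ ≤ seq x n
  δ≤ n N≤n = subst (_≤ seq x n) (+-identityˡ δ) (pos n N≤n)
  conv : ∀ {ε} → 0ℚ < ε → Σ[ M ∈ ℕ ] (∀ m n → M ℕ.≤ m → M ℕ.≤ n →
           ∣ inv (seq x m) - inv (seq x n) ∣ ≤ ε)
  conv {ε} 0<ε = N ℕ.⊔ M , λ m n N≤m N≤n →
    ∣inv-inv∣≤ {seq x m} {seq x n} 0<δ
      (δ≤ m (proj₁ (m⊔n≤o⇒ N≤m))) (δ≤ n (proj₁ (m⊔n≤o⇒ N≤n)))
      (cx n m (proj₂ (m⊔n≤o⇒ {N} N≤n)) (proj₂ (m⊔n≤o⇒ {N} N≤m)))
    where
    0<εδδ = 0<p*q 0<ε (0<p*q 0<δ 0<δ)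
    M = proj₁ (cauchy x 0<εδδ)
    cx = proj₂ (cauchy x 0<εδδ)

_/ℝ_[_] : ℝ → (y : ℝ) → 0ℝ <ℝ y → ℝ
x /ℝ y [ 0<y ] = x *ℝ y ⁻¹[ 0<y ]

0<x+y : ∀ {x y} → 0ℝ <ℝ x → 0ℝ <ℝ y → 0ℝ <ℝ x +ℝ y
0<x+y (δ , 0<δ , N , f) (δ′ , 0<δ′ , N′ , g) =
  δ + δ′ , +-mono-< 0<δ 0<δ′ , N ℕ.⊔ N′ , λ n h →
  subst (_≤ _) (solve 2 (λ a b → (con 0ℚ :+ a) :+ (con 0ℚ :+ b) := con 0ℚ :+ (a :+ b)) refl δ δ′)
    (+-mono-≤ (f n (proj₁ (m⊔n≤o⇒ h))) (g n (proj₂ (m⊔n≤o⇒ {N} h))))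

0<x*y : ∀ {x y} → 0ℝ <ℝ x → 0ℝ <ℝ y → 0ℝ <ℝ x *ℝ y
0<x*y (δ , 0<δ , N , f) (δ′ , 0<δ′ , N′ , g) =
  δ * δ′ , 0<p*q 0<δ 0<δ′ , N ℕ.⊔ N′ , λ n h →
  let δ≤x  = subst (_≤ _) (+-identityˡ δ) (f n (proj₁ (m⊔n≤o⇒ h)))
      δ′≤y = subst (_≤ _) (+-identityˡ δ′) (g n (proj₂ (m⊔n≤o⇒ {N} h)))
  in subst (_≤ _) (sym (+-identityˡ (δ * δ′)))
       (*-mono (≤-trans (<⇒≤ 0<δ) δ≤x) (<⇒≤ 0<δ′) δ≤x δ′≤y)

2ℚ : ℚ
2ℚ = 1ℚ + 1ℚ

euler : ℕ → ℚ → ℚ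
euler k a = (1ℚ + a * r k) ^ suc k

0≤½*r : ∀ k → 0ℚ ≤ ½ * r k
0≤½*r k = 0≤p*q {½} {r k} (*≤* (ℤ.+≤+ ℕ.z≤n)) (0≤r k)

euler-½ : ∀ k → euler k ½ ≤ 2ℚ
euler-½ k = begin
  euler k ½
    ≡⟨ solve 1 (λ x → x := con 2ℚ :* (con ½ :* x)) refl (euler k ½) ⟩
  2ℚ * (½ * euler k ½)
    ≡⟨ cong (λ z → 2ℚ * (z * euler k ½)) ½≡ ⟨
  2ℚ * ((1ℚ - ι (suc k) * (½ * r k)) * euler k ½)
    ≤⟨ *-monoˡ 2ℚ (0≤p+q 0≤1 0≤1) (bernoulli⁻ (0≤½*r k) (suc k)) ⟩
  2ℚ * 1ℚ ≡⟨ *-identityʳ 2ℚ ⟩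
  2ℚ ∎
  where
  open ≤-Reasoning
  ½≡ : 1ℚ - ι (suc k) * (½ * r k) ≡ ½
  ½≡ = trans (solve 2 (λ n r → con 1ℚ :- n :* (con ½ :* r) := con 1ℚ :- con ½ :* (n :* r))
                refl (ι (suc k)) (r k))
             (cong (λ z → 1ℚ - ½ * z) (ι*r k))

-- Upper bound for (1 + B/n)ⁿ, from (1 + 1/2n)ⁿ ≤ 2
euler⁺ : ℕ → ℚ
euler⁺ B = 2ℚ ^ (B ℕ.+ B)

1≤euler⁺ : ∀ B → 1ℚ ≤ euler⁺ B
1≤euler⁺ B = 1≤^ (+⇒≤ 1ℚ 0≤1 refl) (B ℕ.+ B)

^-swap : ∀ x m n → (x ^ m) ^ n ≡ (x ^ n) ^ m
^-swap x m n = trans (^-assocʳ x m n) (trans (cong (x ^_) (ℕ.*-comm m n)) (sym (^-assocʳ x n m)))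

1≤1+ι*r : ∀ B k → 1ℚ ≤ 1ℚ + ι B * r k
1≤1+ι*r B k = +⇒≤ (ι B * r k) (0≤p*q (0≤ι B) (0≤r k)) refl

euler-≤euler⁺ : ∀ B k → euler k (ι B) ≤ euler⁺ B
euler-≤euler⁺ B k = begin
  (1ℚ + ι B * r k) ^ suc k
    ≤⟨ ^-monoˡ (≤-trans 0≤1 (1≤1+ι*r B k)) base (suc k) ⟩
  ((1ℚ + ½ * r k) ^ (B ℕ.+ B)) ^ suc k
    ≡⟨ ^-swap (1ℚ + ½ * r k) (B ℕ.+ B) (suc k) ⟩
  (euler k ½) ^ (B ℕ.+ B)
    ≤⟨ ^-monoˡ (^-nonNeg (0≤p+q 0≤1 (0≤½*r k)) (suc k)) (euler-½ k) (B ℕ.+ B) ⟩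
  2ℚ ^ (B ℕ.+ B) ∎
  where
  open ≤-Reasoning
  base : 1ℚ + ι B * r k ≤ (1ℚ + ½ * r k) ^ (B ℕ.+ B)
  base = begin
    1ℚ + ι B * r k
      ≡⟨ solve 2 (λ b r → con 1ℚ :+ b :* r := con 1ℚ :+ (b :+ b) :* (con ½ :* r)) refl (ι B) (r k) ⟩
    1ℚ + (ι B + ι B) * (½ * r k)   ≡⟨ cong (λ z → 1ℚ + z * (½ * r k)) (ι-+ B B) ⟨
    1ℚ + ι (B ℕ.+ B) * (½ * r k)   ≤⟨ bernoulli (0≤½*r k) (B ℕ.+ B) ⟩
    (1ℚ + ½ * r k) ^ (B ℕ.+ B)     ∎

∣base∣≤ : ∀ {a B} k → ∣ a ∣ ≤ ι B → ∣ 1ℚ + a * r k ∣ ≤ 1ℚ + ι B * r k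
∣base∣≤ {a} {B} k h = ∣p+q∣≤ {1ℚ} {a * r k} ≤-refl
  (∣p*q∣≤ {a} {r k} h (≤-reflexive (0≤p⇒∣p∣≡p (0≤r k))))

euler-lipschitz : ∀ {a b B} k → ∣ a ∣ ≤ ι B → ∣ b ∣ ≤ ι B →
                  ∣ euler k a - euler k b ∣ ≤ ∣ a - b ∣ * (euler⁺ B * euler⁺ B)
euler-lipschitz {a} {b} {B} k ha hb = begin
  ∣ euler k a - euler k b ∣
    ≤⟨ ^-lipschitz {d = ∣ a - b ∣ * r k} base (∣base∣≤ {a} {B} k ha) (∣base∣≤ {b} {B} k hb) (1≤1+ι*r B k) (1≤1+ι*r B k) (suc k) ⟩
  ι (suc k) * (∣ a - b ∣ * r k) * (euler k (ι B) * euler k (ι B))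
    ≡⟨ cong (_* (euler k (ι B) * euler k (ι B)))
         (solve 3 (λ n d r → n :* (d :* r) := d :* (n :* r)) refl (ι (suc k)) ∣ a - b ∣ (r k)) ⟩
  ∣ a - b ∣ * (ι (suc k) * r k) * (euler k (ι B) * euler k (ι B))
    ≡⟨ cong (λ z → ∣ a - b ∣ * z * (euler k (ι B) * euler k (ι B))) (ι*r k) ⟩
  ∣ a - b ∣ * 1ℚ * (euler k (ι B) * euler k (ι B))
    ≡⟨ cong (_* (euler k (ι B) * euler k (ι B))) (*-identityʳ ∣ a - b ∣) ⟩
  ∣ a - b ∣ * (euler k (ι B) * euler k (ι B))
    ≤⟨ *-monoˡ ∣ a - b ∣ (0≤∣p∣ (a - b))
         (*-mono (≤-trans 0≤1 (1≤euler⁺ B)) (^-nonNeg (≤-trans 0≤1 (1≤1+ι*r B k)) (suc k)) (euler-≤euler⁺ B k) (euler-≤euler⁺ B k)) ⟩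
  ∣ a - b ∣ * (euler⁺ B * euler⁺ B) ∎
  where
  open ≤-Reasoning
  base : ∣ (1ℚ + a * r k) - (1ℚ + b * r k) ∣ ≤ ∣ a - b ∣ * r k
  base = ≤-reflexive (trans
    (cong ∣_∣ (solve 3 (λ a b r → (con 1ℚ :+ a :* r) :- (con 1ℚ :+ b :* r) := (a :- b) :* r) refl a b (r k)))
    (trans (∣p*q∣≡∣p∣*∣q∣ (a - b) (r k)) (cong (∣ a - b ∣ *_) (0≤p⇒∣p∣≡p (0≤r k)))))

-- |(1 + a/m)ᵐ − (1 + a/mn)ᵐⁿ| ≤ drift B / m for |a| ≤ B
drift : ℕ → ℚ
drift B = (ι B * ι B) * euler⁺ B * (euler⁺ B * euler⁺ B)

euler-refine : ∀ {a B} k m n → suc k ≡ suc n ℕ.* suc m → ∣ a ∣ ≤ ι B →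
               ∣ euler m a - euler k a ∣ ≤ drift B * r m
euler-refine {a} {B} k m n eq ha = begin
  ∣ euler m a - euler k a ∣
    ≡⟨ cong (λ z → ∣ euler m a - z ∣) (trans (cong ((1ℚ + t) ^_) eq) (sym (^-assocʳ (1ℚ + t) (suc n) (suc m)))) ⟩
  ∣ u ^ suc m - v ^ suc m ∣
    ≤⟨ ^-lipschitz {u} {v} {U} {V} {d} base (∣base∣≤ {a} {B} m ha) (∣^∣≤ (∣base∣≤ {a} {B} k ha) (suc n))
         (1≤1+ι*r B m) (1≤^ (1≤1+ι*r B k) (suc n)) (suc m) ⟩
  ι (suc m) * d * (euler m (ι B) * V ^ suc m)
    ≤⟨ *-monoˡ (ι (suc m) * d) (0≤p*q (0≤ι (suc m)) 0≤d)
         (*-mono 0≤euler⁺ (^-nonNeg 0≤V (suc m)) (euler-≤euler⁺ B m) Vᵐ≤euler⁺) ⟩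
  ι (suc m) * (ι B * r m * (ι B * r m) * euler⁺ B) * (euler⁺ B * euler⁺ B)
    ≡⟨ solve 4 (λ i b r c → i :* (b :* r :* (b :* r) :* c) :* (c :* c)
                  := b :* b :* c :* (c :* c) :* ((i :* r) :* r)) refl (ι (suc m)) (ι B) (r m) (euler⁺ B) ⟩
  drift B * (ι (suc m) * r m * r m)  ≡⟨ cong (λ z → drift B * (z * r m)) (ι*r m) ⟩
  drift B * (1ℚ * r m)               ≡⟨ cong (drift B *_) (*-identityˡ (r m)) ⟩
  drift B * r m                      ∎
  where
  open ≤-Reasoning
  t = a * r k
  τ = ι B * r k
  u = 1ℚ + a * r m
  v = (1ℚ + t) ^ suc n
  U = 1ℚ + ι B * r m
  V = (1ℚ + τ) ^ suc n
  d = ι B * r m * (ι B * r m) * euler⁺ B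
  0≤euler⁺ = ≤-trans 0≤1 (1≤euler⁺ B)
  0≤V = ≤-trans 0≤1 (1≤^ (1≤1+ι*r B k) (suc n))
  0≤d : 0ℚ ≤ d
  0≤d = 0≤p*q (0≤p*q (0≤p*q (0≤ι B) (0≤r m)) (0≤p*q (0≤ι B) (0≤r m))) 0≤euler⁺
  Vᵐ≤euler⁺ : V ^ suc m ≤ euler⁺ B
  Vᵐ≤euler⁺ = subst (_≤ euler⁺ B) (trans (cong ((1ℚ + τ) ^_) eq) (sym (^-assocʳ (1ℚ + τ) (suc n) (suc m)))) (euler-≤euler⁺ B k)
  r-k : r k ≡ r n * r m
  r-k = r-* {k} {n} {m} eq
  n*r-k : ι (suc n) * r k ≡ r m
  n*r-k = trans (cong (ι (suc n) *_) r-k) (trans (sym (*-assoc (ι (suc n)) (r n) (r m)))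
    (trans (cong (_* r m) (ι*r n)) (*-identityˡ (r m))))
  expand : ∀ x → ι (suc n) * (x * r k) ≡ x * r m
  expand x = trans (solve 3 (λ n x r → n :* (x :* r) := x :* (n :* r)) refl (ι (suc n)) x (r k))
                   (cong (x *_) n*r-k)
  base : ∣ u - v ∣ ≤ d
  base = begin
    ∣ u - v ∣                                ≡⟨ ∣p-q∣-comm u v ⟩
    ∣ v - (1ℚ + a * r m) ∣                   ≡⟨ cong (λ z → ∣ v - (1ℚ + z) ∣) (expand a) ⟨
    ∣ v - (1ℚ + ι (suc n) * t) ∣             ≤⟨ bernoulli₂ {t} {τ} ∣t∣≤τ (suc n) ⟩
    ι (suc n) * ι (suc n) * (τ * τ) * V
      ≡⟨ cong (_* V) (solve 2 (λ n t → n :* n :* (t :* t) := (n :* t) :* (n :* t)) refl (ι (suc n)) τ) ⟩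
    (ι (suc n) * τ) * (ι (suc n) * τ) * V    ≡⟨ cong (λ z → z * z * V) (expand (ι B)) ⟩
    ι B * r m * (ι B * r m) * V
      ≤⟨ *-monoˡ (ι B * r m * (ι B * r m)) (0≤p*q (0≤p*q (0≤ι B) (0≤r m)) (0≤p*q (0≤ι B) (0≤r m)))
           (≤-trans (p≤p*q 0≤V (1≤^ (1≤^ (1≤1+ι*r B k) (suc n)) m)) Vᵐ≤euler⁺) ⟩
    d ∎
    where
    ∣t∣≤τ : ∣ t ∣ ≤ τ
    ∣t∣≤τ = ∣p*q∣≤ {a} {r k} ha (≤-reflexive (0≤p⇒∣p∣≡p (0≤r k)))

euler-cauchy : ∀ {a B} m n → ∣ a ∣ ≤ ι B → ∣ euler m a - euler n a ∣ ≤ drift B * r m + drift B * r n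
euler-cauchy {a} {B} m n ha = ≤-trans (∣p-s∣≤ (euler m a) (euler k a) (euler n a))
  (+-mono-≤ (euler-refine {a} {B} k m n (ℕ.*-comm (suc m) (suc n)) ha)
            (subst (_≤ drift B * r n) (∣p-q∣-comm (euler n a) (euler k a)) (euler-refine {a} {B} k n m refl ha)))
  where k = n ℕ.+ m ℕ.* suc n

euler-close : ∀ {a b δ B E} m n → ∣ a ∣ ≤ ι B → ∣ b ∣ ≤ ι B → euler⁺ B * euler⁺ B + drift B ≤ ι E → 0ℚ < δ →
              ∣ a - b ∣ ≤ δ → r m ≤ δ → r n ≤ δ →
              ∣ euler m a - euler n b ∣ ≤ ι (suc (E ℕ.+ E ℕ.+ E)) * δ
euler-close {a} {b} {δ} {B} {E} m n ha hb hE 0<δ hab hm hn = begin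
  ∣ euler m a - euler n b ∣
    ≤⟨ ∣p-s∣≤ (euler m a) (euler m b) (euler n b) ⟩
  ∣ euler m a - euler m b ∣ + ∣ euler m b - euler n b ∣
    ≤⟨ +-mono-≤ (≤-trans (euler-lipschitz {a} {b} {B} m ha hb) (*-mono 0≤δ 0≤CC hab CC≤E))
                (≤-trans (euler-cauchy {b} {B} m n hb)
                         (+-mono-≤ (*-mono (0≤ι E) (0≤r m) drift≤E hm) (*-mono (0≤ι E) (0≤r n) drift≤E hn))) ⟩
  δ * ι E + (ι E * δ + ι E * δ)
    ≤⟨ +⇒≤ δ 0≤δ (trans (cong (_* δ) (trans (ι-suc (E ℕ.+ E ℕ.+ E)) (cong (λ z → 1ℚ + z)
           (trans (ι-+ (E ℕ.+ E) E) (cong (_+ ι E) (ι-+ E E))))))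
         (solve 2 (λ e d → (con 1ℚ :+ (e :+ e :+ e)) :* d := d :* e :+ (e :* d :+ e :* d) :+ d) refl (ι E) δ)) ⟩
  ι (suc (E ℕ.+ E ℕ.+ E)) * δ ∎
  where
  open ≤-Reasoning
  0≤δ = <⇒≤ 0<δ
  0≤euler⁺ = ≤-trans 0≤1 (1≤euler⁺ B)
  0≤CC = 0≤p*q 0≤euler⁺ 0≤euler⁺
  0≤drift : 0ℚ ≤ drift B
  0≤drift = 0≤p*q (0≤p*q (0≤p*q (0≤ι B) (0≤ι B)) 0≤euler⁺) 0≤CC
  CC≤E = ≤-trans (+⇒≤ {euler⁺ B * euler⁺ B} (drift B) 0≤drift refl) hE
  drift≤E  = ≤-trans (+⇒≤ {drift B} (euler⁺ B * euler⁺ B) 0≤CC (+-comm (euler⁺ B * euler⁺ B) (drift B))) hE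

-- exp x = lim (1 + x/n)ⁿ
exp : ℝ → ℝ
exp x = mkℝ (λ n → euler n (seq x n)) conv
  where
  B  = proj₁ (bounded x)
  Nb = proj₁ (proj₂ (bounded x))
  bx = proj₂ (proj₂ (bounded x))
  E  = proj₁ (archimedean (euler⁺ B * euler⁺ B + drift B))
  hE = proj₂ (archimedean (euler⁺ B * euler⁺ B + drift B))
  conv : ∀ {ε} → 0ℚ < ε → Σ[ N ∈ ℕ ] (∀ m n → N ℕ.≤ m → N ℕ.≤ n →
           ∣ euler m (seq x m) - euler n (seq x n) ∣ ≤ ε)
  conv {ε} 0<ε = Nb ℕ.⊔ (Nx ℕ.⊔ Nr) , λ m n N≤m N≤n →
    let (m₁ , m₂) = m⊔n≤o⇒ {Nb} N≤m
        (n₁ , n₂) = m⊔n≤o⇒ {Nb} N≤n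
    in subst (∣ euler m (seq x m) - euler n (seq x n) ∣ ≤_) (proj₂ (proj₂ δs))
      (euler-close {seq x m} {seq x n} {proj₁ δs} {B} {E} m n (bx m m₁) (bx n n₁) hE 0<δ
        (cx m n (proj₁ (m⊔n≤o⇒ m₂)) (proj₁ (m⊔n≤o⇒ n₂)))
        (≤-trans (r-antimono (proj₂ (m⊔n≤o⇒ {Nx} m₂))) hr)
        (≤-trans (r-antimono (proj₂ (m⊔n≤o⇒ {Nx} n₂))) hr))
    where
    δs  = split 0<ε (E ℕ.+ E ℕ.+ E)
    0<δ = proj₁ (proj₂ δs)
    Nx  = proj₁ (cauchy x 0<δ)
    cx  = proj₂ (cauchy x 0<δ)
    Nr  = proj₁ (r-small 0<δ)
    hr  = proj₂ (r-small 0<δ)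

inv-pos : ∀ {q} → 0ℚ < q → 0ℚ < inv q
inv-pos {q} 0<q = *-cancelʳ-<-nonNeg q {{nonNegative (<⇒≤ 0<q)}}
  (subst₂ _<_ (sym (*-zeroˡ q)) (sym (inv-* 0<q)) (0<r 0))

0<euler⁺ : ∀ B → 0ℚ < euler⁺ B
0<euler⁺ B = <-≤-trans (0<r 0) (1≤euler⁺ B)

euler⁻ : ℕ → ℚ
euler⁻ B = inv (euler⁺ (B ℕ.+ B))

0<euler⁻ : ∀ B → 0ℚ < euler⁻ B
0<euler⁻ B = inv-pos (0<euler⁺ (B ℕ.+ B))

module _ {a : ℚ} {B n : ℕ} (ha : ∣ a ∣ ≤ ι B) (hn : B ℕ.+ B ℕ.≤ n) where

  private
    Br = ι B * r n

    2Br≤1 : Br + Br ≤ 1ℚ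
    2Br≤1 = begin
      Br + Br                   ≡⟨ solve 2 (λ b r → b :* r :+ b :* r := (b :+ b) :* r) refl (ι B) (r n) ⟩
      (ι B + ι B) * r n         ≡⟨ cong (_* r n) (ι-+ B B) ⟨
      ι (B ℕ.+ B) * r n         ≤⟨ *-monoʳ (r n) (0≤r n) (ι-mono (ℕ.m≤n⇒m≤1+n hn)) ⟩
      ι (suc n) * r n           ≡⟨ ι*r n ⟩
      1ℚ                        ∎
      where open ≤-Reasoning

    0≤Br : 0ℚ ≤ Br
    0≤Br = 0≤p*q (0≤ι B) (0≤r n)

    base≥ : 1ℚ - Br ≤ 1ℚ + a * r n
    base≥ = +⇒≤ ((a - - ι B) * r n) (0≤p*q (p≤q⇒0≤q-p (∣p∣≤⇒-≤ ha)) (0≤r n))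
      (solve 3 (λ a b r → con 1ℚ :+ a :* r := (con 1ℚ :- b :* r) :+ (a :- (:- b)) :* r) refl a (ι B) (r n))

  0≤base : 0ℚ ≤ 1ℚ + a * r n
  0≤base = ≤-trans (+⇒≤ {0ℚ} {1ℚ - Br} ((1ℚ - (Br + Br)) + Br) (0≤p+q (p≤q⇒0≤q-p 2Br≤1) 0≤Br)
    (solve 1 (λ b → con 1ℚ :- b := con 0ℚ :+ ((con 1ℚ :- (b :+ b)) :+ b)) refl Br)) base≥

  euler⁻≤euler : euler⁻ B ≤ euler n a
  euler⁻≤euler = begin
    euler⁻ B
      ≡⟨ *-identityʳ (euler⁻ B) ⟨
    euler⁻ B * 1ℚ
      ≤⟨ *-monoˡ (euler⁻ B) (<⇒≤ (0<euler⁻ B)) (1≤^ 1≤prod (suc n)) ⟩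
    euler⁻ B * ((1ℚ + a * r n) * (1ℚ + ι (B ℕ.+ B) * r n)) ^ suc n
      ≡⟨ cong (euler⁻ B *_) (^-distrib-* (1ℚ + a * r n) (1ℚ + ι (B ℕ.+ B) * r n) (suc n)) ⟩
    euler⁻ B * (euler n a * euler n (ι (B ℕ.+ B)))
      ≤⟨ *-monoˡ (euler⁻ B) (<⇒≤ (0<euler⁻ B)) (*-monoˡ (euler n a) (^-nonNeg 0≤base (suc n)) (euler-≤euler⁺ (B ℕ.+ B) n)) ⟩
    euler⁻ B * (euler n a * euler⁺ (B ℕ.+ B))
      ≡⟨ solve 3 (λ l e c → l :* (e :* c) := e :* (l :* c)) refl (euler⁻ B) (euler n a) (euler⁺ (B ℕ.+ B)) ⟩
    euler n a * (euler⁻ B * euler⁺ (B ℕ.+ B))  ≡⟨ cong (euler n a *_) (inv-* (0<euler⁺ (B ℕ.+ B))) ⟩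
    euler n a * 1ℚ                   ≡⟨ *-identityʳ (euler n a) ⟩
    euler n a                        ∎
    where
    open ≤-Reasoning
    1≤prod : 1ℚ ≤ (1ℚ + a * r n) * (1ℚ + ι (B ℕ.+ B) * r n)
    1≤prod = begin
      1ℚ
        ≤⟨ +⇒≤ (Br * (1ℚ - (Br + Br))) (0≤p*q 0≤Br (p≤q⇒0≤q-p 2Br≤1)) refl ⟩
      1ℚ + Br * (1ℚ - (Br + Br))
        ≡⟨ solve 2 (λ b r → con 1ℚ :+ b :* r :* (con 1ℚ :- (b :* r :+ b :* r))
             := (con 1ℚ :- b :* r) :* (con 1ℚ :+ (b :+ b) :* r)) refl (ι B) (r n) ⟩
      (1ℚ - Br) * (1ℚ + (ι B + ι B) * r n)
        ≡⟨ cong (λ z → (1ℚ - Br) * (1ℚ + z * r n)) (ι-+ B B) ⟨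
      (1ℚ - Br) * (1ℚ + ι (B ℕ.+ B) * r n)
        ≤⟨ *-monoʳ (1ℚ + ι (B ℕ.+ B) * r n) (≤-trans 0≤1 (1≤1+ι*r (B ℕ.+ B) n)) base≥ ⟩
      (1ℚ + a * r n) * (1ℚ + ι (B ℕ.+ B) * r n) ∎

0<exp : ∀ x → 0ℝ <ℝ exp x
0<exp x = euler⁻ B , 0<euler⁻ B , Nb ℕ.⊔ (B ℕ.+ B) , λ n h →
  subst (_≤ seq (exp x) n) (sym (+-identityˡ (euler⁻ B)))
    (euler⁻≤euler {seq x n} {B} {n} (bx n (proj₁ (m⊔n≤o⇒ h))) (proj₂ (m⊔n≤o⇒ {Nb} h)))
  where
  B  = proj₁ (bounded x)
  Nb = proj₁ (proj₂ (bounded x))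
  bx = proj₂ (proj₂ (bounded x))

expℚ : ℚ → ℝ
expℚ q = exp (fromℚ q)

euler-step : ∀ {p q B n} → p ≤ q → ∣ p ∣ ≤ ι B → B ℕ.+ B ℕ.≤ n →
             euler n p + euler⁻ B * ((q - p) * r B) ≤ euler n q
euler-step {p} {q} {B} {n} p≤q hp hn = begin
  euler n p + euler⁻ B * d
    ≤⟨ +-monoʳ-≤ (euler n p) (*-monoʳ d 0≤d (euler⁻≤euler {p} {B} {n} hp hn)) ⟩
  euler n p + euler n p * d
    ≡⟨ solve 2 (λ e d → e :+ e :* d := e :* (con 1ℚ :+ d)) refl (euler n p) d ⟩
  euler n p * (1ℚ + d)
    ≡⟨ cong (λ z → euler n p * (1ℚ + z)) n*h≡d ⟨
  euler n p * (1ℚ + ι (suc n) * h)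
    ≤⟨ *-monoˡ (euler n p) (^-nonNeg 0≤v (suc n)) (bernoulli 0≤h (suc n)) ⟩
  euler n p * (1ℚ + h) ^ suc n
    ≡⟨ ^-distrib-* v (1ℚ + h) (suc n) ⟨
  (v * (1ℚ + h)) ^ suc n
    ≤⟨ ^-monoˡ (0≤p*q 0≤v (0≤p+q 0≤1 0≤h)) step (suc n) ⟩
  euler n q ∎
  where
  open ≤-Reasoning
  d = (q - p) * r B
  h = d * r n
  v = 1ℚ + p * r n
  0≤q-p = p≤q⇒0≤q-p p≤q
  0≤d : 0ℚ ≤ d
  0≤d = 0≤p*q 0≤q-p (0≤r B)
  0≤h : 0ℚ ≤ h
  0≤h = 0≤p*q 0≤d (0≤r n)
  0≤v = 0≤base {p} {B} {n} hp hn
  n*h≡d : ι (suc n) * h ≡ d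
  n*h≡d = trans (solve 3 (λ i d r → i :* (d :* r) := d :* (i :* r)) refl (ι (suc n)) d (r n))
                (trans (cong (d *_) (ι*r n)) (*-identityʳ d))
  v*r≤1 : v * r B ≤ 1ℚ
  v*r≤1 = subst (v * r B ≤_) (ι*r B) (*-monoʳ (r B) (0≤r B)
    (subst (v ≤_) (sym (ι-suc B)) (+-monoʳ-≤ 1ℚ
      (≤-trans (≤-trans (p≤∣p∣ (p * r n))
         (∣p*q∣≤ {p} {r n} {ι B} {r 0} hp (subst (_≤ r 0) (sym (0≤p⇒∣p∣≡p (0≤r n))) (r-antimono {0} {n} ℕ.z≤n))))
         (≤-reflexive (*-identityʳ (ι B)))))))
  step : v * (1ℚ + h) ≤ 1ℚ + q * r n
  step = +⇒≤ ((1ℚ - v * r B) * ((q - p) * r n))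
    (0≤p*q (p≤q⇒0≤q-p v*r≤1) (0≤p*q 0≤q-p (0≤r n)))
    (solve 4 (λ p q b n → con 1ℚ :+ q :* n
        := (con 1ℚ :+ p :* n) :* (con 1ℚ :+ (q :- p) :* b :* n)
           :+ (con 1ℚ :- (con 1ℚ :+ p :* n) :* b) :* ((q :- p) :* n)) refl p q (r B) (r n))

expℚ-mono-< : ∀ {p q} → p < q → expℚ p <ℝ expℚ q
expℚ-mono-< {p} {q} p<q =
  euler⁻ B * ((q - p) * r B) , 0<p*q (0<euler⁻ B) (0<p*q (p<q⇒0<q-p p<q) (0<r B)) ,
  B ℕ.+ B , λ n hn → euler-step {p} {q} {B} {n} (<⇒≤ p<q) (proj₂ (archimedean ∣ p ∣)) hn
  where B = proj₁ (archimedean ∣ p ∣)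

expℚ-cancel-< : ∀ {p q} → expℚ p <ℝ expℚ q → p < q
expℚ-cancel-< {p} {q} h = go (p <? q)
  where
  go : Dec (p < q) → p < q
  go (yes p<q) = p<q
  go (no p≮q)  = contradiction h (lemma (≮⇒≥ p≮q))
    where
    lemma : q ≤ p → ¬ expℚ p <ℝ expℚ q
    lemma q≤p (δ , 0<δ , N , f) = <-irrefl refl (begin-strict
      euler n p       <⟨ +⇒< δ 0<δ refl ⟩
      euler n p + δ   ≤⟨ f n (ℕ.m≤m⊔n N (B ℕ.+ B)) ⟩
      euler n q       ≤⟨ +⇒≤ (euler⁻ B * ((p - q) * r B))
                           (0≤p*q (<⇒≤ (0<euler⁻ B)) (0≤p*q (p≤q⇒0≤q-p q≤p) (0≤r B))) refl ⟩
      euler n q + euler⁻ B * ((p - q) * r B)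
                      ≤⟨ euler-step {q} {p} {B} {n} q≤p hB (ℕ.m≤n⊔m N (B ℕ.+ B)) ⟩
      euler n p       ∎)
      where
      open ≤-Reasoning
      B = proj₁ (archimedean ∣ q ∣)
      hB = proj₂ (archimedean ∣ q ∣)
      n = N ℕ.⊔ (B ℕ.+ B)

1+ι≤euler : ∀ k n → 1ℚ + ι k ≤ euler n (ι k)
1+ι≤euler k n = begin
  1ℚ + ι k                          ≡⟨ cong (λ z → 1ℚ + z) (*-identityʳ (ι k)) ⟨
  1ℚ + ι k * 1ℚ                     ≡⟨ cong (λ z → 1ℚ + ι k * z) (ι*r n) ⟨
  1ℚ + ι k * (ι (suc n) * r n)
    ≡⟨ solve 3 (λ k i r → con 1ℚ :+ k :* (i :* r) := con 1ℚ :+ i :* (k :* r)) refl (ι k) (ι (suc n)) (r n) ⟩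
  1ℚ + ι (suc n) * (ι k * r n)      ≤⟨ bernoulli (0≤p*q (0≤ι k) (0≤r n)) (suc n) ⟩
  euler n (ι k)                     ∎
  where open ≤-Reasoning

euler-neg≤r : ∀ k n → k ℕ.+ k ℕ.≤ n → euler n (- ι k) ≤ r k
euler-neg≤r k n hn = begin
  e                               ≡⟨ *-identityʳ e ⟨
  e * 1ℚ                          ≡⟨ cong (e *_) (ι*r k) ⟨
  e * (ι (suc k) * r k)           ≡⟨ cong (λ z → e * (z * r k)) (ι-suc k) ⟩
  e * ((1ℚ + ι k) * r k)          ≤⟨ *-monoˡ e 0≤e (*-monoʳ (r k) (0≤r k) (1+ι≤euler k n)) ⟩
  e * (euler n (ι k) * r k)       ≡⟨ *-assoc e (euler n (ι k)) (r k) ⟨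
  e * euler n (ι k) * r k         ≡⟨ cong (_* r k) (^-distrib-* (1ℚ + - ι k * r n) (1ℚ + ι k * r n) (suc n)) ⟨
  ((1ℚ + - ι k * r n) * (1ℚ + ι k * r n)) ^ suc n * r k
    ≤⟨ *-monoʳ (r k) (0≤r k) (^≤1 0≤prod prod≤1 (suc n)) ⟩
  1ℚ * r k                        ≡⟨ *-identityˡ (r k) ⟩
  r k                             ∎
  where
  open ≤-Reasoning
  e = euler n (- ι k)
  ∣-k∣ : ∣ - ι k ∣ ≤ ι k
  ∣-k∣ = ≤-reflexive (trans (∣-p∣≡∣p∣ (ι k)) (0≤p⇒∣p∣≡p (0≤ι k)))
  0≤b = 0≤base { - ι k} {k} {n} ∣-k∣ hn
  0≤e : 0ℚ ≤ e
  0≤e = ^-nonNeg 0≤b (suc n)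
  0≤prod = 0≤p*q 0≤b (≤-trans 0≤1 (1≤1+ι*r k n))
  prod≤1 : (1ℚ + - ι k * r n) * (1ℚ + ι k * r n) ≤ 1ℚ
  prod≤1 = +⇒≤ ((ι k * r n) * (ι k * r n)) (0≤p*q (0≤p*q (0≤ι k) (0≤r n)) (0≤p*q (0≤ι k) (0≤r n)))
    (solve 2 (λ k r → con 1ℚ := (con 1ℚ :+ (:- k) :* r) :* (con 1ℚ :+ k :* r) :+ k :* r :* (k :* r)) refl (ι k) (r n))

exp-above : ∀ x → Σ[ k ∈ ℕ ] x <ℝ expℚ (ι k)
exp-above x = B , 1ℚ , 0<r 0 , Nb , λ n h → ≤-trans
  (subst (seq x n + 1ℚ ≤_) (+-comm (ι B) 1ℚ) (+-monoˡ-≤ 1ℚ (∣p∣≤⇒≤ (bx n h))))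
  (1+ι≤euler B n)
  where
  B  = proj₁ (bounded x)
  Nb = proj₁ (proj₂ (bounded x))
  bx = proj₂ (proj₂ (bounded x))

exp-below : ∀ x → 0ℝ <ℝ x → Σ[ k ∈ ℕ ] expℚ (- ι k) <ℝ x
exp-below x (δ , 0<δ , N , f) = k , η , 0<η , N ℕ.⊔ (k ℕ.+ k) , λ n h → begin
  euler n (- ι k) + η
    ≤⟨ +-monoˡ-≤ η (≤-trans (euler-neg≤r k n (proj₂ (m⊔n≤o⇒ {N} h))) (proj₂ (r-small 0<η))) ⟩
  η + η         ≡⟨ proj₂ (proj₂ ηs) ⟩
  δ             ≡⟨ +-identityˡ δ ⟨
  0ℚ + δ        ≤⟨ f n (proj₁ (m⊔n≤o⇒ h)) ⟩
  seq x n       ∎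
  where
  open ≤-Reasoning
  ηs = half 0<δ
  η = proj₁ ηs
  0<η = proj₁ (proj₂ ηs)
  k = proj₁ (r-small 0<η)

module Log (x : ℝ) (0<x : 0ℝ <ℝ x) where

  search : ∀ {h} → 0ℚ < h → ∀ j q → expℚ q <ℝ x → x <ℝ expℚ (q + ι j * h) →
           Σ[ q ∈ ℚ ] expℚ q <ℝ x × x <ℝ expℚ (q + (h + h))
  search {h} 0<h zero q below above = ⊥-elim (<ℝ-asym {expℚ q} {x} below
    (subst (λ z → x <ℝ expℚ z) (trans (cong (λ z → q + z) (*-zeroˡ h)) (+-identityʳ q)) above))
  search {h} 0<h (suc j) q below above =
    [ (λ below′ → search 0<h j (q + h) below′ (subst (λ z → x <ℝ expℚ z) shift above))
    , (λ above′ → q , below , above′)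
    ]′ (<ℝ-cotrans {expℚ (q + h)} {expℚ (q + (h + h))} (expℚ-mono-< (+-monoʳ-< q h<2h)) x)
    where
    h<2h : h < h + h
    h<2h = +⇒< h 0<h refl
    shift : q + ι (suc j) * h ≡ (q + h) + ι j * h
    shift = trans (cong (λ z → q + z * h) (ι-suc j))
      (solve 3 (λ q j h → q :+ (con 1ℚ :+ j) :* h := (q :+ h) :+ j :* h) refl q (ι j) h)

  found : ∀ n → Σ[ q ∈ ℚ ] expℚ q <ℝ x × x <ℝ expℚ (q + r n)
  found n = proj₁ hit , proj₁ (proj₂ hit) ,
    subst (λ z → x <ℝ expℚ (proj₁ hit + z)) h+h≡r (proj₂ (proj₂ hit))
    where
    h+h≡r : ½ * r n + ½ * r n ≡ r n
    h+h≡r = solve 1 (λ r → con ½ :* r :+ con ½ :* r := r) refl (r n)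
    0<h : 0ℚ < ½ * r n
    0<h = 0<p*q {½} {r n} (*<* (ℤ.+<+ (ℕ.s≤s ℕ.z≤n))) (0<r n)
    k = proj₁ (exp-below x 0<x)
    l = proj₁ (exp-above x)
    j = (k ℕ.+ l) ℕ.* (2 ℕ.* suc n)
    reach : - ι k + ι j * (½ * r n) ≡ ι l
    reach = begin
      - ι k + ι j * (½ * r n)
        ≡⟨ cong (λ z → - ι k + z * (½ * r n))
             (trans (ι-* (k ℕ.+ l) (2 ℕ.* suc n)) (cong₂ _*_ (ι-+ k l) (ι-* 2 (suc n)))) ⟩
      - ι k + ((ι k + ι l) * (ι 2 * ι (suc n))) * (½ * r n)
        ≡⟨ solve 4 (λ k l i r → (:- k) :+ ((k :+ l) :* (con (ι 2) :* i)) :* (con ½ :* r)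
             := (:- k) :+ (k :+ l) :* (i :* r)) refl (ι k) (ι l) (ι (suc n)) (r n) ⟩
      - ι k + (ι k + ι l) * (ι (suc n) * r n)
        ≡⟨ cong (λ z → - ι k + (ι k + ι l) * z) (ι*r n) ⟩
      - ι k + (ι k + ι l) * 1ℚ
        ≡⟨ solve 2 (λ k l → (:- k) :+ (k :+ l) :* con 1ℚ := l) refl (ι k) (ι l) ⟩
      ι l ∎
      where open ≡-Reasoning
    hit = search 0<h j (- ι k) (proj₂ (exp-below x 0<x))
      (subst (λ z → x <ℝ expℚ z) (sym reach) (proj₂ (exp-above x)))

  -- Abstract because unfolding the search is costly; the type alone
  -- determines the limit.
  abstract
    approx : ∀ n → Σ[ q ∈ ℚ ] expℚ q <ℝ x × x <ℝ expℚ (q + r n)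
    approx = found

  approx-< : ∀ m n → proj₁ (approx m) < proj₁ (approx n) + r n
  approx-< m n = expℚ-cancel-< (<ℝ-trans {expℚ (proj₁ (approx m))} {x} {expℚ (proj₁ (approx n) + r n)}
    (proj₁ (proj₂ (approx m))) (proj₂ (proj₂ (approx n))))

  approx-conv : ∀ {ε} → 0ℚ < ε → Σ[ N ∈ ℕ ] (∀ m n → N ℕ.≤ m → N ℕ.≤ n →
                  ∣ proj₁ (approx m) - proj₁ (approx n) ∣ ≤ ε)
  approx-conv {ε} 0<ε = proj₁ (r-small 0<ε) , λ m n N≤m N≤n →
    ∣p∣≤ (diff m n N≤n) (subst (- ε ≤_) (neg-diff m n) (neg-antimono-≤ (diff n m N≤m)))
    where
    diff : ∀ m n → proj₁ (r-small 0<ε) ℕ.≤ n → proj₁ (approx m) - proj₁ (approx n) ≤ ε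
    diff m n N≤n = ≤-trans
      (+⇒≤ ((proj₁ (approx n) + r n) - proj₁ (approx m)) (p≤q⇒0≤q-p (<⇒≤ (approx-< m n)))
        (solve 3 (λ a b r → r := (a :- b) :+ ((b :+ r) :- a)) refl (proj₁ (approx m)) (proj₁ (approx n)) (r n)))
      (≤-trans (r-antimono N≤n) (proj₂ (r-small 0<ε)))
    neg-diff : ∀ m n → - (proj₁ (approx n) - proj₁ (approx m)) ≡ proj₁ (approx m) - proj₁ (approx n)
    neg-diff m n = solve 2 (λ a b → :- (b :- a) := a :- b) refl (proj₁ (approx m)) (proj₁ (approx n))

-- The inverse of exp: the n-th term q has  exp q < x < exp (q + 1/(n+1)).
log : (x : ℝ) → 0ℝ <ℝ x → ℝ
log x 0<x = mkℝ (λ n → proj₁ (approx n)) approx-conv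
  where open Log x 0<x

pow : (x : ℝ) → 0ℝ <ℝ x → ℝ → ℝ
pow x 0<x c = exp (c *ℝ log x 0<x)

log-lower : ∀ {x q} (0<x : 0ℝ <ℝ x) → ¬ x <ℝ expℚ q → ∀ n → q ≤ seq (log x 0<x) n + r n
log-lower {x} {q} 0<x x≮ n = ≮⇒≥ λ lt → x≮ (<ℝ-trans {x} {expℚ (proj₁ (approx n) + r n)} {expℚ q}
    (proj₂ (proj₂ (approx n))) (expℚ-mono-< lt))
  where open Log x 0<x

-- log n and log log n for natural n. Both are positive once n ≥ 16
-- (e² < 16), which is assumed throughout; all claims are asymptotic.

euler⁺2≡16 : euler⁺ 2 ≡ ι 16
euler⁺2≡16 = refl

module _ (n : ℕ) (16≤n : 16 ℕ.≤ n) where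

  0<fromℕ : 0ℝ <ℝ fromℕ n
  0<fromℕ = 1ℚ , 0<r 0 , 0 , λ _ _ → subst (_≤ ι n) (sym (+-identityˡ 1ℚ))
    (ι-mono (ℕ.≤-trans (ℕ.s≤s ℕ.z≤n) 16≤n))

  ln : ℝ
  ln = log (fromℕ n) 0<fromℕ

  euler-2≤ : ∀ k → euler k (ι 2) ≤ ι n
  euler-2≤ k = ≤-trans (euler-≤euler⁺ 2 k) (subst (_≤ ι n) (sym euler⁺2≡16) (ι-mono {16} {n} 16≤n))

  2≤ln : ∀ k → ι 2 ≤ seq ln k + r k
  2≤ln = log-lower {fromℕ n} {ι 2} 0<fromℕ lemma
    where
    lemma : ¬ fromℕ n <ℝ expℚ (ι 2)
    lemma (δ , 0<δ , N , f) = <-irrefl {ι n} refl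
      (<-≤-trans {ι n} {ι n + δ} {ι n} (+⇒< {ι n} {ι n + δ} δ 0<δ refl)
        (≤-trans {ι n + δ} {euler N (ι 2)} {ι n} (f N ℕ.≤-refl) (euler-2≤ N)))

  0<ln : 0ℝ <ℝ ln
  0<ln = 1ℚ , 0<r 0 , 0 , λ k _ →
    +⇒≤ ((seq ln k + r k - ι 2) + (1ℚ - r k))
      (0≤p+q (p≤q⇒0≤q-p (2≤ln k)) (p≤q⇒0≤q-p (r-antimono {0} {k} ℕ.z≤n)))
      (solve 2 (λ x r → x := con 0ℚ :+ con 1ℚ :+ ((x :+ r :- con (ι 2)) :+ (con 1ℚ :- r))) refl (seq ln k) (r k))

  lnln : ℝ
  lnln = log ln 0<ln

  ½≤lnln : ∀ k → ½ ≤ seq lnln k + r k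
  ½≤lnln = log-lower {ln} {½} 0<ln lemma
    where
    open ≤-Reasoning
    lemma : ¬ ln <ℝ expℚ ½
    lemma (δ , 0<δ , N , f) =
      let (η , 0<η , 2η≡δ) = half 0<δ
          (M , hM) = r-small 0<η
          k = N ℕ.⊔ M
      in <-irrefl refl (begin-strict
        seq ln k + δ          ≤⟨ f k (ℕ.m≤m⊔n N M) ⟩
        euler k ½             ≤⟨ euler-½ k ⟩
        ι 2                   ≤⟨ 2≤ln k ⟩
        seq ln k + r k        ≤⟨ +-monoʳ-≤ (seq ln k) (≤-trans (r-antimono (ℕ.m≤n⊔m N M)) hM) ⟩
        seq ln k + η          <⟨ +-monoʳ-< (seq ln k) (+⇒< η 0<η refl) ⟩
        seq ln k + (η + η)    ≡⟨ cong (λ z → seq ln k + z) 2η≡δ ⟩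
        seq ln k + δ          ∎)

  0<lnln : 0ℝ <ℝ lnln
  0<lnln = r 3 , 0<r 3 , 3 , λ k 3≤k →
    +⇒≤ ((seq lnln k + r k - ½) + (r 3 - r k))
      (0≤p+q (p≤q⇒0≤q-p (½≤lnln k)) (p≤q⇒0≤q-p (r-antimono 3≤k)))
      (solve 2 (λ x r′ → x := con 0ℚ :+ con (r 3) :+ ((x :+ r′ :- con ½) :+ (con (r 3) :- r′)))
        refl (seq lnln k) (r k))

  ln^ : ℝ → ℝ
  ln^ c = pow ln 0<ln c

  0<ln^ : ∀ c → 0ℝ <ℝ ln^ c
  0<ln^ c = 0<exp (c *ℝ lnln)

  n/ln^ : ℝ → ℝ
  n/ln^ c = fromℕ n /ℝ ln^ c [ 0<ln^ c ]

  ln/lnln : (a : ℝ) → 0ℝ <ℝ a → ℝ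
  ln/lnln a 0<a = ln /ℝ a *ℝ lnln [ 0<x*y {a} {lnln} 0<a 0<lnln ]

IsFloor : ℕ → ℝ → Set
IsFloor s x = fromℕ s ≤ℝ x × x <ℝ fromℕ (suc s)

Eventually : ((n : ℕ) → 16 ℕ.≤ n → Set) → Set
Eventually P = Σ[ N ∈ ℕ ] (∀ n (16≤n : 16 ℕ.≤ n) → N ℕ.≤ n → P n 16≤n)

-- No absolute values: only used for nonnegative functions.
infix 4 _=O_
_=O_ : (f g : (n : ℕ) → 16 ℕ.≤ n → ℝ) → Set
f =O g = Σ[ K ∈ ℝ ] 0ℝ <ℝ K × Eventually (λ n 16≤n → f n 16≤n ≤ℝ K *ℝ g n 16≤n)

-- h₁ > h₂ > ⋯ > h_p = 1, indexed from 0, so that gap i is h_{i+1};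
-- all gaps are positive because the last and smallest one is 1.
record GapSequence : Set where
  field
    p-1        : ℕ
    gap        : Fin (suc p-1) → ℕ
    decreasing : ∀ {i j} → i Fin.< j → gap j ℕ.< gap i
    last       : gap (Fin.fromℕ p-1) ≡ 1

  p : ℕ
  p = suc p-1

-- The ℕ counts the exchanges made so far.
State : ℕ → Set
State n = Vec (Fin n) n × ℕ

exchange : ∀ {n} → Fin n → Fin n → Vec (Fin n) n → Vec (Fin n) n
exchange i j a = a [ i ]≔ lookup a j [ j ]≔ lookup a i

-- Positions on the h-chain of b are written b + k·h.
sift : ∀ {n} (h b k : ℕ) → b ℕ.+ k ℕ.* h ℕ.< n → State n → State n
sift h b zero    _   st      = st
sift {n} h b (suc k) pos<n (a , e) =
  if does (lookup a i Fin.<? lookup a j)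
  then sift h b k prev<n (exchange i j a , suc e)
  else (a , e)
  where
  prev<n : b ℕ.+ k ℕ.* h ℕ.< n
  prev<n = ℕ.≤-<-trans (ℕ.+-monoʳ-≤ b (ℕ.m≤n+m (k ℕ.* h) h)) pos<n
  i = Fin.fromℕ< pos<n
  j = Fin.fromℕ< prev<n

siftIfInside : ∀ {n} → ℕ → ℕ → State n → ℕ → State n
siftIfInside {n} h b st k with b ℕ.+ k ℕ.* h ℕ.<? n
... | yes pos<n = sift h b k pos<n st
... | no  _     = st

-- Insertion sort of the chain b, b + h, b + 2h, …; since h ≥ 1, the
-- indices k < n exhaust it.
sortChain : ∀ {n} → ℕ → State n → ℕ → State n
sortChain {n} h st b = foldl (siftIfInside h b) st (upTo n)

pass : ∀ {n} → ℕ → State n → State n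
pass h st = foldl (sortChain h) st (upTo h)

shellsort : ∀ {n} → GapSequence → Vec (Fin n) n → State n
shellsort H a = foldl (λ st j → pass (gap j) st) (a , 0) (allFin p)
  where open GapSequence H

exchanges : ∀ {n} → GapSequence → Vec (Fin n) n → ℕ
exchanges H a = proj₂ (shellsort H a)

-- words n k lists all k-tuples over Fin n.
words : ∀ n k → List (Vec (Fin n) k)
words n zero    = [] ∷ []
words n (suc k) = cartesianProductWith _∷_ (allFin n) (words n k)

permutations : ∀ n → List (Vec (Fin n) n)
permutations n = filter (allPairs? (λ x y → ¬? (x Fin.≟ y))) (words n n)

W : ℕ → GapSequence → ℕ
W n H = max 0 (map (exchanges H) (permutations n))

{-# OPTIONS --safe #-}
module Submission where

-- Suppose that all gaps before h are at least n/ℓ. By Dirichlet's theorem some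
-- j ≤ (12ℓ)^k makes j times each of these k gaps nearly divisible by a modulus
-- proportional to n. The positions x for which j x is far from 0 modulo that
-- modulus, with a tolerance that widens as x decreases, form a set D closed under
-- subtracting the gaps, and both D and its complement have density at least 1/3.
-- Placing the smallest keys on D, in increasing order, and the others in increasing
-- order elsewhere, the first k passes do nothing, while the keys on D still have to
-- travel a total distance of order n². As an exchange covers a distance of at most
-- h, the cost W satisfies W h ≥ n²/C, so h ≥ n/ℓ again when ℓ ≥ C W/n. With ℓ of
-- order (log n)^c this continues as long as (12ℓ)^k is less than a constant times n.

open import Defs
open import Algebra.Bundles using (CommutativeRing)
import Algebra.Properties.CommutativeSemiring.Exp
import Algebra.Properties.Semiring.Exp
open import Data.Nat.Base as ℕ using (ℕ; zero; suc)
import Data.Nat.Properties as ℕ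
open import Data.Product.Base using (Σ-syntax; _×_; _,_; proj₁; proj₂)
import Data.Rational.Base as ℚ
open import Data.Rational.Properties using (+-*-commutativeRing)
open import Data.Rational.Solver using (module +-*-Solver)
open import Data.Sum.Base using (_⊎_; inj₁; inj₂; [_,_]′)
open import Relation.Binary.PropositionalEquality
open import Relation.Nullary using (¬_; contradiction)

-- D must be closed under subtracting a gap h exactly, while j h is only close to a multiple of the
-- modulus. Long gaps make the widening tolerance possible: with modulus 24μ and precision 1/(12ℓ),
-- a step by h causes an error of at most 2μ/ℓ, and n ≤ ℓh turns this into 2μh/n, proportional to
-- the step. A tolerance that is linear in x therefore pays for every step and moves by at most 2μ
-- in all. Density rests on a shift τ with jτ near a third of the modulus. Rounding τ costs up to j,
-- hence the demand j ≤ μ and the condition that (12ℓ)^k stay below a constant times n. The role of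
-- ε: the constants in the base of (12ℓ)^k produce a factor exponential in k, which (log n)^(εk)
-- outgrows because log log n is unbounded.

module Analysis where

  open import Data.Rational.Base
  open import Data.Rational.Properties
  open +-*-Solver using (solve; _:=_; _:+_; _:*_; _:-_; con)
  open Algebra.Properties.Semiring.Exp (CommutativeRing.semiring +-*-commutativeRing) using (_^_; ^-assocʳ)
  open Algebra.Properties.CommutativeSemiring.Exp (CommutativeRing.commutativeSemiring +-*-commutativeRing) using (^-distrib-*)
  open ℝ

  -- Rational estimates for the approximants (1 + a/m)^m of exp

  ι-cancel-≤ : ∀ {m n} → ι m ≤ ι n → m ℕ.≤ n
  ι-cancel-≤ {m} {n} ιm≤ιn = ℕ.≮⇒≥ λ n<m → <-irrefl refl (begin-strict
    ι n          <⟨ +⇒< 1ℚ (0<r 0) (+-comm 1ℚ (ι n)) ⟩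
    1ℚ + ι n     ≡⟨ ι-suc n ⟨
    ι (suc n)    ≤⟨ ι-mono n<m ⟩
    ι m          ≤⟨ ιm≤ιn ⟩
    ι n          ∎)
    where open ≤-Reasoning

  ι-^ : ∀ b s → ι (b ℕ.^ s) ≡ ι b ^ s
  ι-^ b zero    = refl
  ι-^ b (suc s) = trans (ι-* b (b ℕ.^ s)) (cong (ι b *_) (ι-^ b s))

  euler-mono : ∀ {a b} k → 0ℚ ≤ a → a ≤ b → euler k a ≤ euler k b
  euler-mono {a} {b} k 0≤a a≤b =
    ^-monoˡ (0≤p+q 0≤1 (0≤p*q 0≤a (0≤r k))) (+-monoʳ-≤ 1ℚ (*-monoʳ (r k) (0≤r k) a≤b)) (suc k)

  1≤euler : ∀ {a} k → 0ℚ ≤ a → 1ℚ ≤ euler k a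
  1≤euler {a} k 0≤a = 1≤^ (+⇒≤ (a * r k) (0≤p*q 0≤a (0≤r k)) refl) (suc k)

  ι*r≤1 : ∀ {m k} → m ℕ.≤ suc k → ι m * r k ≤ 1ℚ
  ι*r≤1 {m} {k} m≤k = ≤-trans (*-monoʳ (r k) (0≤r k) (ι-mono m≤k)) (≤-reflexive (ι*r k))

  -- The product of the two bases has the cross term ab/(k + 1)², and ab ≤ ZA ≤ k makes it at most
  -- 1/(k + 1). So exponents add up to an error of 1, without passing to the limit.
  euler-* : ∀ {a b Z A} k → 0ℚ ≤ a → 0ℚ ≤ b → a ≤ ι Z → b ≤ ι A → Z ℕ.* A ℕ.≤ k →
            euler k a * euler k b ≤ euler k (a + b + 1ℚ)
  euler-* {a} {b} {Z} {A} k 0≤a 0≤b a≤Z b≤A ZA≤k = begin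
    euler k a * euler k b                              ≡⟨ ^-distrib-* (1ℚ + a * r k) (1ℚ + b * r k) (suc k) ⟨
    ((1ℚ + a * r k) * (1ℚ + b * r k)) ^ suc k
      ≤⟨ ^-monoˡ (0≤p*q (0≤p+q 0≤1 (0≤p*q 0≤a (0≤r k))) (0≤p+q 0≤1 (0≤p*q 0≤b (0≤r k)))) base (suc k) ⟩
    euler k (a + b + 1ℚ)                               ∎
    where
    open ≤-Reasoning
    abr≤1 : a * b * r k ≤ 1ℚ
    abr≤1 = ≤-trans (*-monoʳ (r k) (0≤r k) (*-mono (0≤ι Z) 0≤b a≤Z b≤A))
      (subst (λ z → z * r k ≤ 1ℚ) (ι-* Z A) (ι*r≤1 (ℕ.m≤n⇒m≤1+n ZA≤k)))
    base : (1ℚ + a * r k) * (1ℚ + b * r k) ≤ 1ℚ + (a + b + 1ℚ) * r k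
    base = +⇒≤ ((1ℚ - a * b * r k) * r k) (0≤p*q (p≤q⇒0≤q-p abr≤1) (0≤r k))
      (solve 3 (λ a b r → con 1ℚ :+ (a :+ b :+ con 1ℚ) :* r
        := (con 1ℚ :+ a :* r) :* (con 1ℚ :+ b :* r) :+ (con 1ℚ :- a :* b :* r) :* r) refl a b (r k))

  -- (1 + w/m)^{ms} = (1 + sw/(ms))^{ms}
  euler-^ : ∀ w m s → euler m w ^ suc s ≡ euler (s ℕ.+ m ℕ.* suc s) (ι (suc s) * w)
  euler-^ w m s = trans (^-assocʳ (1ℚ + w * r m) (suc m) (suc s)) (cong (λ z → (1ℚ + z) ^ suc (s ℕ.+ m ℕ.* suc s)) (begin
    w * r m                              ≡⟨ *-identityʳ (w * r m) ⟨
    w * r m * 1ℚ                         ≡⟨ cong (w * r m *_) (ι*r s) ⟨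
    w * r m * (ι (suc s) * r s)          ≡⟨ solve 4 (λ w m i s → w :* m :* (i :* s) := i :* w :* (m :* s)) refl w (r m) (ι (suc s)) (r s) ⟩
    ι (suc s) * w * (r m * r s)          ≡⟨ cong (ι (suc s) * w *_) (r-* {s ℕ.+ m ℕ.* suc s} {m} {s} refl) ⟨
    ι (suc s) * w * r (s ℕ.+ m ℕ.* suc s) ∎))
    where open ≡-Reasoning

  euler-below : ∀ {q n} → expℚ q <ℝ fromℕ n → Σ[ M ∈ ℕ ] (∀ m → M ℕ.≤ m → euler m q ≤ ι n)
  euler-below {q} {n} (δ , 0<δ , N , f) = N , λ m N≤m → ≤-trans (+⇒≤ {euler m q} δ (<⇒≤ 0<δ) refl) (f m N≤m)

  module _ (n : ℕ) (16≤n : 16 ℕ.≤ n) where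

    ln-large : ∀ {Λ} → euler⁺ Λ ≤ ι n → ∀ k → ι Λ ≤ seq (ln n 16≤n) k + r k
    ln-large {Λ} Λ≤n = log-lower {fromℕ n} {ι Λ} (0<fromℕ n 16≤n) λ (δ , 0<δ , N , f) → <-irrefl refl (begin-strict
      ι n                <⟨ +⇒< δ 0<δ refl ⟩
      ι n + δ            ≤⟨ f N ℕ.≤-refl ⟩
      euler N (ι Λ)      ≤⟨ euler-≤euler⁺ Λ N ⟩
      euler⁺ Λ           ≤⟨ Λ≤n ⟩
      ι n                ∎)
      where open ≤-Reasoning

    -- The summand `1ℚ` in the first hypothesis absorbs the error `r N` ≤ 1 in the lower bound for
    -- the approximant of log n.
    lnln-large : ∀ {Λ Λ′} → 1ℚ + euler⁺ Λ ≤ ι Λ′ → euler⁺ Λ′ ≤ ι n → ∀ k → ι Λ ≤ seq (lnln n 16≤n) k + r k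
    lnln-large {Λ} {Λ′} Λ≤Λ′ Λ′≤n = log-lower {ln n 16≤n} {ι Λ} (0<ln n 16≤n) λ (δ , 0<δ , N , f) → <-irrefl refl (begin-strict
      1ℚ + euler⁺ Λ                  ≤⟨ Λ≤Λ′ ⟩
      ι Λ′                           ≤⟨ ln-large {Λ′} Λ′≤n N ⟩
      seq (ln n 16≤n) N + r N        ≤⟨ +-monoʳ-≤ (seq (ln n 16≤n) N) (r-antimono {0} {N} ℕ.z≤n) ⟩
      seq (ln n 16≤n) N + 1ℚ         <⟨ +-monoˡ-< 1ℚ (+⇒< {seq (ln n 16≤n) N} δ 0<δ refl) ⟩
      seq (ln n 16≤n) N + δ + 1ℚ     ≤⟨ +-monoˡ-≤ 1ℚ (f N ℕ.≤-refl) ⟩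
      euler N (ι Λ) + 1ℚ             ≤⟨ +-monoˡ-≤ 1ℚ (euler-≤euler⁺ Λ N) ⟩
      euler⁺ Λ + 1ℚ                  ≡⟨ +-comm (euler⁺ Λ) 1ℚ ⟩
      1ℚ + euler⁺ Λ                  ∎)
      where open ≤-Reasoning

    ln-below : ∀ k → Σ[ M ∈ ℕ ] (∀ m → M ℕ.≤ m → euler m (seq (ln n 16≤n) k) ≤ ι n)
    ln-below k = euler-below {seq (ln n 16≤n) k} {n} (proj₁ (proj₂ (Log.approx (fromℕ n) (0<fromℕ n 16≤n) k)))

  -- Transfer from reals to rational approximants

  record Tail (P : ℕ → Set) : Set where
    constructor tail
    field
      start : ℕ
      holds : ∀ k → start ℕ.≤ k → P k
  open Tail

  infixr 5 _⊗_
  -- An inequality of reals constrains the approximants only from some index on. Intersecting tails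
  -- yields one index at which a purely rational lemma applies.
  _⊗_ : ∀ {P Q : ℕ → Set} → Tail P → Tail Q → Tail (λ k → P k × Q k)
  tail M p ⊗ tail N q = tail (M ℕ.⊔ N) λ k h → p k (proj₁ (m⊔n≤o⇒ h)) , q k (proj₂ (m⊔n≤o⇒ {M} h))

  positive-tail : ∀ x → 0ℝ <ℝ x → Tail (λ k → 0ℚ < seq x k)
  positive-tail x (δ , 0<δ , N , f) = tail N λ k h → <-≤-trans 0<δ (subst (_≤ seq x k) (+-identityˡ δ) (f k h))

  bounded-tail : ∀ x → Σ[ B ∈ ℕ ] Tail (λ k → seq x k ≤ ι B)
  bounded-tail x = proj₁ (bounded x) , tail (proj₁ (proj₂ (bounded x))) λ k h → ∣p∣≤⇒≤ {seq x k} (proj₂ (proj₂ (bounded x)) k h)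

  ≤-tail : ∀ x y {η} → 0ℚ < η → x ≤ℝ y → Tail (λ k → seq x k ≤ seq y k + η)
  ≤-tail x y 0<η x≤y = tail (proj₁ (x≤y 0<η)) (proj₂ (x≤y 0<η))

  beyond : ∀ M → Tail (M ℕ.≤_)
  beyond M = tail M λ k M≤k → M≤k

  cauchy-tail : ∀ x → Σ[ M ∈ ℕ ] (∀ m n → M ℕ.≤ m → M ℕ.≤ n → seq x m ≤ seq x n + 1ℚ)
  cauchy-tail x = proj₁ (cauchy x {1ℚ} (0<r 0)) , λ m n hm hn →
    +⇒≤ (1ℚ - (seq x m - seq x n)) (p≤q⇒0≤q-p (∣p∣≤⇒≤ {seq x m - seq x n} (proj₂ (cauchy x {1ℚ} (0<r 0)) m n hm hn)))
      (solve 2 (λ a b → b :+ con 1ℚ := a :+ (con 1ℚ :- (a :- b))) refl (seq x m) (seq x n))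

  -- The error r Y y ≤ 1 is absorbed by the slack (s + 1)(y − w) ≥ 1.
  quotient-bound : ∀ s {L y w} Y → 0ℚ < y → y ≤ ι Y → w + 1ℚ ≤ y → ι (suc s) ≤ L * inv y + r Y → ι (suc s) * w ≤ L
  quotient-bound s {L} {y} {w} Y 0<y y≤Y w+1≤y s≤ = +-cancelʳ-≤ (begin
    ι (suc s) * w + 1ℚ               ≤⟨ +-monoʳ-≤ (ι (suc s) * w) (ι-mono {1} {suc s} (ℕ.s≤s ℕ.z≤n)) ⟩
    ι (suc s) * w + ι (suc s)        ≡⟨ solve 2 (λ s w → s :* w :+ s := s :* (w :+ con 1ℚ)) refl (ι (suc s)) w ⟩
    ι (suc s) * (w + 1ℚ)             ≤⟨ *-monoˡ (ι (suc s)) (0≤ι (suc s)) w+1≤y ⟩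
    ι (suc s) * y                    ≤⟨ *-monoʳ y (<⇒≤ 0<y) s≤ ⟩
    (L * inv y + r Y) * y            ≡⟨ solve 4 (λ L i r y → (L :* i :+ r) :* y := L :* (i :* y) :+ y :* r) refl L (inv y) (r Y) y ⟩
    L * (inv y * y) + y * r Y        ≡⟨ cong (λ z → L * z + y * r Y) (inv-* 0<y) ⟩
    L * 1ℚ + y * r Y                 ≤⟨ +-mono-≤ (≤-reflexive (*-identityʳ L))
                                          (≤-trans (*-monoʳ (r Y) (0≤r Y) y≤Y) (ι*r≤1 (ℕ.n≤1+n Y))) ⟩
    L + 1ℚ                           ∎)
    where
    open ≤-Reasoning
    +-cancelʳ-≤ : ∀ {a b} → a + 1ℚ ≤ b + 1ℚ → a ≤ b
    +-cancelʳ-≤ {a} {b} h = +⇒≤ {a} {b} ((b + 1ℚ) - (a + 1ℚ)) (p≤q⇒0≤q-p h)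
      (solve 2 (λ a b → b := a :+ ((b :+ con 1ℚ) :- (a :+ con 1ℚ))) refl a b)

  -- The exponent w = z₀ + A + 2 satisfies b ≤ A (1 + zₘ/m)ᵐ ≤ (1 + w/m)ᵐ and (s + 1) w ≤ L.
  power-bound : ∀ {z₀ zₘ y L} A Y Z n b s m → 0ℚ ≤ z₀ → 0ℚ < y → y ≤ ι Y → z₀ + ι (3 ℕ.+ A) ≤ y →
    ι (suc s) ≤ L * inv y + r Y → (∀ m′ → m ℕ.≤ m′ → euler m′ L ≤ ι n) → 0ℚ ≤ zₘ → zₘ ≤ z₀ + 1ℚ →
    ι b ≤ ι A * euler m zₘ → z₀ + 1ℚ ≤ ι Z → Z ℕ.* A ℕ.≤ m → b ℕ.^ suc s ℕ.≤ n
  power-bound {z₀} {zₘ} {y} {L} A Y Z n b s m 0≤z₀ 0<y y≤Y gap s≤L/y below 0≤zₘ zₘ≤z b≤ z≤Z ZA≤m = ι-cancel-≤ (begin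
    ι (b ℕ.^ suc s)              ≡⟨ ι-^ b (suc s) ⟩
    ι b ^ suc s                  ≤⟨ ^-monoˡ (0≤ι b) b≤euler (suc s) ⟩
    euler m w ^ suc s            ≡⟨ euler-^ w m s ⟩
    euler m′ (ι (suc s) * w)     ≤⟨ euler-mono m′ (0≤p*q (0≤ι (suc s)) 0≤w) (quotient-bound s {L} {y} {w} Y 0<y y≤Y w+1≤y s≤L/y) ⟩
    euler m′ L                   ≤⟨ below m′ (ℕ.≤-trans (ℕ.m≤m*n m (suc s)) (ℕ.m≤n+m _ s)) ⟩
    ι n                          ∎)
    where
    open ≤-Reasoning
    m′ = s ℕ.+ m ℕ.* suc s
    z′ = z₀ + 1ℚ
    0≤z′ : 0ℚ ≤ z′
    0≤z′ = 0≤p+q 0≤z₀ 0≤1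
    -- Three units of slack are spent: one on the passage from `zₘ` to `z₀`, one on the cross term
    -- in `euler-*`, one on `quotient-bound`.
    w = z′ + ι A + 1ℚ
    0≤w : 0ℚ ≤ w
    0≤w = 0≤p+q (0≤p+q 0≤z′ (0≤ι A)) 0≤1
    w+1≤y : w + 1ℚ ≤ y
    w+1≤y = begin
      w + 1ℚ                                  ≡⟨ solve 2 (λ z A → z :+ con 1ℚ :+ A :+ con 1ℚ :+ con 1ℚ
                                                   := z :+ (con 1ℚ :+ (con 1ℚ :+ (con 1ℚ :+ A)))) refl z₀ (ι A) ⟩
      z₀ + (1ℚ + (1ℚ + (1ℚ + ι A)))           ≡⟨ cong (λ q → z₀ + q) (trans (ι-suc (2 ℕ.+ A)) (cong (λ q → 1ℚ + q)
                                                   (trans (ι-suc (1 ℕ.+ A)) (cong (λ q → 1ℚ + q) (ι-suc A))))) ⟨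
      z₀ + ι (3 ℕ.+ A)                        ≤⟨ gap ⟩
      y                                       ∎
    b≤euler : ι b ≤ euler m w
    b≤euler = begin
      ι b                              ≤⟨ b≤ ⟩
      ι A * euler m zₘ                 ≤⟨ *-mono (≤-trans 0≤1 (1≤euler m (0≤ι A))) (≤-trans 0≤1 (1≤euler m 0≤zₘ))
                                            (≤-trans (+⇒≤ {ι A} 1ℚ 0≤1 (+-comm 1ℚ (ι A))) (1+ι≤euler A m))
                                            (euler-mono m 0≤zₘ zₘ≤z) ⟩
      euler m (ι A) * euler m z′       ≡⟨ *-comm (euler m (ι A)) (euler m z′) ⟩
      euler m z′ * euler m (ι A)       ≤⟨ euler-* {z′} {ι A} {Z} {A} m 0≤z′ (0≤ι A) z≤Z ≤-refl ZA≤m ⟩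
      euler m w                        ∎

  -- Comparison of (log n)^c with n and with the cost

  module _ (c ε : ℝ) (0<c : 0ℝ <ℝ c) (0<ε : 0ℝ <ℝ ε) (A : ℕ) (n : ℕ) (16≤n : 16 ℕ.≤ n) where

    private
      a = c +ℝ ε
      l = lnln n 16≤n
      z = c *ℝ l
      y = a *ℝ l
      0<a = 0<x+y {c} {ε} 0<c 0<ε
      0<z = 0<x*y {c} {l} 0<c (0<lnln n 16≤n)
      0<y = 0<x*y {a} {l} 0<a (0<lnln n 16≤n)

      y≡ : ∀ k → seq y k ≡ seq z k + seq ε k * seq l k
      y≡ k = *-distribʳ-+ (seq l k) (seq c k) (seq ε k)

    -- Heuristically b^s ≤ exp (s (c log log n + log A)) ≤ exp (s (c + ε) log log n) ≤ n. Two
    -- indices are needed: `k` fixes rational exponents, and `m`, chosen after `k`, is a precision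
    -- of exp at which (1 + L/m)^m ≤ n holds for the exponent L fixed by `k`.
    power-≤ : Tail (λ k → ι (3 ℕ.+ A) ≤ seq ε k * seq l k) → ∀ b s →
      Tail (λ k → ι b ≤ ι A * seq (ln^ n 16≤n c) k) →
      fromℕ s ≤ℝ ln/lnln n 16≤n a 0<a → b ℕ.^ s ℕ.≤ n
    power-≤ gap b zero    b≤ s≤ = ℕ.≤-trans (ℕ.s≤s ℕ.z≤n) 16≤n
    power-≤ gap b (suc s) b≤ s≤ =
      let (0<z′ , 0<y′ , y≤Y , gap-k , s≤L/y , M≤k) = holds at-k k ℕ.≤-refl
          (0<z″ , M≤m , b≤′ , below≤m , ZA≤m)        = holds at-m m ℕ.≤-refl
      in power-bound {seq z k} {seq z m} {seq y k} {seq (ln n 16≤n) k} A Y Z n b s m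
           (<⇒≤ 0<z′) 0<y′ y≤Y (subst (seq z k + ι (3 ℕ.+ A) ≤_) (sym (y≡ k)) (+-monoʳ-≤ (seq z k) gap-k)) s≤L/y
           (λ m′ m≤m′ → proj₂ below m′ (ℕ.≤-trans below≤m m≤m′))
           (<⇒≤ 0<z″) (proj₂ z-cauchy m k M≤m M≤k) b≤′ (proj₂ (archimedean (seq z k + 1ℚ))) ZA≤m
      where
      Y = proj₁ (bounded-tail y)
      z-cauchy = cauchy-tail z
      at-k = positive-tail z 0<z ⊗ positive-tail y 0<y ⊗ proj₂ (bounded-tail y) ⊗ gap ⊗
        ≤-tail (fromℕ (suc s)) (ln/lnln n 16≤n a 0<a) (0<r Y) s≤ ⊗ beyond (proj₁ z-cauchy)
      k = start at-k
      Z = proj₁ (archimedean (seq z k + 1ℚ))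
      below = ln-below n 16≤n k
      at-m = positive-tail z 0<z ⊗ beyond (proj₁ z-cauchy) ⊗ b≤ ⊗ beyond (proj₁ below) ⊗ beyond (Z ℕ.* A)
      m = start at-m

  lnln-unbounded : ∀ ε → 0ℝ <ℝ ε → ∀ A → Σ[ N ∈ ℕ ] (∀ n (16≤n : 16 ℕ.≤ n) → N ℕ.≤ n →
    Tail (λ k → ι A ≤ seq ε k * seq (lnln n 16≤n) k))
  lnln-unbounded ε (δ , 0<δ , M , f) A = N , λ n 16≤n N≤n → tail M λ k M≤k →
    bound (seq ε k) (seq (lnln n 16≤n) k) (≤-trans (proj₂ (r-small 0<δ)) (subst (_≤ seq ε k) (+-identityˡ δ) (f k M≤k)))
      (≤-trans (lnln-large n 16≤n {Λ} {Λ′} (proj₂ (archimedean (1ℚ + euler⁺ Λ)))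
          (≤-trans (proj₂ (archimedean (euler⁺ Λ′))) (ι-mono N≤n)) k)
        (+-monoʳ-≤ (seq (lnln n 16≤n) k) (r-antimono {0} {k} ℕ.z≤n)))
    where
    E = proj₁ (r-small 0<δ)
    -- The outer `suc` pays for the approximation error of log log n, the factor `suc E` for ε ≥
    -- 1/(E + 1).
    Λ = suc (suc E ℕ.* A)
    Λ′ = proj₁ (archimedean (1ℚ + euler⁺ Λ))
    N = proj₁ (archimedean (euler⁺ Λ′))
    bound : ∀ e l → r E ≤ e → ι Λ ≤ l + 1ℚ → ι A ≤ e * l
    bound e l E≤e Λ≤l = begin
      ι A                              ≡⟨ *-identityˡ (ι A) ⟨
      1ℚ * ι A                         ≡⟨ cong (_* ι A) (ι*r E) ⟨
      ι (suc E) * r E * ι A            ≡⟨ solve 3 (λ i r a → i :* r :* a := r :* (i :* a)) refl (ι (suc E)) (r E) (ι A) ⟩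
      r E * (ι (suc E) * ι A)          ≡⟨ cong (r E *_) (ι-* (suc E) A) ⟨
      r E * ι (suc E ℕ.* A)            ≤⟨ *-mono (≤-trans (0≤r E) E≤e) (0≤ι (suc E ℕ.* A)) E≤e EA≤l ⟩
      e * l                            ∎
      where
      open ≤-Reasoning
      EA≤l : ι (suc E ℕ.* A) ≤ l
      EA≤l = +⇒≤ (l + 1ℚ - (1ℚ + ι (suc E ℕ.* A))) (p≤q⇒0≤q-p (subst (_≤ l + 1ℚ) (ι-suc (suc E ℕ.* A)) Λ≤l))
        (solve 2 (λ l x → l := x :+ (l :+ con 1ℚ :- (con 1ℚ :+ x))) refl l (ι (suc E ℕ.* A)))

  1≤ln^-tail : ∀ c → 0ℝ <ℝ c → ∀ n 16≤n → Tail (λ k → 1ℚ ≤ seq (ln^ n 16≤n c) k)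
  1≤ln^-tail c 0<c n 16≤n = tail (start 0<z) λ k h → 1≤euler k (<⇒≤ (holds 0<z k h))
    where
    0<z = positive-tail (c *ℝ lnln n 16≤n) (0<x*y {c} {lnln n 16≤n} 0<c (0<lnln n 16≤n))

  -- Here `w` stands for the cost, `e` for an approximant of (log n)^c, and `ℓ` is at most C w/n +
  -- 1. As e ≥ 1, the rounding of `ℓ` and the error 1 in the bound on `w` disappear into the
  -- constant.
  cost-factor : ∀ C K₀ n w ℓ {k e} → 1 ℕ.≤ n → 1ℚ ≤ e → k ≤ ι K₀ → ι w ≤ k * (ι n * e) + 1ℚ →
    ℓ ℕ.* n ℕ.≤ C ℕ.* w ℕ.+ n → ι ℓ ≤ ι (suc (C ℕ.* suc K₀)) * e
  cost-factor C K₀ n w ℓ {k} {e} 1≤n 1≤e k≤K₀ w≤ ℓn≤ = *-cancelʳ-≤-pos (ι n) {{positive 0<n}} (begin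
    ι ℓ * ι n                                    ≡⟨ ι-* ℓ n ⟨
    ι (ℓ ℕ.* n)                                  ≤⟨ ι-mono ℓn≤ ⟩
    ι (C ℕ.* w ℕ.+ n)                            ≡⟨ trans (ι-+ (C ℕ.* w) n) (cong (_+ ι n) (ι-* C w)) ⟩
    ι C * ι w + ι n                              ≤⟨ +-mono-≤ (*-monoˡ (ι C) (0≤ι C) w≤′) (p≤p*q (0≤ι n) 1≤e) ⟩
    ι C * ((1ℚ + ι K₀) * (ι n * e)) + ι n * e    ≡⟨ solve 4 (λ C K n e → C :* ((con 1ℚ :+ K) :* (n :* e)) :+ n :* e
                                                      := (con 1ℚ :+ C :* (con 1ℚ :+ K)) :* e :* n) refl (ι C) (ι K₀) (ι n) e ⟩
    (1ℚ + ι C * (1ℚ + ι K₀)) * e * ι n           ≡⟨ cong (λ q → q * e * ι n) (trans (ι-suc (C ℕ.* suc K₀))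
                                                      (cong (λ q → 1ℚ + q) (trans (ι-* C (suc K₀)) (cong (ι C *_) (ι-suc K₀))))) ⟨
    ι (suc (C ℕ.* suc K₀)) * e * ι n             ∎)
    where
    open ≤-Reasoning
    0<n : 0ℚ < ι n
    0<n = <-≤-trans (0<r 0) (ι-mono {1} {n} 1≤n)
    1≤ne : 1ℚ ≤ ι n * e
    1≤ne = ≤-trans (ι-mono {1} {n} 1≤n) (p≤p*q (0≤ι n) 1≤e)
    w≤′ : ι w ≤ (1ℚ + ι K₀) * (ι n * e)
    w≤′ = begin
      ι w                                 ≤⟨ w≤ ⟩
      k * (ι n * e) + 1ℚ                  ≤⟨ +-mono-≤ (*-monoʳ (ι n * e) (≤-trans 0≤1 1≤ne) k≤K₀) 1≤ne ⟩
      ι K₀ * (ι n * e) + ι n * e          ≡⟨ solve 2 (λ K x → K :* x :+ x := (con 1ℚ :+ K) :* x) refl (ι K₀) (ι n * e) ⟩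
      (1ℚ + ι K₀) * (ι n * e)             ∎

  cost-factor-tail : ∀ c → 0ℝ <ℝ c → ∀ K C n 16≤n w ℓ → fromℕ w ≤ℝ K *ℝ (fromℕ n *ℝ ln^ n 16≤n c) →
    ℓ ℕ.* n ℕ.≤ C ℕ.* w ℕ.+ n →
    Tail (λ k → ι ℓ ≤ ι (suc (C ℕ.* suc (proj₁ (bounded-tail K)))) * seq (ln^ n 16≤n c) k)
  cost-factor-tail c 0<c K C n 16≤n w ℓ w≤ ℓn≤ = tail (start all) λ k h →
    cost-factor C (proj₁ (bounded-tail K)) n w ℓ (ℕ.≤-trans (ℕ.s≤s ℕ.z≤n) 16≤n)
      (proj₁ (holds all k h)) (proj₁ (proj₂ (holds all k h))) (proj₂ (proj₂ (holds all k h))) ℓn≤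
    where
    all = 1≤ln^-tail c 0<c n 16≤n ⊗ proj₂ (bounded-tail K) ⊗
      ≤-tail (fromℕ w) (K *ℝ (fromℕ n *ℝ ln^ n 16≤n c)) (0<r 0) w≤

  gap-Ω : ∀ c n 16≤n A ℓ g → n ℕ.≤ ℓ ℕ.* g → Tail (λ k → ι ℓ ≤ ι A * seq (ln^ n 16≤n c) k) →
    fromℚ (r A) *ℝ n/ln^ n 16≤n c ≤ℝ fromℕ g
  gap-Ω c n 16≤n A ℓ g n≤ℓg ℓ≤ {η} 0<η = start all , λ k h →
    ≤-trans (bound (seq (ln^ n 16≤n c) k) (proj₁ (holds all k h)) (proj₂ (holds all k h))) (+⇒≤ {ι g} η (<⇒≤ 0<η) refl)
    where
    all = positive-tail (ln^ n 16≤n c) (0<ln^ n 16≤n c) ⊗ ℓ≤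
    bound : ∀ e → 0ℚ < e → ι ℓ ≤ ι A * e → r A * (ι n * inv e) ≤ ι g
    bound e 0<e ℓ≤Ae = begin
      r A * (ι n * inv e)                        ≤⟨ *-monoˡ (r A) (0≤r A) (*-monoʳ (inv e) (inv-nonNeg 0<e)
                                                      (subst (ι n ≤_) (ι-* ℓ g) (ι-mono n≤ℓg))) ⟩
      r A * (ι ℓ * ι g * inv e)                  ≤⟨ *-monoˡ (r A) (0≤r A) (*-monoʳ (inv e) (inv-nonNeg 0<e)
                                                      (*-monoʳ (ι g) (0≤ι g) (≤-trans ℓ≤Ae (*-monoʳ e (<⇒≤ 0<e) (ι-mono (ℕ.n≤1+n A)))))) ⟩
      r A * (ι (suc A) * e * ι g * inv e)        ≡⟨ solve 5 (λ r i e g v → r :* (i :* e :* g :* v) := (i :* r) :* (v :* e) :* g)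
                                                      refl (r A) (ι (suc A)) e (ι g) (inv e) ⟩
      ι (suc A) * r A * (inv e * e) * ι g        ≡⟨ cong₂ (λ p q → p * q * ι g) (ι*r A) (inv-* 0<e) ⟩
      1ℚ * 1ℚ * ι g                              ≡⟨ *-identityˡ (ι g) ⟩
      ι g                                        ∎
      where open ≤-Reasoning

  -- Cotransitivity gives q < x or x < q + η for each η > 0, and the hypothesis excludes the first
  -- alternative.
  ≰⇒≥ℝ : ∀ q x → ¬ fromℚ q ≤ℝ x → x ≤ℝ fromℚ q
  ≰⇒≥ℝ q x q≰x {η} 0<η = [ (λ (δ , 0<δ , N , f) → contradiction (λ {ε} 0<ε → N , λ n h → below {seq x n} {δ} {ε} 0<δ 0<ε (f n h)) q≰x)
                          , (λ (δ , 0<δ , N , f) → N , λ n h → ≤-trans (+⇒≤ {seq x n} δ (<⇒≤ 0<δ) refl) (f n h)) ]′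
    (<ℝ-cotrans {fromℚ q} {fromℚ (q + η)} (fromℚ-mono-< (+⇒< {q} η 0<η refl)) x)
    where
    below : ∀ {x δ ε} → 0ℚ < δ → 0ℚ < ε → q + δ ≤ x → q ≤ x + ε
    below {x} {δ} {ε} 0<δ 0<ε h = ≤-trans (≤-trans (+⇒≤ {q} δ (<⇒≤ 0<δ) refl) h) (+⇒≤ {x} ε (<⇒≤ 0<ε) refl)

  quotient-Ω : ∀ a 0<a n 16≤n t → ¬ fromℕ t ≤ℝ ln/lnln n 16≤n a 0<a →
    fromℚ (r (proj₁ (bounded-tail a))) *ℝ (ln n 16≤n /ℝ lnln n 16≤n [ 0<lnln n 16≤n ]) ≤ℝ fromℕ t
  quotient-Ω a 0<a n 16≤n t t≰ {η} 0<η = start all , λ k h →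
    ≤-trans (bound (seq a k) (seq (lnln n 16≤n) k) (seq (ln n 16≤n) k) (proj₁ (holds all k h))
        (proj₁ (proj₂ (holds all k h))) (proj₁ (proj₂ (proj₂ (holds all k h)))) (<⇒≤ (proj₁ (proj₂ (proj₂ (proj₂ (holds all k h)))))))
      (proj₂ (proj₂ (proj₂ (proj₂ (holds all k h)))))
    where
    B = proj₁ (bounded-tail a)
    all = proj₂ (bounded-tail a) ⊗ positive-tail a 0<a ⊗ positive-tail (lnln n 16≤n) (0<lnln n 16≤n) ⊗
      positive-tail (ln n 16≤n) (0<ln n 16≤n) ⊗
      ≤-tail (ln/lnln n 16≤n a 0<a) (fromℕ t) 0<η (≰⇒≥ℝ (ι t) (ln/lnln n 16≤n a 0<a) t≰)
    bound : ∀ a l L → a ≤ ι B → 0ℚ < a → 0ℚ < l → 0ℚ ≤ L → r B * (L * inv l) ≤ L * inv (a * l)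
    bound a l L a≤B 0<a 0<l 0≤L = begin
      r B * (L * inv l)                              ≡⟨ *-identityʳ _ ⟨
      r B * (L * inv l) * 1ℚ                         ≡⟨ cong (r B * (L * inv l) *_) (inv-* 0<al) ⟨
      r B * (L * inv l) * (inv (a * l) * (a * l))    ≡⟨ solve 6 (λ b L i v a l → b :* (L :* i) :* (v :* (a :* l)) := (a :* b) :* (i :* l) :* (L :* v))
                                                          refl (r B) L (inv l) (inv (a * l)) a l ⟩
      a * r B * (inv l * l) * (L * inv (a * l))      ≡⟨ cong (λ q → a * r B * q * (L * inv (a * l))) (inv-* 0<l) ⟩
      a * r B * 1ℚ * (L * inv (a * l))               ≤⟨ *-monoʳ (L * inv (a * l)) (0≤p*q 0≤L (inv-nonNeg 0<al)) aB≤1 ⟩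
      1ℚ * (L * inv (a * l))                         ≡⟨ *-identityˡ _ ⟩
      L * inv (a * l)                                ∎
      where
      open ≤-Reasoning
      0<al : 0ℚ < a * l
      0<al = 0<p*q 0<a 0<l
      aB≤1 : a * r B * 1ℚ ≤ 1ℚ
      aB≤1 = ≤-trans (≤-reflexive (*-identityʳ (a * r B))) (≤-trans (*-monoʳ (r B) (0≤r B) a≤B) (ι*r≤1 (ℕ.n≤1+n B)))

  scale-tail : ∀ D {ℓ A} x → Tail (λ k → ι ℓ ≤ ι A * seq x k) → Tail (λ k → ι (D ℕ.* ℓ) ≤ ι (D ℕ.* A) * seq x k)
  scale-tail D {ℓ} {A} x (tail M h) = tail M λ k M≤k → subst₂ _≤_ (sym (ι-* D ℓ))
    (trans (sym (*-assoc (ι D) (ι A) (seq x k))) (cong (_* seq x k) (sym (ι-* D A))))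
    (*-monoˡ (ι D) (0≤ι D) (h k M≤k))

open import Data.Bool.Base using (Bool; true; false; if_then_else_)
open import Data.Fin.Base as Fin using (Fin; fromℕ<; toℕ)
open import Data.Fin.Permutation.Components using (transpose; transpose-inverse)
import Data.Fin.Properties as Fin
open import Data.Fin.Subset using (Subset; inside; outside; ∣_∣; _∈_)
open import Data.List.Base as List using (List; []; _∷_; foldl; upTo)
open import Data.List.Extrema.Nat using (xs≤max)
open import Data.List.Membership.Propositional using () renaming (_∈_ to _∈ˡ_)
open import Data.List.Membership.Propositional.Properties
  using (∈-allFin; ∈-filter⁺; ∈-cartesianProductWith⁺; ∈-map⁺)
import Data.List.Relation.Unary.All as All
open import Data.List.Relation.Unary.Any using (here)
open import Data.Nat.Base
  using (_+_; _*_; _∸_; _^_; _≤_; _<_; z≤n; s≤s; NonZero; >-nonZero; _/_; _%_)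
open import Data.Nat.DivMod
open import Data.Nat.Properties
open import Data.Nat.Tactic.RingSolver using (solve-∀)
open import Data.Vec.Base as Vec using (Vec; []; _∷_; here; there; lookup; _[_]≔_)
import Data.Vec.Properties as Vec
open import Data.Vec.Relation.Unary.AllPairs using (allPairs?)
import Data.Vec.Relation.Unary.AllPairs.Properties as AllPairs
open import Function.Base using (_∘_; id)
open import Relation.Binary.Definitions using (tri<; tri≈; tri>)
open import Relation.Nullary using (Dec; yes; no; does)
open import Relation.Nullary.Decidable using (¬?; _×-dec_; dec-true; dec-false)
open GapSequence using (p; gap)

-- Linear arithmetic: a ≤ b follows from a sum u ≤ v of known inequalities and
-- an identity, free of subtraction, that exhibits the slack e.
lin-≤ : ∀ {u v} a b e → u ≤ v → a + e + v ≡ b + u → a ≤ b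
lin-≤ {u} {v} a b e u≤v eq = +-cancelʳ-≤ u a b (≤-trans (+-mono-≤ (m≤m+n a e) u≤v) (≤-reflexive eq))

-- Sums over windows of natural numbers

∑ : ℕ → ℕ → (ℕ → ℕ) → ℕ
∑ b zero    f = 0
∑ b (suc k) f = f b + ∑ (suc b) k f

∑-mono : ∀ b k {f g : ℕ → ℕ} → (∀ x → b ≤ x → x < b + k → f x ≤ g x) → ∑ b k f ≤ ∑ b k g
∑-mono b zero    f≤g = z≤n
∑-mono b (suc k) f≤g = +-mono-≤ (f≤g b ≤-refl (m<m+n b (s≤s z≤n)))
  (∑-mono (suc b) k λ x b<x x< → f≤g x (<⇒≤ b<x) (subst (x <_) (sym (+-suc b k)) x<))

∑-+ : ∀ b k (f g : ℕ → ℕ) → ∑ b k (λ x → f x + g x) ≡ ∑ b k f + ∑ b k g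
∑-+ b zero    f g = refl
∑-+ b (suc k) f g = trans (cong (f b + g b +_) (∑-+ (suc b) k f g))
  (lemma (f b) (g b) (∑ (suc b) k f) (∑ (suc b) k g))
  where
  lemma : ∀ a b c d → a + b + (c + d) ≡ a + c + (b + d)
  lemma = solve-∀

∑-const : ∀ b k c → ∑ b k (λ _ → c) ≡ k * c
∑-const b zero    c = refl
∑-const b (suc k) c = cong (c +_) (∑-const (suc b) k c)

∑-shift : ∀ b k s (f : ℕ → ℕ) → ∑ b k (λ x → f (x + s)) ≡ ∑ (b + s) k f
∑-shift b zero    s f = refl
∑-shift b (suc k) s f = cong (f (b + s) +_) (∑-shift (suc b) k s f)

∑-split : ∀ b k l (f : ℕ → ℕ) → ∑ b (k + l) f ≡ ∑ b k f + ∑ (b + k) l f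
∑-split b zero    l f = cong (λ c → ∑ c l f) (sym (+-identityʳ b))
∑-split b (suc k) l f = trans (cong (f b +_) (trans (∑-split (suc b) k l f)
    (cong (λ c → ∑ (suc b) k f + ∑ c l f) (sym (+-suc b k)))))
  (sym (+-assoc (f b) _ _))

∑-window : ∀ b k c l (f : ℕ → ℕ) → c ≤ b → b + k ≤ c + l → ∑ b k f ≤ ∑ c l f
∑-window b k c l f c≤b b+k≤c+l with m≤n⇒∃[o]m+o≡n c≤b
... | d , refl with m≤n⇒∃[o]m+o≡n (+-cancelˡ-≤ c (d + k) l (subst (_≤ c + l) (+-assoc c d k) b+k≤c+l))
...   | e , refl = begin
  ∑ (c + d) k f                                        ≤⟨ m≤n+m _ (∑ c d f) ⟩
  ∑ c d f + ∑ (c + d) k f                              ≡⟨ ∑-split c d k f ⟨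
  ∑ c (d + k) f                                        ≤⟨ m≤m+n _ _ ⟩
  ∑ c (d + k) f + ∑ (c + (d + k)) e f                  ≡⟨ ∑-split c (d + k) e f ⟨
  ∑ c (d + k + e) f                                    ∎
  where open ≤-Reasoning

-- Each of the three sums of the shifted f is at most the sum over the enlarged
-- window.
density : ∀ (f : ℕ → ℕ) b k τ →
  (∀ x → b ≤ x → x < b + k → 1 ≤ f x + f (x + τ) + f (x + τ + τ)) →
  k ≤ 3 * ∑ b (k + (τ + τ)) f
density f b k τ hit = begin
  k                                                    ≡⟨ *-identityʳ k ⟨
  k * 1                                                ≡⟨ ∑-const b k 1 ⟨
  ∑ b k (λ _ → 1)                                      ≤⟨ ∑-mono b k hit ⟩
  ∑ b k (λ x → f x + f (x + τ) + f (x + τ + τ))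
    ≡⟨ ∑-+ b k (λ x → f x + f (x + τ)) (λ x → f (x + τ + τ)) ⟩
  ∑ b k (λ x → f x + f (x + τ)) + ∑ b k (λ x → f (x + τ + τ))
    ≡⟨ cong (_+ ∑ b k (λ x → f (x + τ + τ))) (∑-+ b k f (λ x → f (x + τ))) ⟩
  ∑ b k f + ∑ b k (λ x → f (x + τ)) + ∑ b k (λ x → f (x + τ + τ))
    ≡⟨ cong₂ (λ u v → ∑ b k f + u + v) (∑-shift b k τ f)
         (trans (∑-shift b k τ (λ x → f (x + τ))) (∑-shift (b + τ) k τ f)) ⟩
  ∑ b k f + ∑ (b + τ) k f + ∑ (b + τ + τ) k f
    ≤⟨ +-mono-≤ (+-mono-≤
         (∑-window b k b (k + (τ + τ)) f ≤-refl (+-monoʳ-≤ b (m≤m+n k (τ + τ))))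
         (∑-window (b + τ) k b (k + (τ + τ)) f (m≤m+n b τ) (≤-trans (m≤m+n (b + τ + k) τ) (≤-reflexive (e₁ b τ k)))))
         (∑-window (b + τ + τ) k b (k + (τ + τ)) f (≤-trans (m≤m+n b τ) (m≤m+n (b + τ) τ)) (≤-reflexive (e₂ b τ k))) ⟩
  w + w + w                                            ≡⟨ e₃ w ⟩
  3 * w                                                ∎
  where
  open ≤-Reasoning
  w = ∑ b (k + (τ + τ)) f
  e₁ : ∀ b τ k → b + τ + k + τ ≡ b + (k + (τ + τ))
  e₁ = solve-∀
  e₂ : ∀ b τ k → b + τ + τ + k ≡ b + (k + (τ + τ))
  e₂ = solve-∀
  e₃ : ∀ w → w + w + w ≡ 3 * w
  e₃ = solve-∀

-- The permutation listing first the members of d, then the non-members,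
-- both in increasing order

module Ranks (d : ℕ → Bool) where

  member nonmember : ℕ → ℕ
  member    x = if d x then 1 else 0
  nonmember x = if d x then 0 else 1

  rank⁺ rank⁻ : ℕ → ℕ
  rank⁺ x = ∑ 0 x member
  rank⁻ x = ∑ 0 x nonmember

  rank-sum : ∀ x → rank⁺ x + rank⁻ x ≡ x
  rank-sum x = trans (sym (∑-+ 0 x member nonmember)) (trans (go 0 x) (*-identityʳ x))
    where
    one : ∀ x → member x + nonmember x ≡ 1
    one x with d x
    ... | true  = refl
    ... | false = refl
    go : ∀ b k → ∑ b k (λ x → member x + nonmember x) ≡ k * 1
    go b zero    = refl
    go b (suc k) = cong₂ _+_ (one b) (go (suc b) k)

  ∑-< : ∀ (f : ℕ → ℕ) {x y} → x < y → f x ≡ 1 → ∑ 0 x f < ∑ 0 y f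
  ∑-< f {x} {y} x<y fx≡1 = begin-strict
    ∑ 0 x f                  <⟨ n<1+n _ ⟩
    1 + ∑ 0 x f              ≡⟨ +-comm 1 (∑ 0 x f) ⟩
    ∑ 0 x f + 1              ≡⟨ cong (∑ 0 x f +_) (trans (sym fx≡1) (sym (+-identityʳ (f x)))) ⟩
    ∑ 0 x f + ∑ x 1 f        ≡⟨ ∑-split 0 x 1 f ⟨
    ∑ 0 (x + 1) f            ≤⟨ ∑-window 0 (x + 1) 0 y f z≤n (≤-trans (≤-reflexive (+-comm x 1)) x<y) ⟩
    ∑ 0 y f                  ∎
    where open ≤-Reasoning

  module _ (n : ℕ) where

    size : ℕ
    size = rank⁺ n

    key : ℕ → ℕ
    key x = if d x then rank⁺ x else size + rank⁻ x

    key-member : ∀ {x} → d x ≡ true → x < n → key x < size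
    key-member dx x<n rewrite dx = ∑-< member x<n (cong (if_then 1 else 0) dx)

    key< : ∀ {x} → x < n → key x < n
    key< {x} x<n with d x in eq
    ... | true  = <-≤-trans (∑-< member x<n (cong (if_then 1 else 0) eq))
                    (≤-trans (m≤m+n size (rank⁻ n)) (≤-reflexive (rank-sum n)))
    ... | false = <-≤-trans (+-monoʳ-< size (∑-< nonmember x<n (cong (if_then 0 else 1) eq)))
                    (≤-reflexive (rank-sum n))

    -- Keys at x < y are out of order only if y is a member and x is not, which `down` forbids.
    key-mono : ∀ {x y} → x < y → y < n → (d y ≡ true → d x ≡ true) → key x < key y
    key-mono {x} {y} x<y y<n down with d x in ex | d y in ey
    ... | true  | true  = ∑-< member x<y (cong (if_then 1 else 0) ex)
    ... | true  | false = <-≤-trans (∑-< member (<-trans x<y y<n) (cong (if_then 1 else 0) ex)) (m≤m+n size _)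
    ... | false | false = +-monoʳ-< size (∑-< nonmember x<y (cong (if_then 0 else 1) ex))
    ... | false | true  with () ← down refl

    key-≢ : ∀ {x y} → x < y → y < n → key x ≢ key y
    key-≢ {x} {y} x<y y<n eq with d x in ex | d y in ey
    ... | true  | _     = contradiction kx≡ky (<⇒≢ (key-mono x<y y<n λ _ → ex))
      where
      kx≡ky : key x ≡ key y
      kx≡ky rewrite ex | ey = eq
    ... | false | false = contradiction kx≡ky (<⇒≢ (key-mono x<y y<n λ t → contradiction (trans (sym ey) t) λ ()))
      where
      kx≡ky : key x ≡ key y
      kx≡ky rewrite ex | ey = eq
    ... | false | true  = contradiction (sym eq)
      (<⇒≢ (<-≤-trans (∑-< member y<n (cong (if_then 1 else 0) ey)) (m≤m+n size _)))

    entry : Fin n → Fin n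
    entry i = fromℕ< (key< (Fin.toℕ<n i))

    permutation : Vec (Fin n) n
    permutation = Vec.tabulate entry

    toℕ-permutation : ∀ i → toℕ (lookup permutation i) ≡ key (toℕ i)
    toℕ-permutation i = trans (cong toℕ (Vec.lookup∘tabulate entry i)) (Fin.toℕ-fromℕ< _)

    permutation-injective : ∀ {i j} → lookup permutation i ≡ lookup permutation j → i ≡ j
    permutation-injective {i} {j} eq with <-cmp (toℕ i) (toℕ j)
    ... | tri< i<j _ _ = contradiction (trans (sym (toℕ-permutation i)) (trans (cong toℕ eq) (toℕ-permutation j)))
                           (key-≢ i<j (Fin.toℕ<n j))
    ... | tri≈ _ i≡j _ = Fin.toℕ-injective i≡j
    ... | tri> _ _ j<i = contradiction (trans (sym (toℕ-permutation j)) (trans (cong toℕ (sym eq)) (toℕ-permutation i)))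
                           (key-≢ j<i (Fin.toℕ<n i))

-- Invariants of Shellsort

foldl-invariant : ∀ {A S : Set} (P : S → Set) {f : S → A → S} →
  (∀ st x → P st → P (f st x)) → ∀ xs {st} → P st → P (foldl f st xs)
foldl-invariant P step []       Pst = Pst
foldl-invariant P step (x ∷ xs) Pst = foldl-invariant P step xs (step _ x Pst)

foldl-tabulate : ∀ {A S : Set} n (P : ℕ → S → Set) {f : S → A → S} (g : Fin n → A) →
  (∀ i st → P (toℕ i) st → P (suc (toℕ i)) (f st (g i))) →
  ∀ {st} → P 0 st → P n (foldl f st (List.tabulate g))
foldl-tabulate zero    P g step P₀ = P₀
foldl-tabulate (suc n) P g step P₀ =
  foldl-tabulate n (P ∘ suc) (g ∘ Fin.suc) (λ i → step (Fin.suc i)) (step Fin.zero _ P₀)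

foldl-applyUpTo : ∀ {A S : Set} n (P : ℕ → S → Set) {f : S → A → S} (g : ℕ → A) →
  (∀ i st → P i st → P (suc i) (f st (g i))) →
  ∀ {st} → P 0 st → P n (foldl f st (List.applyUpTo g n))
foldl-applyUpTo zero    P g step P₀ = P₀
foldl-applyUpTo (suc n) P g step P₀ =
  foldl-applyUpTo n (P ∘ suc) (g ∘ suc) (λ i → step (suc i)) (step 0 _ P₀)

private
  chain-step : ∀ b h k → b + (h + k * h) ≡ b + k * h + h
  chain-step = solve-∀

module _ {n : ℕ} where

  module _ (P : State n → Set) (h : ℕ)
    (step : ∀ a e i j → toℕ i ≡ toℕ j + h → P (a , e) → P (exchange i j a , suc e)) where

    sift-invariant : ∀ b k pos<n st → P st → P (sift h b k pos<n st)
    sift-invariant b zero    pos<n st      Pst = Pst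
    sift-invariant b (suc k) pos<n (a , e) Pst
      with does (lookup a (fromℕ< pos<n) Fin.<? lookup a (fromℕ< (≤-<-trans (+-monoʳ-≤ b (m≤n+m (k * h) h)) pos<n)))
    ... | true  = sift-invariant b k _ _ (step a e _ _
          (trans (Fin.toℕ-fromℕ< pos<n) (trans (chain-step b h k) (cong (_+ h) (sym (Fin.toℕ-fromℕ< _))))) Pst)
    ... | false = Pst

    pass-invariant : ∀ st → P st → P (pass h st)
    pass-invariant st = foldl-invariant P
      (λ _ b → foldl-invariant P (λ st k → inRange b st k) (upTo n)) (upTo h)
      where
      inRange : ∀ b st k → P st → P (siftIfInside h b st k)
      inRange b st k Pst with b + k * h <? n
      ... | yes pos<n = sift-invariant b k pos<n st Pst
      ... | no  _     = Pst

  Ordered : ℕ → Vec (Fin n) n → Set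
  Ordered h a = ∀ i j → toℕ i ≡ toℕ j + h → lookup a j Fin.≤ lookup a i

  pass-ordered : ∀ {h} st → Ordered h (proj₁ st) → pass h st ≡ st
  pass-ordered {h} st@(a , e) ord = foldl-invariant (_≡ st)
    (λ { _ b refl → foldl-invariant (_≡ st) (λ { _ k refl → inRange b k }) (upTo n) refl }) (upTo h) refl
    where
    sift-ordered : ∀ b k pos<n → sift h b k pos<n st ≡ st
    sift-ordered b zero    pos<n = refl
    sift-ordered b (suc k) pos<n
      with lookup a (fromℕ< pos<n) Fin.<? lookup a (fromℕ< (≤-<-trans (+-monoʳ-≤ b (m≤n+m (k * h) h)) pos<n))
    ... | yes lt = contradiction (ord _ _
          (trans (Fin.toℕ-fromℕ< pos<n) (trans (chain-step b h k) (cong (_+ h) (sym (Fin.toℕ-fromℕ< _))))))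
          (<⇒≱ lt)
    ... | no nlt rewrite dec-false (lookup a (fromℕ< pos<n) Fin.<? lookup a (fromℕ< (≤-<-trans (+-monoʳ-≤ b (m≤n+m (k * h) h)) pos<n))) nlt = refl
    inRange : ∀ b k → siftIfInside h b st k ≡ st
    inRange b k with b + k * h <? n
    ... | yes pos<n = sift-ordered b k pos<n
    ... | no  _     = refl

  transpose-left : (i j : Fin n) → transpose i j i ≡ j
  transpose-left i j rewrite dec-true (i Fin.≟ i) refl = refl

  transpose-right : (i j : Fin n) → i ≢ j → transpose i j j ≡ i
  transpose-right i j i≢j rewrite dec-false (j Fin.≟ i) (i≢j ∘ sym) | dec-true (j Fin.≟ j) refl = refl

  transpose-other : {i j x : Fin n} → x ≢ i → x ≢ j → transpose i j x ≡ x
  transpose-other {i} {j} {x} x≢i x≢j rewrite dec-false (x Fin.≟ i) x≢i | dec-false (x Fin.≟ j) x≢j = refl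

  lookup-exchange : ∀ i j (a : Vec (Fin n) n) x → lookup (exchange i j a) x ≡ lookup a (transpose i j x)
  lookup-exchange i j a x with x Fin.≟ i
  lookup-exchange i j a x | yes refl with x Fin.≟ j
  ... | yes refl = Vec.lookup∘update x (a [ x ]≔ lookup a x) (lookup a x)
  ... | no  x≢j  = trans (Vec.lookup∘update′ x≢j (a [ x ]≔ lookup a j) _) (Vec.lookup∘update x a _)
  lookup-exchange i j a x | no x≢i with x Fin.≟ j
  ... | yes refl = Vec.lookup∘update x (a [ i ]≔ lookup a x) _
  ... | no  x≢j  = trans (Vec.lookup∘update′ x≢j (a [ i ]≔ lookup a j) _) (Vec.lookup∘update′ x≢i a _)

  Injective : Vec (Fin n) n → Set
  Injective a = ∀ {x y} → lookup a x ≡ lookup a y → x ≡ y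

  exchange-injective : ∀ i j {a} → Injective a → Injective (exchange i j a)
  exchange-injective i j {a} inj {x} {y} eq = begin
    x                                  ≡⟨ transpose-inverse j i ⟨
    transpose j i (transpose i j x)    ≡⟨ cong (transpose j i) (inj
      (trans (sym (lookup-exchange i j a x)) (trans eq (lookup-exchange i j a y)))) ⟩
    transpose j i (transpose i j y)    ≡⟨ transpose-inverse j i ⟩
    y                                  ∎
    where open ≡-Reasoning

  -- The pass with gap 1 sorts

  Sorted : ℕ → Vec (Fin n) n → Set
  Sorted K a = ∀ x y → toℕ x < toℕ y → toℕ y < K → lookup a x Fin.≤ lookup a y

  -- The loop invariant of an insertion: the entry at `k` may still be too small for its
  -- predecessors, but is not too large for its successors.
  SortedExcept : ℕ → ℕ → Vec (Fin n) n → Set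
  SortedExcept k K a = ∀ x y → toℕ x < toℕ y → toℕ y < K → toℕ y ≢ k → lookup a x Fin.≤ lookup a y

  exchange-sortedExcept : ∀ {k K a} i j → toℕ i ≡ suc k → toℕ j ≡ k → lookup a i Fin.< lookup a j → suc k < K →
    SortedExcept (suc k) K a → SortedExcept k K (exchange i j a)
  exchange-sortedExcept {k} {K} {a} i j i≡ j≡ ai<aj k< srt x y x<y y<K y≢k
    rewrite lookup-exchange i j a x | lookup-exchange i j a y = go (y Fin.≟ i) (x Fin.≟ i) (x Fin.≟ j)
    where
    ≢-left : ∀ {z} → toℕ z ≢ toℕ i → toℕ z ≢ suc k
    ≢-left z≢i eq = z≢i (trans eq (sym i≡))
    y≢j : y ≢ j
    y≢j refl = y≢k j≡
    j≢i : j ≢ i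
    j≢i refl = 1+n≢n (trans (sym i≡) j≡)
    go : Dec (y ≡ i) → Dec (x ≡ i) → Dec (x ≡ j) →
         lookup a (transpose i j x) Fin.≤ lookup a (transpose i j y)
    go (yes refl) (yes refl) _ = contradiction x<y (<-irrefl refl)
    go (yes refl) (no _) (yes refl)
      rewrite transpose-left y x | transpose-right y x (j≢i ∘ sym) = <⇒≤ ai<aj
    go (yes refl) (no x≢i) (no x≢j)
      rewrite transpose-left y j | transpose-other {y} {j} x≢i x≢j =
      srt x j (≤∧≢⇒< (≤-trans (≤-pred (subst (toℕ x <_) i≡ x<y)) (≤-reflexive (sym j≡))) (x≢j ∘ Fin.toℕ-injective))
        (<-trans (≤-reflexive (cong suc j≡)) k<) (λ eq → 1+n≢n (trans (sym eq) j≡))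
    go (no y≢i) (yes refl) _
      rewrite transpose-left x j | transpose-other {x} {j} y≢i y≢j =
      srt j y (<-trans (≤-reflexive (trans (cong suc j≡) (sym i≡))) x<y) y<K (≢-left (y≢i ∘ Fin.toℕ-injective))
    go (no y≢i) (no _) (yes refl)
      rewrite transpose-right i x (j≢i ∘ sym) | transpose-other {i} {x} y≢i y≢j =
      srt i y (≤∧≢⇒< (≤-trans (≤-reflexive (trans i≡ (cong suc (sym j≡)))) x<y) (y≢i ∘ sym ∘ Fin.toℕ-injective))
        y<K (≢-left (y≢i ∘ Fin.toℕ-injective))
    go (no y≢i) (no x≢i) (no x≢j)
      rewrite transpose-other {i} {j} x≢i x≢j | transpose-other {i} {j} y≢i y≢j =
      srt x y x<y y<K (≢-left (y≢i ∘ Fin.toℕ-injective))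

  -- An insertion ends at position 0, which has no predecessors, or at a predecessor that is not
  -- larger. In the latter case transitivity through that predecessor covers all earlier entries, so
  -- the exception vanishes.
  sift-sorts : ∀ {K} k pos<n st → k < K → SortedExcept k K (proj₁ st) → Sorted K (proj₁ (sift 1 0 k pos<n st))
  sift-sorts zero    pos<n st      k<K srt x y x<y y<K = srt x y x<y y<K λ y≡0 → n≮0 (subst (toℕ x <_) y≡0 x<y)
  sift-sorts {K} (suc k) pos<n (a , e) k<K srt
    with lookup a (fromℕ< pos<n) Fin.<? lookup a (fromℕ< (≤-<-trans (+-monoʳ-≤ 0 (m≤n+m (k * 1) 1)) pos<n))
  ... | yes lt rewrite dec-true (lookup a (fromℕ< pos<n) Fin.<? lookup a (fromℕ< (≤-<-trans (+-monoʳ-≤ 0 (m≤n+m (k * 1) 1)) pos<n))) lt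
    = sift-sorts k _ _ (<-trans (n<1+n k) k<K) (exchange-sortedExcept {a = a} _ _
        (trans (Fin.toℕ-fromℕ< pos<n) (cong suc (*-identityʳ k))) (trans (Fin.toℕ-fromℕ< _) (*-identityʳ k)) lt k<K srt)
  ... | no  nlt rewrite dec-false (lookup a (fromℕ< pos<n) Fin.<? lookup a (fromℕ< (≤-<-trans (+-monoʳ-≤ 0 (m≤n+m (k * 1) 1)) pos<n))) nlt
    = sorted
    where
    i = fromℕ< pos<n
    j = fromℕ< (≤-<-trans (+-monoʳ-≤ 0 (m≤n+m (k * 1) 1)) pos<n)
    i≡ : toℕ i ≡ suc k
    i≡ = trans (Fin.toℕ-fromℕ< pos<n) (cong suc (*-identityʳ k))
    j≡ : toℕ j ≡ k
    j≡ = trans (Fin.toℕ-fromℕ< _) (*-identityʳ k)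
    sorted : Sorted K a
    sorted x y x<y y<K with toℕ y ≟ suc k | x Fin.≟ j
    ... | no y≢   | _        = srt x y x<y y<K y≢
    ... | yes y≡  | yes refl = subst (λ z → lookup a x Fin.≤ lookup a z) (Fin.toℕ-injective (trans i≡ (sym y≡))) (≮⇒≥ nlt)
    ... | yes y≡  | no x≢j   = ≤-trans
          (srt x j (≤∧≢⇒< (≤-trans (≤-pred (subst (toℕ x <_) y≡ x<y)) (≤-reflexive (sym j≡))) (x≢j ∘ Fin.toℕ-injective))
            (<-trans (≤-reflexive (cong suc j≡)) k<K) (λ eq → 1+n≢n (trans (sym eq) j≡)))
          (subst (λ z → lookup a j Fin.≤ lookup a z) (Fin.toℕ-injective (trans i≡ (sym y≡))) (≮⇒≥ nlt))

  pass-1-sorts : ∀ st → Sorted n (proj₁ (pass 1 st))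
  pass-1-sorts st = foldl-applyUpTo n (λ K st → Sorted K (proj₁ st)) id inRange λ _ _ _ ()
    where
    inRange : ∀ k st → Sorted k (proj₁ st) → Sorted (suc k) (proj₁ (siftIfInside 1 0 st k))
    inRange k st srt with k * 1 <? n
    ... | yes k<n = sift-sorts k k<n st (n<1+n k) λ x y x<y y≤k y≢k → srt x y x<y (≤∧≢⇒< (≤-pred y≤k) y≢k)
    ... | no  k≮n = λ x y x<y y≤k → srt x y x<y
          (<-≤-trans (Fin.toℕ<n y) (≤-trans (≮⇒≥ k≮n) (≤-reflexive (*-identityʳ k))))

  -- Injectivity makes the sorted vector strictly increasing. Hence keys below `m` end at positions
  -- below `m` ≤ `T`, where the excess is 0.
  sorted⇒≤lookup : ∀ {a} → Sorted n a → Injective a → ∀ x → toℕ x ≤ toℕ (lookup a x)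
  sorted⇒≤lookup {a} srt inj x = go (toℕ x) x refl
    where
    go : ∀ m x → toℕ x ≡ m → m ≤ toℕ (lookup a x)
    go zero    x eq = z≤n
    go (suc m) x eq = ≤-<-trans (go m y y≡)
      (≤∧≢⇒< (srt y x y<x (Fin.toℕ<n x)) λ e → <⇒≢ y<x (cong toℕ (inj (Fin.toℕ-injective e))))
      where
      m<n : m < n
      m<n = <-trans (≤-reflexive (sym eq)) (Fin.toℕ<n x)
      y = fromℕ< m<n
      y≡ : toℕ y ≡ m
      y≡ = Fin.toℕ-fromℕ< m<n
      y<x : toℕ y < toℕ x
      y<x = ≤-reflexive (trans (cong suc y≡) (sym eq))

-- The potential counts how far the keys below m lie beyond position T. An
-- exchange at distance h lowers it by at most h, and it vanishes at the end.

total : ∀ {A : Set} {k} → (ℕ → A → ℕ) → Vec A k → ℕ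
total t []       = 0
total t (v ∷ vs) = t 0 v + total (t ∘ suc) vs

total-update : ∀ {A : Set} {k} (t : ℕ → A → ℕ) (vs : Vec A k) i w →
  total t (vs [ i ]≔ w) + t (toℕ i) (lookup vs i) ≡ total t vs + t (toℕ i) w
total-update t (v ∷ vs) Fin.zero    w = lemma (t 0 w) (total (t ∘ suc) vs) (t 0 v)
  where
  lemma : ∀ a b c → a + b + c ≡ c + b + a
  lemma = solve-∀
total-update t (v ∷ vs) (Fin.suc i) w = trans (+-assoc (t 0 v) _ _)
  (trans (cong (t 0 v +_) (total-update (t ∘ suc) vs i w)) (sym (+-assoc (t 0 v) _ _)))

total-zero : ∀ {A : Set} {k} (t : ℕ → A → ℕ) (vs : Vec A k) → (∀ i → t (toℕ i) (lookup vs i) ≡ 0) → total t vs ≡ 0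
total-zero t []       z = refl
total-zero t (v ∷ vs) z = cong₂ _+_ (z Fin.zero) (total-zero (t ∘ suc) vs (z ∘ Fin.suc))

∑≤total : ∀ {A : Set} k (t : ℕ → A → ℕ) b (g : ℕ → ℕ) (f : Fin k → A) →
  (∀ i → g (b + toℕ i) ≤ t (toℕ i) (f i)) → ∑ b k g ≤ total t (Vec.tabulate f)
∑≤total zero    t b g f h = z≤n
∑≤total (suc k) t b g f h = +-mono-≤ (subst (λ c → g c ≤ t 0 (f Fin.zero)) (+-identityʳ b) (h Fin.zero))
  (∑≤total k (t ∘ suc) (suc b) g (f ∘ Fin.suc)
    λ i → subst (λ c → g c ≤ t (suc (toℕ i)) (f (Fin.suc i))) (+-suc b (toℕ i)) (h (Fin.suc i)))

module Potential {n : ℕ} (m T : ℕ) (m≤T : m ≤ T) where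

  excess : ℕ → Fin n → ℕ
  excess x v = if does (toℕ v <? m) then x ∸ T else 0

  excess-below : ∀ x v → toℕ v < m → excess x v ≡ x ∸ T
  excess-below x v v<m rewrite dec-true (toℕ v <? m) v<m = refl

  potential : Vec (Fin n) n → ℕ
  potential = total excess

  -- If only the key that moves down from x to y counts, its excess falls by at most the distance h,
  -- truncation at `T` included. In the other three cases the sum does not fall.
  exchange-excess : ∀ {h} x y u v → x ≡ y + h → excess x u + excess y v ≤ excess x v + excess y u + h
  exchange-excess {h} x y u v refl with does (toℕ u <? m) | does (toℕ v <? m)
  ... | true  | true  = m≤m+n _ h
  ... | false | false = z≤n
  ... | true  | false = ≤-trans (≤-reflexive (+-identityʳ _)) (m≤n+o⇒m∸n≤o (y + h) T lemma)
    where
    lemma : y + h ≤ T + (y ∸ T + h)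
    lemma = ≤-trans (+-monoˡ-≤ h (m≤n+m∸n y T)) (≤-reflexive (+-assoc T (y ∸ T) h))
  ... | false | true  = ≤-trans (∸-monoˡ-≤ T (m≤m+n y h)) (≤-trans (m≤m+n _ 0) (m≤m+n _ h))

  exchange-potential : ∀ {h} i j a → 1 ≤ h → toℕ i ≡ toℕ j + h →
    potential a ≤ potential (exchange i j a) + h
  exchange-potential {h} i j a 1≤h i≡j+h = +-cancelʳ-≤ (u + v) _ _ (begin
    potential a + (u + v)               ≤⟨ +-monoʳ-≤ (potential a) (exchange-excess (toℕ i) (toℕ j) (lookup a i) (lookup a j) i≡j+h) ⟩
    potential a + (u′ + v′ + h)         ≡⟨ e₁ (potential a) u′ v′ h ⟩
    (potential a + u′) + v′ + h         ≡⟨ cong (λ z → z + v′ + h) (total-update excess a i (lookup a j)) ⟨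
    (potential a₁ + u) + v′ + h         ≡⟨ e₂ (potential a₁) u v′ h ⟩
    (potential a₁ + v′) + u + h         ≡⟨ cong (λ z → z + u + h) (total-update excess a₁ j (lookup a i)) ⟨
    (potential a₂ + excess (toℕ j) (lookup a₁ j)) + u + h
      ≡⟨ cong (λ z → (potential a₂ + excess (toℕ j) z) + u + h) (Vec.lookup∘update′ j≢i a (lookup a j)) ⟩
    (potential a₂ + v) + u + h          ≡⟨ e₃ (potential a₂) u v h ⟩
    potential a₂ + h + (u + v)          ∎)
    where
    open ≤-Reasoning
    u = excess (toℕ i) (lookup a i)
    v = excess (toℕ j) (lookup a j)
    u′ = excess (toℕ i) (lookup a j)
    v′ = excess (toℕ j) (lookup a i)
    a₁ = a [ i ]≔ lookup a j
    a₂ = a₁ [ j ]≔ lookup a i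
    j≢i : j ≢ i
    j≢i refl = <⇒≢ (m<m+n (toℕ j) 1≤h) i≡j+h
    e₁ : ∀ a b c d → a + (b + c + d) ≡ a + b + c + d
    e₁ = solve-∀
    e₂ : ∀ a b c d → a + b + c + d ≡ a + c + b + d
    e₂ = solve-∀
    e₃ : ∀ a b c d → a + c + b + d ≡ a + d + (b + c)
    e₃ = solve-∀

  sorted-potential : ∀ {a} → Sorted n a → Injective a → potential a ≡ 0
  sorted-potential {a} srt inj = total-zero excess a zero-excess
    where
    zero-excess : ∀ i → excess (toℕ i) (lookup a i) ≡ 0
    zero-excess i with toℕ (lookup a i) <? m
    ... | yes ai<m rewrite dec-true (toℕ (lookup a i) <? m) ai<m = m≤n⇒m∸n≡0 (≤-trans (sorted⇒≤lookup {n} {a} srt inj i) (≤-trans (<⇒≤ ai<m) m≤T))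
    ... | no  ai≮m rewrite dec-false (toℕ (lookup a i) <? m) ai≮m = refl

  -- An exchange at distance h ≤ g takes at most h from the potential and adds g to the second
  -- summand, so the sum never decreases.
  pass-potential : ∀ F g h → 1 ≤ h → h ≤ g → ∀ st → F ≤ potential (proj₁ st) + proj₂ st * g →
    F ≤ potential (proj₁ (pass h st)) + proj₂ (pass h st) * g
  pass-potential F g h 1≤h h≤g = pass-invariant (λ st → F ≤ potential (proj₁ st) + proj₂ st * g) h
    λ a e i j i≡j+h F≤ → begin
      F                                             ≤⟨ F≤ ⟩
      potential a + e * g                           ≤⟨ +-monoˡ-≤ (e * g) (exchange-potential i j a 1≤h i≡j+h) ⟩
      potential (exchange i j a) + h + e * g        ≤⟨ +-monoˡ-≤ (e * g) (+-monoʳ-≤ _ h≤g) ⟩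
      potential (exchange i j a) + g + e * g        ≡⟨ +-assoc _ g (e * g) ⟩
      potential (exchange i j a) + suc e * g        ∎
    where open ≤-Reasoning

-- The cost of an input on which the first passes do nothing

exchanges≤W : ∀ {n} H (f : Fin n → Fin n) → (∀ {i j} → i ≢ j → f i ≢ f j) →
  exchanges H (Vec.tabulate f) ≤ W n H
exchanges≤W {n} H f inj = All.lookup (xs≤max 0 (List.map (exchanges H) (permutations n)))
  (∈-map⁺ (exchanges H) (∈-filter⁺ (allPairs? (λ x y → ¬? (x Fin.≟ y))) (∈-words (Vec.tabulate f)) (AllPairs.tabulate⁺ inj)))
  where
  ∈-words : ∀ {m} (v : Vec (Fin n) m) → v ∈ˡ words n m
  ∈-words []      = here refl
  ∈-words (x ∷ v) = ∈-cartesianProductWith⁺ _∷_ (∈-allFin x) (∈-words v)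

module _ (H : GapSequence) where
  open GapSequence H using (p-1; decreasing; last)

  gap-antitone : ∀ {i j} → toℕ i ≤ toℕ j → gap H j ≤ gap H i
  gap-antitone {i} {j} i≤j with toℕ i ≟ toℕ j
  ... | yes i≡j rewrite Fin.toℕ-injective i≡j = ≤-refl
  ... | no  i≢j = <⇒≤ (decreasing (≤∧≢⇒< i≤j i≢j))

  1≤gap : ∀ i → 1 ≤ gap H i
  1≤gap i = ≤-trans (≤-reflexive (sym last))
    (gap-antitone (≤-trans (≤-pred (Fin.toℕ<n i)) (≤-reflexive (sym (Fin.toℕ-fromℕ p-1)))))

  module _ {n : ℕ} (d : ℕ → Bool) (T : ℕ) (size≤T : Ranks.size d n ≤ T) (κ : Fin (p H))
    (down : ∀ i → i Fin.< κ → ∀ x → x + gap H i < n → d (x + gap H i) ≡ true → d x ≡ true) where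

    open Ranks d
    open Potential {n} (size n) T size≤T

    private
      a₀ = permutation n
      F = potential a₀
      g = gap H κ

      -- `i` passes have been made. Those before `κ` change nothing, so every actual exchange covers
      -- at most `g`. The last conjunct becomes effective with the final pass, whose gap is 1.
      Invariant : ℕ → State n → Set
      Invariant i st = (i ≤ toℕ κ → st ≡ (a₀ , 0)) × F ≤ potential (proj₁ st) + proj₂ st * g ×
        Injective (proj₁ st) × (i ≡ p H → Sorted n (proj₁ st))

      ordered : ∀ i → i Fin.< κ → Ordered (gap H i) a₀
      ordered i i<κ x y x≡y+h = <⇒≤ (subst₂ _<_ (sym (toℕ-permutation n y)) (sym (toℕ-permutation n x))
        (key-mono n y<x (Fin.toℕ<n x) λ dx → down i i<κ (toℕ y)
          (subst (_< n) x≡y+h (Fin.toℕ<n x)) (subst (λ z → d z ≡ true) x≡y+h dx)))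
        where
        y<x : toℕ y < toℕ x
        y<x = <-≤-trans (m<m+n (toℕ y) (1≤gap i)) (≤-reflexive (sym x≡y+h))

      last-sorts : ∀ i st → suc (toℕ i) ≡ p H → Sorted n (proj₁ (pass (gap H i) st))
      last-sorts i st eq = subst (λ h → Sorted n (proj₁ (pass h st))) (sym gap≡1) (pass-1-sorts st)
        where
        gap≡1 : gap H i ≡ 1
        gap≡1 = trans (cong (gap H) (Fin.toℕ-injective (trans (suc-injective eq) (sym (Fin.toℕ-fromℕ p-1))))) last

      step : ∀ i st → Invariant (toℕ i) st → Invariant (suc (toℕ i)) (pass (gap H i) st)
      step i st (start , bound , inj , _) with toℕ i <? toℕ κ
      ... | no  i≮κ = (λ i<κ → contradiction i<κ i≮κ)
                    , pass-potential F g (gap H i) (1≤gap i) (gap-antitone (≮⇒≥ i≮κ)) st bound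
                    , (λ {x} {y} → pass-invariant (Injective ∘ proj₁) (gap H i) (λ a e i j _ inj {x} {y} → exchange-injective i j {a} inj {x} {y}) st inj {x} {y})
                    , last-sorts i st
      ... | yes i<κ with refl ← start (<⇒≤ i<κ)
                    with eq ← pass-ordered {h = gap H i} (a₀ , 0) (ordered i i<κ) =
                      (λ _ → eq)
                    , subst (λ st → F ≤ potential (proj₁ st) + proj₂ st * g) (sym eq) (m≤m+n F 0)
                    , (λ {x} {y} → subst (Injective ∘ proj₁) (sym eq) inj {x} {y})
                    , last-sorts i (a₀ , 0)

      final : Invariant (p H) (shellsort H a₀)
      final = foldl-tabulate (p H) Invariant id step
        ((λ _ → refl) , m≤m+n F 0 , permutation-injective n , λ ())

      F≤exchanges : F ≤ exchanges H a₀ * g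
      F≤exchanges with _ , bound , inj , sorted ← final =
        ≤-trans bound (≤-reflexive (cong (_+ exchanges H a₀ * g)
          (sorted-potential {proj₁ (shellsort H a₀)} (sorted refl) inj)))

    -- Members carry the keys below `size n`, so the left side is at most the initial potential. The
    -- final potential is 0, so exchanges of length at most `gap H κ` must have paid for all of it.
    ∑-excess≤W : ∑ 0 n (λ x → member x * (x ∸ T)) ≤ W n H * gap H κ
    ∑-excess≤W = begin
      ∑ 0 n (λ x → member x * (x ∸ T))   ≤⟨ ∑≤total n excess 0 _ (entry n) member≤ ⟩
      F                                  ≤⟨ F≤exchanges ⟩
      exchanges H a₀ * g                 ≤⟨ *-monoˡ-≤ g (exchanges≤W H (entry n) λ {i} {j} i≢j eq → i≢j (permutation-injective n
                                              (trans (Vec.lookup∘tabulate (entry n) i) (trans eq (sym (Vec.lookup∘tabulate (entry n) j)))))) ⟩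
      W n H * g                          ∎
      where
      open ≤-Reasoning
      member≤ : ∀ i → member (toℕ i) * (toℕ i ∸ T) ≤ excess (toℕ i) (entry n i)
      member≤ i = go (d (toℕ i)) refl
        where
        v = entry n i
        go : ∀ b → d (toℕ i) ≡ b → (if b then 1 else 0) * (toℕ i ∸ T) ≤ excess (toℕ i) v
        go false eq = z≤n
        go true  eq = ≤-reflexive (trans (*-identityˡ _) (sym (excess-below (toℕ i) v
          (subst (_< size n) (sym (Fin.toℕ-fromℕ< _)) (key-member n eq (Fin.toℕ<n i))))))

-- Simultaneous Diophantine approximation

-- a is within M/Q of a multiple of M; witnessed by a + (M q₁ + r₁) = M q₂ + r₂.
record NearMultiple (M Q a : ℕ) : Set where
  field
    q₁ r₁ q₂ r₂ : ℕ
    congruence : a + (r₁ + q₁ * M) ≡ r₂ + q₂ * M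
    upper : Q * r₁ ≤ Q * r₂ + M
    lower : Q * r₂ ≤ Q * r₁ + M

module _ (M Q : ℕ) .{{_ : NonZero M}} .{{_ : NonZero Q}} where

  box< : ∀ t → t % M * Q / M < Q
  box< t = m<n*o⇒m/o<n (subst (_< Q * M) (*-comm Q (t % M)) (*-monoʳ-< Q (m%n<n t M)))

  boxes : ∀ {k N} → (Fin k → ℕ) → Fin N → Fin k → Fin Q
  boxes h t i = fromℕ< (box< (toℕ t * h i))

-- Dirichlet's pigeonhole argument: the Q^k + 1 points (t h₁, …, t h_k) mod M
-- for t ≤ Q^k fall into Q^k boxes of side M/Q.
dirichlet : ∀ M Q k (h : Fin k → ℕ) .{{_ : NonZero M}} .{{_ : NonZero Q}} →
  Σ[ j ∈ ℕ ] 1 ≤ j × j ≤ Q ^ k × (∀ i → NearMultiple M Q (j * h i))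
dirichlet M Q k h with Fin.pigeonhole (n<1+n (Q ^ k)) (Fin.funToFin ∘ boxes M Q h)
... | s , t , s<t , same with m≤n⇒∃[o]m+o≡n (<⇒≤ s<t)
...   | j , s+j≡t = j , 1≤j , j≤ , near
  where
  1≤j : 1 ≤ j
  1≤j = +-cancelˡ-< (toℕ s) 0 j (subst₂ _<_ (sym (+-identityʳ (toℕ s))) (sym s+j≡t) s<t)
  j≤ : j ≤ Q ^ k
  j≤ = ≤-trans (m≤n+m j (toℕ s)) (≤-trans (≤-reflexive s+j≡t) (≤-pred (Fin.toℕ<n t)))
  -- Scaled by `Q`, both residues lie in the same interval [bM, (b + 1)M], where b is the common box
  -- number.
  close : ∀ u v → u % M * Q / M ≡ v % M * Q / M → Q * (u % M) ≤ Q * (v % M) + M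
  close u v eq = begin
    Q * (u % M)                                              ≡⟨ *-comm Q (u % M) ⟩
    u % M * Q                                                ≡⟨ m≡m%n+[m/n]*n (u % M * Q) M ⟩
    (u % M * Q) % M + (u % M * Q / M) * M                    ≤⟨ +-monoˡ-≤ _ (<⇒≤ (m%n<n (u % M * Q) M)) ⟩
    M + (u % M * Q / M) * M                                  ≡⟨ cong (λ b → M + b * M) eq ⟩
    M + (v % M * Q / M) * M                                  ≤⟨ +-monoʳ-≤ M (m/n*n≤m (v % M * Q) M) ⟩
    M + v % M * Q                                            ≡⟨ +-comm M _ ⟩
    v % M * Q + M                                            ≡⟨ cong (_+ M) (*-comm (v % M) Q) ⟩
    Q * (v % M) + M                                          ∎
    where open ≤-Reasoning
  near : ∀ i → NearMultiple M Q (j * h i)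
  near i = record
    { q₁ = x / M ; r₁ = x % M ; q₂ = y / M ; r₂ = y % M
    ; congruence = begin
        j * h i + (x % M + x / M * M)   ≡⟨ cong (j * h i +_) (m≡m%n+[m/n]*n x M) ⟨
        j * h i + x                     ≡⟨ +-comm (j * h i) x ⟩
        x + j * h i                     ≡⟨ *-distribʳ-+ (h i) (toℕ s) j ⟨
        (toℕ s + j) * h i               ≡⟨ cong (_* h i) s+j≡t ⟩
        y                               ≡⟨ m≡m%n+[m/n]*n y M ⟩
        y % M + y / M * M               ∎
    ; upper = close x y same-box
    ; lower = close y x (sym same-box)
    }
    where
    open ≡-Reasoning
    x = toℕ s * h i
    y = toℕ t * h i
    same-box : x % M * Q / M ≡ y % M * Q / M
    same-box = begin
      x % M * Q / M                                    ≡⟨ Fin.toℕ-fromℕ< (box< M Q x) ⟨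
      toℕ (boxes M Q h s i)                                  ≡⟨ cong toℕ (Fin.finToFun-funToFin (boxes M Q h s) i) ⟨
      toℕ (Fin.finToFun (Fin.funToFin (boxes M Q h s)) i)    ≡⟨ cong (λ c → toℕ (Fin.finToFun c i)) same ⟩
      toℕ (Fin.finToFun (Fin.funToFin (boxes M Q h t)) i)    ≡⟨ cong toℕ (Fin.finToFun-funToFin (boxes M Q h t) i) ⟩
      toℕ (boxes M Q h t i)                                  ≡⟨ Fin.toℕ-fromℕ< (box< M Q y) ⟩
      y % M * Q / M                                    ∎

-- The set of positions x for which j x mod 24μ lies in the interval
-- [5μ + 2μx/n, 19μ − 2μx/n]. The interval widens as x decreases, fast enough
-- to absorb the error made by a step back of an almost periodic length h.

module Band (n μ j : ℕ) (1≤n : 1 ≤ n) (1≤μ : 1 ≤ μ) where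

  -- The circle has 24 units of μ. As the tolerance varies by at most 2μ, residues in [7μ, 17μ] are
  -- good at every position up to n, and those below 5μ or above 19μ are bad at every position. Both
  -- of these arcs have length 10μ.
  M : ℕ
  M = 24 * μ

  instance
    M≢0 : NonZero M
    M≢0 = >-nonZero (≤-trans 1≤μ (m≤m+n μ _))

    n≢0 : NonZero n
    n≢0 = >-nonZero 1≤n

  ρ : ℕ → ℕ
  ρ x = j * x % M

  Good : ℕ → Set
  Good x = 5 * (μ * n) + 2 * (μ * x) ≤ n * ρ x × n * ρ x + 2 * (μ * x) ≤ 19 * (μ * n)

  good? : ∀ x → Dec (Good x)
  good? x = 5 * (μ * n) + 2 * (μ * x) ≤? n * ρ x ×-dec n * ρ x + 2 * (μ * x) ≤? 19 * (μ * n)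

  wrap : ∀ {a v} b c → a + b * M ≡ v + c * M → v < M → a % M ≡ v
  wrap {a} {v} b c eq v<M = begin
    a % M               ≡⟨ [m+kn]%n≡m%n a b M ⟨
    (a + b * M) % M     ≡⟨ cong (_% M) eq ⟩
    (v + c * M) % M     ≡⟨ [m+kn]%n≡m%n v c M ⟩
    v % M               ≡⟨ m<n⇒m%n≡m v<M ⟩
    v                   ∎
    where open ≡-Reasoning

  -- The error 24μ/(12ℓ) = 2μ/ℓ is at most 2μh/n, exactly what the tolerance gains between x + h and
  -- x.
  scaled-error : ∀ {ℓ h u v} → 1 ≤ ℓ → n ≤ ℓ * h → (12 * ℓ) * u ≤ (12 * ℓ) * v + M →
    n * u ≤ n * v + 2 * (μ * h)
  scaled-error {ℓ} {h} {u} {v} 1≤ℓ n≤ℓh u≤v = *-cancelˡ-≤ ℓ {{>-nonZero 1≤ℓ}} (begin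
    ℓ * (n * u)                        ≡⟨ e₁ ℓ n u ⟩
    n * (ℓ * u)                        ≤⟨ *-monoʳ-≤ n ℓu≤ ⟩
    n * (ℓ * v + 2 * μ)                ≡⟨ e₂ ℓ n v μ ⟩
    ℓ * (n * v) + 2 * (μ * n)          ≤⟨ +-monoʳ-≤ (ℓ * (n * v)) (*-monoʳ-≤ 2 (*-monoʳ-≤ μ n≤ℓh)) ⟩
    ℓ * (n * v) + 2 * (μ * (ℓ * h))    ≡⟨ e₃ ℓ (n * v) μ h ⟩
    ℓ * (n * v + 2 * (μ * h))          ∎)
    where
    open ≤-Reasoning
    e₁ : ∀ a b c → a * (b * c) ≡ b * (a * c)
    e₁ = solve-∀
    e₂ : ∀ ℓ n v μ → n * (ℓ * v + 2 * μ) ≡ ℓ * (n * v) + 2 * (μ * n)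
    e₂ = solve-∀
    e₃ : ∀ ℓ a μ h → ℓ * a + 2 * (μ * (ℓ * h)) ≡ ℓ * (a + 2 * (μ * h))
    e₃ = solve-∀
    e₄ : ∀ ℓ v μ → (12 * ℓ) * v + 24 * μ ≡ 12 * (ℓ * v + 2 * μ)
    e₄ = solve-∀
    ℓu≤ : ℓ * u ≤ ℓ * v + 2 * μ
    ℓu≤ = *-cancelˡ-≤ 12 (subst₂ _≤_ (*-assoc 12 ℓ u) (e₄ ℓ v μ) u≤v)

  -- Stepping back by h turns the residue ρ₀ into ρ₀ + r₁ - r₂ modulo `M`. This number lies in the
  -- wider band belonging to x, and the band stays inside [0, M), so no reduction takes place and it
  -- is `ρ x` itself.
  good-down : ∀ {ℓ h x} → 1 ≤ ℓ → n ≤ ℓ * h → NearMultiple M (12 * ℓ) (j * h) → x + h < n →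
    Good (x + h) → Good x
  good-down {ℓ} {h} {x} 1≤ℓ n≤ℓh near x+h<n (low , high) = low′ , high′
    where
    open NearMultiple near
    up : n * r₁ ≤ n * r₂ + 2 * (μ * h)
    up = scaled-error 1≤ℓ n≤ℓh upper
    dn : n * r₂ ≤ n * r₁ + 2 * (μ * h)
    dn = scaled-error 1≤ℓ n≤ℓh lower
    ρ₀ = ρ (x + h)
    -- Ensures that the truncated subtraction in `s` is exact.
    r₂≤ : r₂ ≤ ρ₀ + r₁
    r₂≤ = *-cancelˡ-≤ n (lin-≤ (n * r₂) (n * (ρ₀ + r₁)) (5 * (μ * n) + 2 * (μ * x)) (+-mono-≤ dn low)
      (e n r₁ r₂ μ h ρ₀ x))
      where
      e : ∀ n r₁ r₂ μ h ρ₀ x → n * r₂ + (5 * (μ * n) + 2 * (μ * x)) + (n * r₁ + 2 * (μ * h) + n * ρ₀)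
        ≡ n * (ρ₀ + r₁) + (n * r₂ + (5 * (μ * n) + 2 * (μ * (x + h))))
      e = solve-∀
    s = ρ₀ + r₁ ∸ r₂
    s+r₂ : s + r₂ ≡ ρ₀ + r₁
    s+r₂ = m∸n+n≡m r₂≤
    ns : n * s + n * r₂ ≡ n * ρ₀ + n * r₁
    ns = trans (sym (*-distribˡ-+ n s r₂)) (trans (cong (n *_) s+r₂) (*-distribˡ-+ n ρ₀ r₁))
    low-s : 5 * (μ * n) + 2 * (μ * x) ≤ n * s
    low-s = lin-≤ (5 * (μ * n) + 2 * (μ * x)) (n * s) 0 (+-mono-≤ (+-mono-≤ dn low) (≤-reflexive (sym ns)))
      (e n r₁ r₂ μ h ρ₀ x s)
      where
      e : ∀ n r₁ r₂ μ h ρ₀ x s → 5 * (μ * n) + 2 * (μ * x) + 0 + (n * r₁ + 2 * (μ * h) + n * ρ₀ + (n * s + n * r₂))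
        ≡ n * s + (n * r₂ + (5 * (μ * n) + 2 * (μ * (x + h))) + (n * ρ₀ + n * r₁))
      e = solve-∀
    high-s : n * s + 2 * (μ * x) ≤ 19 * (μ * n)
    high-s = lin-≤ (n * s + 2 * (μ * x)) (19 * (μ * n)) 0 (+-mono-≤ (+-mono-≤ up high) (≤-reflexive ns))
      (e n r₁ r₂ μ h ρ₀ x s)
      where
      e : ∀ n r₁ r₂ μ h ρ₀ x s → n * s + 2 * (μ * x) + 0 + (n * r₂ + 2 * (μ * h) + 19 * (μ * n) + (n * ρ₀ + n * r₁))
        ≡ 19 * (μ * n) + (n * r₁ + (n * ρ₀ + 2 * (μ * (x + h))) + (n * s + n * r₂))
      e = solve-∀
    s<M : s < M
    s<M = *-cancelˡ-< n s M (lin-≤ (1 + n * s) (n * M) (2 * (μ * x) + 4 * (μ * n))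
      (+-mono-≤ high-s (*-mono-≤ 1≤μ 1≤n)) (e n μ x s))
      where
      e : ∀ n μ x s → 1 + n * s + (2 * (μ * x) + 4 * (μ * n)) + (19 * (μ * n) + μ * n)
        ≡ n * (24 * μ) + (n * s + 2 * (μ * x) + 1)
      e = solve-∀
    ρ≡s : ρ x ≡ s
    ρ≡s = wrap {j * x} {s} q₂ (u + q₁) (+-cancelʳ-≡ r₂ _ _ (begin
      j * x + q₂ * M + r₂                      ≡⟨ e₁ (j * x) (q₂ * M) r₂ ⟩
      j * x + (r₂ + q₂ * M)                    ≡⟨ cong (j * x +_) congruence ⟨
      j * x + (j * h + (r₁ + q₁ * M))          ≡⟨ e₂ j x h (r₁ + q₁ * M) ⟩
      j * (x + h) + (r₁ + q₁ * M)              ≡⟨ cong (_+ (r₁ + q₁ * M)) (m≡m%n+[m/n]*n (j * (x + h)) M) ⟩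
      ρ₀ + u * M + (r₁ + q₁ * M)               ≡⟨ e₃ ρ₀ u M r₁ q₁ ⟩
      ρ₀ + r₁ + (u + q₁) * M                   ≡⟨ cong (_+ (u + q₁) * M) s+r₂ ⟨
      s + r₂ + (u + q₁) * M                    ≡⟨ e₄ s r₂ ((u + q₁) * M) ⟩
      s + (u + q₁) * M + r₂                    ∎)) s<M
      where
      open ≡-Reasoning
      u = j * (x + h) / M
      e₁ : ∀ a b c → a + b + c ≡ a + (c + b)
      e₁ = solve-∀
      e₂ : ∀ j x h c → j * x + (j * h + c) ≡ j * (x + h) + c
      e₂ = solve-∀
      e₃ : ∀ ρ u M r q → ρ + u * M + (r + q * M) ≡ ρ + r + (u + q) * M
      e₃ = solve-∀
      e₄ : ∀ a b c → a + b + c ≡ a + c + b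
      e₄ = solve-∀
    low′ = subst (λ v → 5 * (μ * n) + 2 * (μ * x) ≤ n * v) (sym ρ≡s) low-s
    high′ = subst (λ v → n * v + 2 * (μ * x) ≤ 19 * (μ * n)) (sym ρ≡s) high-s

-- Density of the good positions and of the bad ones

module Hits (n μ j : ℕ) (1≤n : 1 ≤ n) (1≤μ : 1 ≤ μ) (1≤j : 1 ≤ j) (j≤μ : j ≤ μ) where

  open Band n μ j 1≤n 1≤μ public

  private instance
    j≢0 : NonZero j
    j≢0 = >-nonZero 1≤j

  -- A shift by `τ` turns the circle by `σ`, a third of it up to a rounding error below j ≤ μ.
  τ σ : ℕ
  τ = 8 * μ / j
  σ = j * τ

  σ≤8μ : σ ≤ 8 * μ
  σ≤8μ = ≤-trans (≤-reflexive (*-comm j τ)) (m/n*n≤m (8 * μ) j)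

  7μ<σ : 7 * μ < σ
  7μ<σ = lin-≤ (1 + 7 * μ) σ 0 (+-mono-≤ (+-mono-≤ (m%n<n (8 * μ) j) j≤μ) (≤-reflexive 8μ≡)) (e μ j σ (8 * μ % j))
    where
    8μ≡ : 8 * μ ≡ 8 * μ % j + σ
    8μ≡ = trans (m≡m%n+[m/n]*n (8 * μ) j) (cong (8 * μ % j +_) (*-comm τ j))
    e : ∀ μ j σ r → 1 + 7 * μ + 0 + (j + μ + (r + σ)) ≡ σ + (1 + r + j + 8 * μ)
    e = solve-∀

  τ≤8μ : τ ≤ 8 * μ
  τ≤8μ = ≤-trans (m≤m*n τ j) (≤-trans (≤-reflexive (*-comm τ j)) σ≤8μ)

  ρ-shift : ∀ x t → ρ (x + t) ≡ (ρ x + j * t) % M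
  ρ-shift x t = begin
    j * (x + t) % M                          ≡⟨ cong (_% M) (*-distribˡ-+ j x t) ⟩
    (j * x + j * t) % M                      ≡⟨ cong (λ a → (a + j * t) % M) (m≡m%n+[m/n]*n (j * x) M) ⟩
    (ρ x + j * x / M * M + j * t) % M        ≡⟨ cong (_% M) (e (ρ x) (j * x / M * M) (j * t)) ⟩
    (ρ x + j * t + j * x / M * M) % M        ≡⟨ [m+kn]%n≡m%n (ρ x + j * t) (j * x / M) M ⟩
    (ρ x + j * t) % M                        ∎
    where
    open ≡-Reasoning
    e : ∀ a b c → a + b + c ≡ a + c + b
    e = solve-∀

  ρ-shift₂ : ∀ x → ρ (x + τ + τ) ≡ (ρ x + (σ + σ)) % M
  ρ-shift₂ x = trans (cong ρ (+-assoc x τ τ)) (trans (ρ-shift x (τ + τ)) (cong (λ a → (ρ x + a) % M) (*-distribˡ-+ j τ τ)))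

  good-at : ∀ {y v} → y ≤ n → 7 * μ ≤ v → v ≤ 17 * μ → ρ y ≡ v → Good y
  good-at {y} {v} y≤n lo hi refl =
      lin-≤ (5 * (μ * n) + 2 * (μ * y)) (n * v) 0 (+-mono-≤ (*-monoʳ-≤ n lo) (*-monoʳ-≤ 2 (*-monoʳ-≤ μ y≤n))) (e₁ n μ y v)
    , lin-≤ (n * v + 2 * (μ * y)) (19 * (μ * n)) 0 (+-mono-≤ (*-monoʳ-≤ n hi) (*-monoʳ-≤ 2 (*-monoʳ-≤ μ y≤n))) (e₂ n μ y v)
    where
    e₁ : ∀ n μ y v → 5 * (μ * n) + 2 * (μ * y) + 0 + (n * v + 2 * (μ * n)) ≡ n * v + (n * (7 * μ) + 2 * (μ * y))
    e₁ = solve-∀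
    e₂ : ∀ n μ y v → n * v + 2 * (μ * y) + 0 + (n * (17 * μ) + 2 * (μ * n)) ≡ 19 * (μ * n) + (n * v + 2 * (μ * y))
    e₂ = solve-∀

  bad-low : ∀ {y} → ρ y < 5 * μ → ¬ Good y
  bad-low {y} ρ<5μ (low , _) = <⇒≱ ρ<5μ (*-cancelˡ-≤ n (≤-trans (≤-reflexive (e n μ)) (≤-trans (m≤m+n _ _) low)))
    where
    e : ∀ n μ → n * (5 * μ) ≡ 5 * (μ * n)
    e = solve-∀

  bad-high : ∀ {y} → 19 * μ < ρ y → ¬ Good y
  bad-high {y} 19μ<ρ (_ , high) = <⇒≱ 19μ<ρ (*-cancelˡ-≤ n (≤-trans (≤-trans (m≤m+n _ _) high) (≤-reflexive (e n μ))))
    where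
    e : ∀ n μ → 19 * (μ * n) ≡ n * (19 * μ)
    e = solve-∀

  -- The bad arc passes through 0; unrolled, it runs from 19μ to 29μ. This allows residues to be
  -- treated before reduction.
  bad-at : ∀ {y v} → 19 * μ < v → v ≤ 28 * μ → ρ y ≡ v % M → ¬ Good y
  bad-at {y} {v} lo hi eq with v <? M
  ... | yes v<M = bad-high (subst (19 * μ <_) (sym (trans eq (m<n⇒m%n≡m v<M))) lo)
  ... | no  v≮M with w , w+M≡v ← m≤n⇒∃[o]m+o≡n (≮⇒≥ v≮M) = bad-low (subst (_< 5 * μ) (sym (trans eq v%M≡w)) w<5μ)
    where
    w<5μ : w < 5 * μ
    w<5μ = lin-≤ (1 + w) (5 * μ) 0 (+-mono-≤ (+-mono-≤ hi 1≤μ) (≤-reflexive w+M≡v)) (e μ w v)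
      where
      e : ∀ μ w v → 1 + w + 0 + (28 * μ + μ + v) ≡ 5 * μ + (v + 1 + (24 * μ + w))
      e = solve-∀
    v%M≡w : v % M ≡ w
    v%M≡w = wrap 0 1 (trans (+-identityʳ v) (trans (sym w+M≡v) (e M w))) (<-≤-trans w<5μ (*-monoˡ-≤ μ {5} {24} (m≤m+n 5 19)))
      where
      e : ∀ M w → M + w ≡ w + 1 * M
      e = solve-∀

  -- The three residues cut the circle into arcs of lengths σ, σ and 24μ - 2σ. Since 7μ < σ ≤ 8μ,
  -- all are shorter than 10μ, so no arc of length 10μ is missed; `bad-hit` holds for the same
  -- reason.
  good-hit : ∀ x → x + τ + τ ≤ n → Good x ⊎ Good (x + τ) ⊎ Good (x + τ + τ)
  good-hit x x≤n with ρ x <? 7 * μ | ρ x ≤? 17 * μ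
  ... | yes ρ<7μ | _ = inj₂ (inj₁ (good-at (≤-trans (m≤m+n (x + τ) τ) x≤n) (≤-trans (<⇒≤ 7μ<σ) (m≤n+m σ (ρ x))) v≤17μ
          (trans (ρ-shift x τ) (m<n⇒m%n≡m v<M))))
    where
    v≤17μ : ρ x + σ ≤ 17 * μ
    v≤17μ = lin-≤ (ρ x + σ) (17 * μ) (2 * μ) (+-mono-≤ (<⇒≤ ρ<7μ) σ≤8μ) (e μ (ρ x) σ)
      where
      e : ∀ μ ρ σ → ρ + σ + 2 * μ + (7 * μ + 8 * μ) ≡ 17 * μ + (ρ + σ)
      e = solve-∀
    v<M : ρ x + σ < M
    v<M = ≤-<-trans v≤17μ (*-monoˡ-< μ {{>-nonZero 1≤μ}} {17} {24} (m≤m+n 18 6))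
  ... | no ρ≮7μ | yes ρ≤17μ = inj₁ (good-at (≤-trans (m≤m+n x τ) (≤-trans (m≤m+n (x + τ) τ) x≤n)) (≮⇒≥ ρ≮7μ) ρ≤17μ refl)
  ... | no _ | no ρ≰17μ = inj₂ (inj₂ (good-at x≤n 7μ≤w w≤17μ
          (trans (ρ-shift₂ x) (wrap 0 1 (trans (+-identityʳ _) (trans (sym M+w≡v) (e₀ M w)))
            (≤-<-trans w≤17μ (*-monoˡ-< μ {{>-nonZero 1≤μ}} {17} {24} (m≤m+n 18 6)))))))
    where
    e₀ : ∀ M w → M + w ≡ w + 1 * M
    e₀ = solve-∀
    M≤v : M ≤ ρ x + (σ + σ)
    M≤v = lin-≤ M (ρ x + (σ + σ)) (7 * μ) (+-mono-≤ (<⇒≤ (≰⇒> ρ≰17μ)) (+-mono-≤ (<⇒≤ 7μ<σ) (<⇒≤ 7μ<σ))) (e μ (ρ x) σ)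
      where
      e : ∀ μ ρ σ → 24 * μ + 7 * μ + (ρ + (σ + σ)) ≡ ρ + (σ + σ) + (17 * μ + (7 * μ + 7 * μ))
      e = solve-∀
    w = ρ x + (σ + σ) ∸ M
    M+w≡v : M + w ≡ ρ x + (σ + σ)
    M+w≡v = m+[n∸m]≡n M≤v
    7μ≤w : 7 * μ ≤ w
    7μ≤w = lin-≤ (7 * μ) w 0 (+-mono-≤ (+-mono-≤ (<⇒≤ (≰⇒> ρ≰17μ)) (+-mono-≤ (<⇒≤ 7μ<σ) (<⇒≤ 7μ<σ))) (≤-reflexive (sym M+w≡v))) (e μ (ρ x) σ w)
      where
      e : ∀ μ ρ σ w → 7 * μ + 0 + (ρ + (σ + σ) + (24 * μ + w)) ≡ w + (17 * μ + (7 * μ + 7 * μ) + (ρ + (σ + σ)))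
      e = solve-∀
    w≤17μ : w ≤ 17 * μ
    w≤17μ = lin-≤ w (17 * μ) μ (+-mono-≤ (+-mono-≤ (<⇒≤ (m%n<n (j * x) M)) (+-mono-≤ σ≤8μ σ≤8μ)) (≤-reflexive M+w≡v)) (e μ (ρ x) σ w)
      where
      e : ∀ μ ρ σ w → w + μ + (24 * μ + (8 * μ + 8 * μ) + (ρ + (σ + σ))) ≡ 17 * μ + (ρ + (σ + σ) + (24 * μ + w))
      e = solve-∀

  bad-hit : ∀ x → ¬ Good x ⊎ ¬ Good (x + τ) ⊎ ¬ Good (x + τ + τ)
  bad-hit x with ρ x <? 5 * μ | ρ x ≤? 12 * μ | ρ x ≤? 19 * μ
  ... | yes ρ<5μ | _         | _         = inj₁ (bad-low ρ<5μ)
  ... | no ρ≮5μ  | yes ρ≤12μ | _         = inj₂ (inj₂ (bad-at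
          (lin-≤ (1 + 19 * μ) (ρ x + (σ + σ)) 1 (+-mono-≤ (≮⇒≥ ρ≮5μ) (+-mono-≤ 7μ<σ 7μ<σ)) (e₁ μ (ρ x) σ))
          (lin-≤ (ρ x + (σ + σ)) (28 * μ) 0 (+-mono-≤ ρ≤12μ (+-mono-≤ σ≤8μ σ≤8μ)) (e₂ μ (ρ x) σ))
          (ρ-shift₂ x)))
    where
    e₁ : ∀ μ ρ σ → 1 + 19 * μ + 1 + (ρ + (σ + σ)) ≡ ρ + (σ + σ) + (5 * μ + (1 + 7 * μ + (1 + 7 * μ)))
    e₁ = solve-∀
    e₂ : ∀ μ ρ σ → ρ + (σ + σ) + 0 + (12 * μ + (8 * μ + 8 * μ)) ≡ 28 * μ + (ρ + (σ + σ))
    e₂ = solve-∀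
  ... | no _     | no ρ≰12μ  | yes ρ≤19μ = inj₂ (inj₁ (bad-at
          (lin-≤ (1 + 19 * μ) (ρ x + σ) 1 (+-mono-≤ (≰⇒> ρ≰12μ) 7μ<σ) (e₁ μ (ρ x) σ))
          (lin-≤ (ρ x + σ) (28 * μ) μ (+-mono-≤ ρ≤19μ σ≤8μ) (e₂ μ (ρ x) σ))
          (ρ-shift x τ)))
    where
    e₁ : ∀ μ ρ σ → 1 + 19 * μ + 1 + (ρ + σ) ≡ ρ + σ + (1 + 12 * μ + (1 + 7 * μ))
    e₁ = solve-∀
    e₂ : ∀ μ ρ σ → ρ + σ + μ + (19 * μ + 8 * μ) ≡ 28 * μ + (ρ + σ)
    e₂ = solve-∀
  ... | no _     | no _      | no ρ≰19μ  = inj₁ (bad-high (≰⇒> ρ≰19μ))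

∑-* : ∀ b k (f : ℕ → ℕ) c → ∑ b k (λ x → f x * c) ≡ ∑ b k f * c
∑-* b zero    f c = refl
∑-* b (suc k) f c = trans (cong (f b * c +_) (∑-* (suc b) k f c)) (sym (*-distribʳ-+ c (f b) (∑ (suc b) k f)))

module Density (n μ j : ℕ) (1≤n : 1 ≤ n) (1≤μ : 1 ≤ μ) (1≤j : 1 ≤ j) (j≤μ : j ≤ μ) (76μ≤n : 76 * μ ≤ n) where

  open Hits n μ j 1≤n 1≤μ 1≤j j≤μ public

  d : ℕ → Bool
  d x = does (good? x)

  open Ranks d

  member-good : ∀ {x} → Good x → member x ≡ 1
  member-good {x} g = cong (if_then 1 else 0) (dec-true (good? x) g)

  nonmember-bad : ∀ {x} → ¬ Good x → nonmember x ≡ 1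
  nonmember-bad {x} ¬g = cong (if_then 0 else 1) (dec-false (good? x) ¬g)

  one-of-three : ∀ {P : ℕ → Set} (f : ℕ → ℕ) {x y z} → (∀ {x} → P x → f x ≡ 1) →
    P x ⊎ P y ⊎ P z → 1 ≤ f x + f y + f z
  one-of-three f {x} {y} {z} one (inj₁ px) = ≤-trans (≤-reflexive (sym (one px))) (≤-trans (m≤m+n (f x) (f y)) (m≤m+n _ (f z)))
  one-of-three f {x} {y} {z} one (inj₂ (inj₁ py)) = ≤-trans (≤-reflexive (sym (one py))) (≤-trans (m≤n+m (f y) (f x)) (m≤m+n _ (f z)))
  one-of-three f {x} {y} {z} one (inj₂ (inj₂ pz)) = ≤-trans (≤-reflexive (sym (one pz))) (m≤n+m (f z) _)

  private
    -- The threshold of the potential. Of the last 20μ positions, the first μ guarantee a distance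
    -- of μ, and the other 19μ contain enough members to be moved.
    N = n ∸ 20 * μ
    2τ≤19μ : τ + τ ≤ 19 * μ
    2τ≤19μ = ≤-trans (+-mono-≤ τ≤8μ τ≤8μ) (≤-trans (≤-reflexive (sym (*-distribʳ-+ μ 8 8))) (*-monoˡ-≤ μ {16} {19} (m≤m+n 16 3)))
    N≡ : N + 20 * μ ≡ n
    N≡ = m∸n+n≡m (≤-trans (*-monoˡ-≤ μ {20} {76} (m≤m+n 20 56)) 76μ≤n)

    -- 76 = 3 · 20 + 16: apart from a loss of 2τ ≤ 16μ, at least one position in three is bad.
    20μ≤nonmembers : 20 * μ ≤ rank⁻ n
    20μ≤nonmembers = *-cancelˡ-≤ 3 (lin-≤ (3 * (20 * μ)) (3 * rank⁻ n) 0 (+-mono-≤ (+-mono-≤ 76μ≤n dens) (+-mono-≤ τ≤8μ τ≤8μ))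
      (trans (cong (λ z → 3 * (20 * μ) + 0 + (z + 3 * rank⁻ n + (8 * μ + 8 * μ))) (sym k+2τ≡n)) (e μ k τ (rank⁻ n))))
      where
      k = n ∸ (τ + τ)
      k+2τ≡n : k + (τ + τ) ≡ n
      k+2τ≡n = m∸n+n≡m (≤-trans 2τ≤19μ (≤-trans (*-monoˡ-≤ μ {19} {76} (m≤m+n 19 57)) 76μ≤n))
      dens : k ≤ 3 * rank⁻ n
      dens = subst (λ l → k ≤ 3 * ∑ 0 l nonmember) k+2τ≡n
        (density nonmember 0 k τ λ x _ _ → one-of-three {λ y → ¬ Good y} nonmember nonmember-bad (bad-hit x))
      e : ∀ μ k τ c → 3 * (20 * μ) + 0 + (k + (τ + τ) + 3 * c + (8 * μ + 8 * μ)) ≡ 3 * c + (76 * μ + k + (τ + τ))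
      e = solve-∀

  size≤ : size n ≤ N
  size≤ = lin-≤ (size n) N 0 (+-mono-≤ 20μ≤nonmembers (≤-trans (≤-reflexive (rank-sum n)) (≤-reflexive (sym N≡)))) (e μ (size n) N (rank⁻ n))
    where
    e : ∀ μ s N c → s + 0 + (c + (N + 20 * μ)) ≡ N + (20 * μ + (s + c))
    e = solve-∀

  private
    -- The same count with 19 = 3 · 1 + 16.
    μ≤tail : μ ≤ ∑ (N + μ) (19 * μ) member
    μ≤tail = *-cancelˡ-≤ 3 (lin-≤ (3 * μ) (3 * ∑ (N + μ) (19 * μ) member) 0
      (+-mono-≤ (+-mono-≤ dens (+-mono-≤ τ≤8μ τ≤8μ)) (≤-reflexive (sym k+2τ≡)))
      (e μ k τ (∑ (N + μ) (19 * μ) member)))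
      where
      k = 19 * μ ∸ (τ + τ)
      k+2τ≡ : k + (τ + τ) ≡ 19 * μ
      k+2τ≡ = m∸n+n≡m 2τ≤19μ
      inRange : ∀ {x} → x < N + μ + k → x + τ + τ ≤ n
      inRange {x} x< = begin
        x + τ + τ               ≡⟨ +-assoc x τ τ ⟩
        x + (τ + τ)             ≤⟨ +-monoˡ-≤ (τ + τ) (<⇒≤ x<) ⟩
        N + μ + k + (τ + τ)     ≡⟨ +-assoc (N + μ) k (τ + τ) ⟩
        N + μ + (k + (τ + τ))   ≡⟨ cong (N + μ +_) k+2τ≡ ⟩
        N + μ + 19 * μ          ≡⟨ +-assoc N μ (19 * μ) ⟩
        N + 20 * μ              ≡⟨ N≡ ⟩
        n                       ∎
        where open ≤-Reasoning
      dens : k ≤ 3 * ∑ (N + μ) (19 * μ) member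
      dens = subst (λ l → k ≤ 3 * ∑ (N + μ) l member) k+2τ≡
        (density member (N + μ) k τ λ x _ x< → one-of-three {Good} member member-good (good-hit x (inRange x<)))
      e : ∀ μ k τ c → 3 * μ + 0 + (3 * c + (8 * μ + 8 * μ) + (k + (τ + τ))) ≡ 3 * c + (k + (τ + τ) + 19 * μ)
      e = solve-∀

  μ²≤∑ : μ * μ ≤ ∑ 0 n (λ x → member x * (x ∸ N))
  μ²≤∑ = begin
    μ * μ                                              ≤⟨ *-monoˡ-≤ μ μ≤tail ⟩
    ∑ (N + μ) (19 * μ) member * μ                      ≡⟨ ∑-* (N + μ) (19 * μ) member μ ⟨
    ∑ (N + μ) (19 * μ) (λ x → member x * μ)            ≤⟨ ∑-mono (N + μ) (19 * μ) (λ x N+μ≤x _ → *-monoʳ-≤ (member x)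
        (≤-trans (≤-reflexive (sym (m+n∸m≡n N μ))) (∸-monoˡ-≤ N N+μ≤x))) ⟩
    ∑ (N + μ) (19 * μ) (λ x → member x * (x ∸ N))      ≤⟨ ∑-window (N + μ) (19 * μ) 0 n _ z≤n
                                                            (≤-reflexive (trans (+-assoc N μ (19 * μ)) N≡)) ⟩
    ∑ 0 n (λ x → member x * (x ∸ N))                   ∎
    where open ≤-Reasoning

-- The cost of long gaps, and induction along the gap sequence

long-gaps-cost : ∀ n μ ℓ H (κ : Fin (p H)) → 1 ≤ μ → 1 ≤ ℓ → 76 * μ ≤ n → (12 * ℓ) ^ toℕ κ ≤ μ →
  (∀ i → i Fin.< κ → n ≤ ℓ * gap H i) → μ * μ ≤ W n H * gap H κ
long-gaps-cost n μ ℓ H κ 1≤μ 1≤ℓ 76μ≤n Q^κ≤μ long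
  -- The gaps approximated are those before `κ`, so the exponent in the bound on `j` is `κ`, and
  -- (12ℓ)^κ ≤ μ supplies the j ≤ μ required for density.
  with dirichlet (24 * μ) (12 * ℓ) (toℕ κ) (λ i → gap H (Fin.inject {i = κ} i))
         {{>-nonZero (≤-trans 1≤μ (m≤m+n μ _))}} {{>-nonZero (≤-trans 1≤ℓ (m≤m+n ℓ _))}}
... | j , 1≤j , j≤Q^κ , near = ≤-trans μ²≤∑ (∑-excess≤W H d _ size≤ κ down)
  where
  open Density n μ j (≤-trans (≤-trans 1≤μ (m≤m+n μ _)) 76μ≤n) 1≤μ 1≤j (≤-trans j≤Q^κ Q^κ≤μ) 76μ≤n
  down : ∀ i → i Fin.< κ → ∀ x → x + gap H i < n → d (x + gap H i) ≡ true → d x ≡ true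
  down i i<κ x x+h<n dxh = dec-true (good? x) (good-down 1≤ℓ (long i i<κ) near-i x+h<n (does⇒ (good? (x + gap H i)) dxh))
    where
    does⇒ : ∀ {A : Set} (a? : Dec A) → does a? ≡ true → A
    does⇒ (yes a) _ = a
    near-i : NearMultiple (24 * μ) (12 * ℓ) (j * gap H i)
    near-i = subst (λ i → NearMultiple (24 * μ) (12 * ℓ) (j * gap H i))
      (Fin.toℕ-injective (trans (Fin.toℕ-inject {i = κ} (fromℕ< i<κ)) (Fin.toℕ-fromℕ< i<κ))) (near (fromℕ< i<κ))

-- Abstract because unfolding the numerals is costly.
abstract
  costConstant : ℕ
  costConstant = 152 * 152

  next-gap : ∀ n ℓ H (κ : Fin (p H)) → 1 ≤ ℓ → 76 * (12 * ℓ) ^ toℕ κ ≤ n →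
    (∀ i → i Fin.< κ → n ≤ ℓ * gap H i) → n * n ≤ costConstant * W n H * gap H κ
  next-gap n ℓ H κ 1≤ℓ Q^κ≤n long = begin
    n * n                                  ≤⟨ *-mono-≤ n≤152μ n≤152μ ⟩
    152 * μ * (152 * μ)                    ≡⟨ e 152 μ ⟩
    152 * 152 * (μ * μ)                    ≤⟨ *-monoʳ-≤ (152 * 152) (long-gaps-cost n μ ℓ H κ 1≤μ 1≤ℓ 76μ≤n Q^κ≤μ long) ⟩
    152 * 152 * (W n H * gap H κ)          ≡⟨ *-assoc (152 * 152) (W n H) (gap H κ) ⟨
    costConstant * W n H * gap H κ         ∎
    where
    open ≤-Reasoning
    μ : ℕ
    μ = n / 76
    76μ≤n : 76 * μ ≤ n
    76μ≤n = ≤-trans (≤-reflexive (*-comm 76 μ)) (m/n*n≤m n 76)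
    Q^κ≤μ : (12 * ℓ) ^ toℕ κ ≤ μ
    Q^κ≤μ = ≤-trans (≤-reflexive (sym (m*n/n≡m ((12 * ℓ) ^ toℕ κ) 76)))
      (/-monoˡ-≤ 76 (≤-trans (≤-reflexive (*-comm ((12 * ℓ) ^ toℕ κ) 76)) Q^κ≤n))
    1≤μ : 1 ≤ μ
    1≤μ = ≤-trans (m^n>0 (12 * ℓ) {{>-nonZero (≤-trans 1≤ℓ (m≤m+n ℓ _))}} (toℕ κ)) Q^κ≤μ
    -- n < 76μ + 76, and μ ≥ 1.
    n≤152μ : n ≤ 152 * μ
    n≤152μ = lin-≤ n (152 * μ) 0 (+-mono-≤ (+-mono-≤ (≤-reflexive (m≡m%n+[m/n]*n n 76)) (<⇒≤ (m%n<n n 76))) (*-monoʳ-≤ 76 1≤μ))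
      (e′ n (n % 76) μ)
      where
      e′ : ∀ n r μ → n + 0 + (r + μ * 76 + 76 + 76 * μ) ≡ 152 * μ + (n + r + 76 * 1)
      e′ = solve-∀
    e : ∀ c μ → c * μ * (c * μ) ≡ c * c * (μ * μ)
    e = solve-∀

module LongGaps (n ℓ s : ℕ) (H : GapSequence) (1≤ℓ : 1 ≤ ℓ) (cost : costConstant * W n H ≤ ℓ * n)
  (Q^s≤n : 76 * (12 * ℓ) ^ s ≤ n) where

  private
    Q≢0 : NonZero (12 * ℓ)
    Q≢0 = >-nonZero (≤-trans 1≤ℓ (m≤m+n ℓ _))

    1≤n : 1 ≤ n
    1≤n = ≤-trans (m^n>0 (12 * ℓ) {{Q≢0}} s) (≤-trans (m≤m+n _ _) Q^s≤n)

    -- Strong induction on `κ`, with `m` as its bound: once all earlier gaps are long, n² ≤ C W g,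
    -- and C W ≤ ℓ n cancels one factor n.
    long : ∀ m κ → toℕ κ < m → toℕ κ ≤ s → n ≤ ℓ * gap H κ
    long (suc m) κ κ<m κ≤s = *-cancelˡ-≤ n {{>-nonZero 1≤n}} (begin
      n * n                               ≤⟨ next-gap n ℓ H κ 1≤ℓ Q^κ≤n (λ i i<κ →
                                               long m i (<-≤-trans i<κ (≤-pred κ<m)) (≤-trans (<⇒≤ i<κ) κ≤s)) ⟩
      costConstant * W n H * gap H κ      ≤⟨ *-monoˡ-≤ (gap H κ) cost ⟩
      ℓ * n * gap H κ                     ≡⟨ e ℓ n (gap H κ) ⟩
      n * (ℓ * gap H κ)                   ∎)
      where
      open ≤-Reasoning
      Q^κ≤n : 76 * (12 * ℓ) ^ toℕ κ ≤ n
      Q^κ≤n = ≤-trans (*-monoʳ-≤ 76 (^-monoʳ-≤ (12 * ℓ) {{Q≢0}} κ≤s)) Q^s≤n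
      e : ∀ a b c → a * b * c ≡ b * (a * c)
      e = solve-∀

  gap-long : ∀ κ → toℕ κ ≤ s → n ≤ ℓ * gap H κ
  gap-long κ = long (suc (toℕ κ)) κ ≤-refl

  -- Otherwise the last gap, 1, would be among the long ones and n ≤ ℓ. But s ≥ p ≥ 1 gives ℓ <
  -- (12ℓ)^s ≤ n.
  s<p : s < p H
  s<p = ≰⇒> λ p≤s → contradiction (gap-long (Fin.fromℕ p-1)
      (≤-trans (≤-reflexive (Fin.toℕ-fromℕ p-1)) (≤-trans (n≤1+n p-1) p≤s))) (<⇒≱ (begin-strict
    ℓ * gap H (Fin.fromℕ p-1)         ≡⟨ trans (cong (ℓ *_) last) (*-identityʳ ℓ) ⟩
    ℓ                                 <⟨ m<m+n ℓ (≤-trans 1≤ℓ (m≤m+n ℓ _)) ⟩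
    12 * ℓ                            ≤⟨ m≤m*n (12 * ℓ) ((12 * ℓ) ^ p-1) {{>-nonZero (m^n>0 (12 * ℓ) {{Q≢0}} p-1)}} ⟩
    (12 * ℓ) ^ suc p-1                ≤⟨ ^-monoʳ-≤ (12 * ℓ) {{Q≢0}} p≤s ⟩
    (12 * ℓ) ^ s                      ≤⟨ m≤m+n _ _ ⟩
    76 * (12 * ℓ) ^ s                 ≤⟨ Q^s≤n ⟩
    n                                 ∎))
    where
    open ≤-Reasoning
    open GapSequence H using (p-1; last)

-- From the induction to the asymptotic statements

open Analysis using (Tail; lnln-unbounded; power-≤; cost-factor-tail; gap-Ω; quotient-Ω; bounded-tail; scale-tail)

-- Moves the factor 76 into the base of the power. This needs a positive exponent; exponent 0 is
-- covered by 76 ≤ n.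
*-^-≤ : ∀ a b s → 1 ≤ a → a * b ^ suc s ≤ (a * b) ^ suc s
*-^-≤ a b s 1≤a = begin
  a * (b * b ^ s)      ≡⟨ *-assoc a b (b ^ s) ⟨
  a * b * b ^ s        ≤⟨ *-monoʳ-≤ (a * b) (^-monoˡ-≤ s (m≤n*m b a {{>-nonZero 1≤a}})) ⟩
  a * b * (a * b) ^ s  ∎
  where open ≤-Reasoning

abstract
  baseConstant : ℕ
  baseConstant = 76 * 12

  power-≤-baseConstant : ∀ ℓ s → 76 * (12 * ℓ) ^ suc s ≤ (baseConstant * ℓ) ^ suc s
  power-≤-baseConstant ℓ s = ≤-trans (*-^-≤ 76 (12 * ℓ) s (s≤s z≤n)) (≤-reflexive (cong (_^ suc s) (sym (*-assoc 76 12 ℓ))))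

greatest : ∀ {P : ℕ → Set} → (∀ s → Dec (P s)) → P 0 → ∀ m → ¬ P m → Σ[ s ∈ ℕ ] P s × ¬ P (suc s)
greatest P? P₀ zero    ¬P = contradiction P₀ ¬P
greatest P? P₀ (suc m) ¬P with P? m
... | yes Pm = m , Pm , ¬P
... | no ¬Pm = greatest P? P₀ m ¬Pm

initialSegment : ∀ n → ℕ → Subset n
initialSegment zero    k       = []
initialSegment (suc n) zero    = outside ∷ initialSegment n zero
initialSegment (suc n) (suc k) = inside ∷ initialSegment n k

∣initialSegment∣ : ∀ n k → k ≤ n → ∣ initialSegment n k ∣ ≡ k
∣initialSegment∣ zero    zero    k≤n       = refl
∣initialSegment∣ (suc n) zero    k≤n       = ∣initialSegment∣ n zero z≤n
∣initialSegment∣ (suc n) (suc k) (s≤s k≤n) = cong suc (∣initialSegment∣ n k k≤n)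

∈-initialSegment : ∀ n k {i} → i ∈ initialSegment n k → toℕ i < k
∈-initialSegment (suc n) zero    (there i∈) with () ← ∈-initialSegment n zero i∈
∈-initialSegment (suc n) (suc k) here       = s≤s z≤n
∈-initialSegment (suc n) (suc k) (there i∈) = s≤s (∈-initialSegment n k i∈)

module Family (H : ℕ → GapSequence) (c : ℝ) (0<c : 0ℝ <ℝ c) (K : ℝ) (N₀ : ℕ)
  (cheap : ∀ n (16≤n : 16 ≤ n) → N₀ ≤ n → fromℕ (W n (H n)) ≤ℝ K *ℝ (fromℕ n *ℝ ln^ n 16≤n c)) where

  A : ℕ
  A = suc (costConstant * suc (proj₁ (bounded-tail K)))

  δ : ℝ
  δ = fromℚ (r A)

  0<δ : 0ℝ <ℝ δ
  0<δ = fromℚ-mono-< (0<r A)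

  module _ (n : ℕ) (16≤n : 16 ≤ n) (N₀≤n : N₀ ≤ n) where

    private
      instance
        n≢0 : NonZero n
        n≢0 = >-nonZero (≤-trans (s≤s z≤n) 16≤n)
      cost = costConstant * W n (H n)

    abstract
      ℓ : ℕ
      -- `suc` rounds up and keeps `ℓ` positive.
      ℓ = suc (cost / n)

      1≤ℓ : 1 ≤ ℓ
      1≤ℓ = s≤s z≤n

      cost≤ℓn : cost ≤ ℓ * n
      cost≤ℓn = ≤-trans (≤-reflexive (m≡m%n+[m/n]*n cost n)) (+-monoˡ-≤ (cost / n * n) (<⇒≤ (m%n<n cost n)))

      ℓn≤cost+n : ℓ * n ≤ cost + n
      ℓn≤cost+n = ≤-trans (≤-reflexive (+-comm n (cost / n * n))) (+-monoˡ-≤ n (m/n*n≤m cost n))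

    ℓ-tail : Tail (λ k → ι ℓ ℚ.≤ ι A ℚ.* ℝ.seq (ln^ n 16≤n c) k)
    ℓ-tail = cost-factor-tail c 0<c K costConstant n 16≤n (W n (H n)) ℓ (cheap n 16≤n N₀≤n) ℓn≤cost+n

    Affordable : ℕ → Set
    Affordable s = 76 * (12 * ℓ) ^ s ≤ n

    -- The base `baseConstant * ℓ` is at most a constant times (log n)^c, and ε log log n exceeds
    -- that constant by 3, the slack that `power-≤` requires.
    affordable : ∀ ε (0<ε : 0ℝ <ℝ ε) → 76 ≤ n →
      Tail (λ k → ι (3 + baseConstant * A) ℚ.≤ ℝ.seq ε k ℚ.* ℝ.seq (lnln n 16≤n) k) →
      ∀ s → fromℕ s ≤ℝ ln/lnln n 16≤n (c +ℝ ε) (0<x+y {c} {ε} 0<c 0<ε) → Affordable s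
    affordable ε 0<ε 76≤n unbounded zero    s≤ = 76≤n
    affordable ε 0<ε 76≤n unbounded (suc s) s≤ = ≤-trans (power-≤-baseConstant ℓ s)
      (power-≤ c ε 0<c 0<ε (baseConstant * A) n 16≤n unbounded (baseConstant * ℓ) (suc s)
        (scale-tail baseConstant (ln^ n 16≤n c) ℓ-tail) s≤)

    module _ (s : ℕ) (s-affordable : Affordable s) where

      open LongGaps n ℓ s (H n) 1≤ℓ cost≤ℓn s-affordable public using (s<p; gap-long)

      gap-large : ∀ i → toℕ i ≤ s → δ *ℝ n/ln^ n 16≤n c ≤ℝ fromℕ (gap (H n) i)
      gap-large i i≤s = gap-Ω c n 16≤n A ℓ (gap (H n) i) (gap-long i i≤s) ℓ-tail

    -- Affordability forces s < p, so `p (H n)` is a failing index to descend from. The search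
    -- replaces the floor of a real quotient, which cannot be computed because the order of ℝ is not
    -- decidable, by a decidable condition on naturals.
    greatest-affordable : 76 ≤ n → Σ[ s ∈ ℕ ] Affordable s × ¬ Affordable (suc s)
    greatest-affordable 76≤n = greatest {Affordable} (λ s → 76 * (12 * ℓ) ^ s ≤? n) 76≤n (p (H n))
      λ Q^p≤n → <-irrefl refl (s<p (p (H n)) Q^p≤n)

theoremC5 :
    (H : ℕ → GapSequence) (c : ℝ) (0<c : 0ℝ <ℝ c) →
    (λ n _ → fromℕ (W n (H n))) =O (λ n 16≤n → fromℕ n *ℝ ln^ n 16≤n c) →
    ((ε : ℝ) (0<ε : 0ℝ <ℝ ε) →
      Σ[ δ ∈ ℝ ] 0ℝ <ℝ δ ×
      Eventually (λ n 16≤n → (s : ℕ) → IsFloor s (ln/lnln n 16≤n (c +ℝ ε) (0<x+y {c} {ε} 0<c 0<ε)) →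
        Σ[ s<p ∈ s < p (H n) ]
          δ *ℝ n/ln^ n 16≤n c ≤ℝ fromℕ (gap (H n) (fromℕ< s<p))))
    ×
    (Σ[ κ ∈ ℝ ] 0ℝ <ℝ κ × (Σ[ δ ∈ ℝ ] 0ℝ <ℝ δ ×
      Eventually (λ n 16≤n → Σ[ S ∈ Subset (p (H n)) ]
        κ *ℝ (ln n 16≤n /ℝ lnln n 16≤n [ 0<lnln n 16≤n ]) ≤ℝ fromℕ ∣ S ∣ ×
        (∀ i → i ∈ S → δ *ℝ n/ln^ n 16≤n c ≤ℝ fromℕ (gap (H n) i)))))
theoremC5 H c 0<c (K , 0<K , N₀ , cheap) = first , second
  where
  open Family H c 0<c K N₀ cheap

  first : (ε : ℝ) (0<ε : 0ℝ <ℝ ε) →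
      Σ[ δ ∈ ℝ ] 0ℝ <ℝ δ ×
      Eventually (λ n 16≤n → (s : ℕ) → IsFloor s (ln/lnln n 16≤n (c +ℝ ε) (0<x+y {c} {ε} 0<c 0<ε)) →
        Σ[ s<p ∈ s < p (H n) ]
          δ *ℝ n/ln^ n 16≤n c ≤ℝ fromℕ (gap (H n) (fromℕ< s<p)))
  first ε 0<ε = δ , 0<δ , N₀ + (N₁ + 76) , λ n 16≤n N≤n s (s≤ , _) →
    let N₀≤n = ≤-trans (m≤m+n N₀ _) N≤n
        N₁≤n = ≤-trans (≤-trans (m≤m+n N₁ 76) (m≤n+m _ N₀)) N≤n
        76≤n = ≤-trans (≤-trans (m≤n+m 76 N₁) (m≤n+m _ N₀)) N≤n
        Q^s≤n = affordable n 16≤n N₀≤n ε 0<ε 76≤n (unbounded n 16≤n N₁≤n) s s≤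
        s<p′ = s<p n 16≤n N₀≤n s Q^s≤n
    -- Gaps are indexed from 0, so index `s` is the gap h_{s+1}.
    in s<p′ , gap-large n 16≤n N₀≤n s Q^s≤n (fromℕ< s<p′) (≤-reflexive (Fin.toℕ-fromℕ< s<p′))
    where
    N₁ = proj₁ (lnln-unbounded ε 0<ε (3 + baseConstant * A))
    unbounded = proj₂ (lnln-unbounded ε 0<ε (3 + baseConstant * A))

  second : Σ[ κ ∈ ℝ ] 0ℝ <ℝ κ × (Σ[ δ ∈ ℝ ] 0ℝ <ℝ δ ×
      Eventually (λ n 16≤n → Σ[ S ∈ Subset (p (H n)) ]
        κ *ℝ (ln n 16≤n /ℝ lnln n 16≤n [ 0<lnln n 16≤n ]) ≤ℝ fromℕ ∣ S ∣ ×
        (∀ i → i ∈ S → δ *ℝ n/ln^ n 16≤n c ≤ℝ fromℕ (gap (H n) i))))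
  second = fromℚ (r B) , fromℚ-mono-< (0<r B) , δ , 0<δ , N₀ + (N₁ + 76) , λ n 16≤n N≤n →
    let N₀≤n = ≤-trans (m≤m+n N₀ _) N≤n
        N₁≤n = ≤-trans (≤-trans (m≤m+n N₁ 76) (m≤n+m _ N₀)) N≤n
        76≤n = ≤-trans (≤-trans (m≤n+m 76 N₁) (m≤n+m _ N₀)) N≤n
        (s , Q^s≤n , Q^1+s≰n) = greatest-affordable n 16≤n N₀≤n 76≤n
    -- The s + 1 indices 0, ..., s. For an Ω bound the fixed choice ε = 1 suffices: as s + 1 is not
    -- affordable, it cannot be at most log n / ((c + 1) log log n), so the reverse inequality
    -- holds.
    in initialSegment (p (H n)) (suc s)
     , subst (λ t → fromℚ (r B) *ℝ (ln n 16≤n /ℝ lnln n 16≤n [ 0<lnln n 16≤n ]) ≤ℝ fromℕ t)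
         (sym (∣initialSegment∣ (p (H n)) (suc s) (s<p n 16≤n N₀≤n s Q^s≤n)))
         (quotient-Ω (c +ℝ 1ℝ) 0<c+1 n 16≤n (suc s) λ s≤ →
           Q^1+s≰n (affordable n 16≤n N₀≤n 1ℝ 0<1 76≤n (unbounded n 16≤n N₁≤n) (suc s) s≤))
     , λ i i∈ → gap-large n 16≤n N₀≤n s Q^s≤n i (≤-pred (∈-initialSegment (p (H n)) (suc s) i∈))
    where
    1ℝ = fromℕ 1
    0<1 : 0ℝ <ℝ 1ℝ
    0<1 = fromℚ-mono-< (0<r 0)
    0<c+1 = 0<x+y {c} {1ℝ} 0<c 0<1
    B = proj₁ (bounded-tail (c +ℝ 1ℝ))
    N₁ = proj₁ (lnln-unbounded 1ℝ 0<1 (3 + baseConstant * A))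
    unbounded = proj₂ (lnln-unbounded 1ℝ 0<1 (3 + baseConstant * A))
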